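{- Let $\mathfrak{m}\mathrm{LPoset}$ be the linearly compact $\mathbb{Z}[\beta]$-module with pseudobasis the set of isomorphism classes $[(P,\gamma)]$ of (finite) labeled posets. With respect to the continuous linear operations $\nabla,\Delta,\iota,\epsilon$ determined by $$\nabla([(P,\gamma)]\otimes[(Q,\delta)])=[(P,\gamma)\sqcup(Q,\delta)],\qquad \Delta([(P,\gamma)])=\sum_{S\cup T=P}\beta^{|S\cap T|}\,[(S,\gamma)]\otimes[(T,\gamma)],$$ where the second sum is over all ordered pairs $(S,T)$ of subsets of $P$ such that $S$ is a lower set, $T$ is an upper set, $P=S\cup T$, and $S\cap T$ is an antichain, with $\iota(1)=[\varnothing]$ the class of the empty labeled poset, and $\epsilon([(P,\gamma)])=1$ if $P=\varnothing$ and $0$ otherwise, the module $\mathfrak{m}\mathrm{LPoset}$ is a commutative LC-Hopf algebra over $\mathbb{Z}[\beta]$.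
   Context: Labeled posets. A labeled poset $(P,\gamma)$ is a finite poset $P$ with an injective map $\gamma:P\to\mathbb{Z}$. Write $s\lessdot t$ if $t$ covers $s$. $(P,\gamma)\cong(Q,\delta)$ if there is a poset isomorphism $\phi:P\to Q$ such that for every cover $s\lessdot t$ in $P$ one has $\gamma(s)>\gamma(t)$ iff $\delta(\phi(s))>\delta(\phi(t))$; $[(P,\gamma)]$ is the isomorphism class. For $S\subseteq P$, $(S,\gamma)$ means $S$ with the induced order and labeling $\gamma|_S$. The disjoint union $(P,\gamma)\sqcup(Q,\delta)$ is the disjoint union of posets with labeling $s\mapsto\gamma(s)-\max_P\gamma$ for $s\in P$ and $s\mapsto\delta(s)-\min_Q\delta+1$ for $s\in Q$. A lower set (resp. upper set) $S\subseteq P$ is one such that $x<y$ and $y\in S$ (resp. $x\in S$) imply $x\in S$ (resp. $y\in S$). An antichain is a subset containing no two elements $x<y$. Linearly compact modules. Let $R=\mathbb{Z}[\beta]$ (discrete topology). If $A$ is a free $R$-module, $B$ an $R$-module, and $\langle\cdot,\cdot\rangle:A\times B\to R$ is $R$-bilinear with $b\mapsto\langle\cdot,b\rangle$ a bijection $B\to\mathrm{Hom}_R(A,R)$, then $B$ with the coarsest topology making every $\langle a,\cdot\rangle$ continuous is a linearly compact (LC-) module dual to $A$. If $\{a_i\}$ is a basis of $A$, the elements $b_j$ with $\langle a_i,b_j\rangle=\delta_{ij}$ form a pseudobasis of $B$; elements of $B$ are arbitrary (possibly infinite) $R$-linear combinations of the $b_j$. $B\hat\otimes B'=\mathrm{Hom}_R(A\otimes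 A',R)$ is the LC-module with pseudobasis $\{b_i\otimes b'_j\}$. Continuous linear maps are exactly the adjoints of linear maps between the dual free modules. An LC-(co/bi/Hopf) algebra is an LC-module $B$ with continuous linear structure maps ($\nabla:B\hat\otimes B\to B$, $\iota:R\to B$, $\Delta:B\to B\hat\otimes B$, $\epsilon:B\to R$) whose adjoints make the dual free module $A$ an ordinary algebra/coalgebra/bialgebra/Hopf algebra (product of $B$ dual to coproduct of $A$, etc.); the antipode of $B$ is the adjoint of the antipode of $A$. -}

module Defs where

open import Algebra.Bundles using (CommutativeRing)
open import Algebra.Module.Bundles using (LeftModule)
open import Algebra.Module.Morphism.Structures using (module LeftModuleMorphisms)
import Algebra.Properties.Semiring.Exp as Exp
import Algebra.Module.Construct.TensorUnit as TensorUnit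
import Algebra.Module.Properties.LeftModule as LeftModuleProperties
import Algebra.Properties.Group as GroupProperties
open import Data.Bool.Base as Bool using (Bool; false; T; if_then_else_)
open import Data.Bool.Properties as Bool using (T?)
open import Data.Fin.Base using (Fin; zero; suc; splitAt; _↑ˡ_; _↑ʳ_)
open import Data.Fin.Properties as Fin using (all?; any?)
open import Data.Fin.Subset using (Subset; inside; outside; _∈_; _∩_; _∪_; ∣_∣) renaming (⊤ to full)
open import Data.Fin.Subset.Properties using (_∈?_)
open import Data.Integer.Base as ℤ using (ℤ; 0ℤ; 1ℤ)
import Data.Integer.Properties as ℤ
open import Data.List.Base as List using (List; []; _∷_; foldr; filter; cartesianProduct; _++_)
open import Data.List.Relation.Unary.All using (All)
open import Data.Nat.Base as ℕ using (ℕ; zero; suc)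
import Data.Nat.Properties as ℕ
open import Data.Product using (∃; _×_; _,_; proj₁; proj₂; uncurry)
open import Data.Product.Relation.Binary.Pointwise.NonDependent using (×-setoid)
open import Data.Sum.Base using (_⊎_; inj₁; inj₂; [_,_]′)
open import Data.Unit.Base using (⊤; tt)
open import Data.Vec.Base using (Vec; []; _∷_; lookup; tabulate)
import Data.Vec.Properties as Vec
open import Function.Base using (_∘_; id)
open import Function.Bundles using (Func; _⇔_; mk⇔; Equivalence)
open import Function.Definitions using (Injective; Bijective)
open import Level using (0ℓ)
open import Relation.Binary.Bundles using (Setoid; DecSetoid)
open import Relation.Binary.Core using (Rel)
open import Relation.Binary.Definitions using (Decidable)
open import Relation.Binary.Morphism.Structures using (IsOrderIsomorphism)
open import Relation.Binary.PropositionalEquality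
  using (_≡_; _≢_; refl; sym; trans; cong; cong₂; subst; subst₂)
open import Relation.Binary.PropositionalEquality.Properties as ≡ using (isEquivalence)
import Relation.Binary.Reasoning.Setoid as SetoidReasoning
open import Relation.Binary.Structures using (IsPartialOrder)
open import Relation.Nullary.Decidable
  using (Dec; does; does-⇔; map′; _×-dec_; _→-dec_; ¬?)
open import Relation.Nullary.Negation using (¬_; contradiction)

-- A polynomial is its list of coefficients, constant term first; trailing
-- zeros are ignored by the equality.

module Polynomials where

  Poly : Set
  Poly = List ℤ

  coeff : Poly → ℕ → ℤ
  coeff []      n       = 0ℤ
  coeff (a ∷ p) zero    = a
  coeff (a ∷ p) (suc n) = coeff p n

  infix 4 _≈_

  record _≈_ (p q : Poly) : Set where
    constructor mk
    field coeff-≡ : ∀ n → coeff p n ≡ coeff q n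

  open _≈_ public

  infixl 6 _+_
  infixl 7 _*_
  infixr 7 _·_

  _+_ : Poly → Poly → Poly
  []      + q       = q
  (a ∷ p) + []      = a ∷ p
  (a ∷ p) + (b ∷ q) = a ℤ.+ b ∷ p + q

  _·_ : ℤ → Poly → Poly
  a · p = List.map (a ℤ.*_) p

  -_ : Poly → Poly
  - p = List.map ℤ.-_ p

  _*_ : Poly → Poly → Poly
  []      * q = []
  (a ∷ p) * q = a · q + (0ℤ ∷ p * q)

  private
    coeff-+ : ∀ p q n → coeff (p + q) n ≡ coeff p n ℤ.+ coeff q n
    coeff-+ []      q       n       = sym (ℤ.+-identityˡ _)
    coeff-+ (a ∷ p) []      n       = sym (ℤ.+-identityʳ _)
    coeff-+ (a ∷ p) (b ∷ q) zero    = refl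
    coeff-+ (a ∷ p) (b ∷ q) (suc n) = coeff-+ p q n

    coeff-· : ∀ a p n → coeff (a · p) n ≡ a ℤ.* coeff p n
    coeff-· a []      n       = sym (ℤ.*-zeroʳ a)
    coeff-· a (b ∷ p) zero    = refl
    coeff-· a (b ∷ p) (suc n) = coeff-· a p n

    coeff-neg : ∀ p n → coeff (- p) n ≡ ℤ.- coeff p n
    coeff-neg []      n       = refl
    coeff-neg (b ∷ p) zero    = refl
    coeff-neg (b ∷ p) (suc n) = coeff-neg p n

    ≈-refl : ∀ {p} → p ≈ p
    ≈-refl = mk λ _ → refl

    ≈-sym : ∀ {p q} → p ≈ q → q ≈ p
    ≈-sym e = mk λ n → sym (coeff-≡ e n)

    ≈-trans : ∀ {p q r} → p ≈ q → q ≈ r → p ≈ r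
    ≈-trans e f = mk λ n → trans (coeff-≡ e n) (coeff-≡ f n)

    setoid : Setoid 0ℓ 0ℓ
    setoid = record
      { Carrier       = Poly
      ; _≈_           = _≈_
      ; isEquivalence = record { refl = ≈-refl ; sym = ≈-sym ; trans = ≈-trans }
      }

    open SetoidReasoning setoid

    +-cong : ∀ {p q r s} → p ≈ q → r ≈ s → p + r ≈ q + s
    +-cong {p} {q} {r} {s} e f = mk λ n →
      trans (coeff-+ p r n)
        (trans (cong₂ ℤ._+_ (coeff-≡ e n) (coeff-≡ f n)) (sym (coeff-+ q s n)))

    +-congˡ : ∀ {p q r} → q ≈ r → p + q ≈ p + r
    +-congˡ = +-cong ≈-refl

    +-congʳ : ∀ {p q r} → q ≈ r → q + p ≈ r + p
    +-congʳ e = +-cong e ≈-refl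

    +-assoc : ∀ p q r → (p + q) + r ≈ p + (q + r)
    +-assoc p q r = mk λ n →
      trans (coeff-+ (p + q) r n)
        (trans (cong (ℤ._+ coeff r n) (coeff-+ p q n))
          (trans (ℤ.+-assoc (coeff p n) (coeff q n) (coeff r n))
            (trans (cong (λ z → coeff p n ℤ.+ z) (sym (coeff-+ q r n)))
              (sym (coeff-+ p (q + r) n)))))

    +-comm : ∀ p q → p + q ≈ q + p
    +-comm p q = mk λ n →
      trans (coeff-+ p q n)
        (trans (ℤ.+-comm (coeff p n) (coeff q n)) (sym (coeff-+ q p n)))

    +-identityʳ : ∀ p → p + [] ≈ p
    +-identityʳ p = +-comm p []

    neg-cong : ∀ {p q} → p ≈ q → - p ≈ - q
    neg-cong {p} {q} e = mk λ n →
      trans (coeff-neg p n) (trans (cong ℤ.-_ (coeff-≡ e n)) (sym (coeff-neg q n)))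

    neg-inverseˡ : ∀ p → - p + p ≈ []
    neg-inverseˡ p = mk λ n →
      trans (coeff-+ (- p) p n)
        (trans (cong (ℤ._+ coeff p n) (coeff-neg p n)) (ℤ.+-inverseˡ (coeff p n)))

    neg-inverseʳ : ∀ p → p + - p ≈ []
    neg-inverseʳ p = ≈-trans (+-comm p (- p)) (neg-inverseˡ p)

    medial : ∀ p q r s → (p + q) + (r + s) ≈ (p + r) + (q + s)
    medial p q r s = begin
      (p + q) + (r + s) ≈⟨ +-assoc p q (r + s) ⟩
      p + (q + (r + s)) ≈⟨ +-congˡ {p} (+-assoc q r s) ⟨
      p + ((q + r) + s) ≈⟨ +-congˡ {p} (+-congʳ (+-comm q r)) ⟩
      p + ((r + q) + s) ≈⟨ +-congˡ {p} (+-assoc r q s) ⟩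
      p + (r + (q + s)) ≈⟨ +-assoc p r (q + s) ⟨
      (p + r) + (q + s) ∎

    ∷-cong : ∀ {a p q} → p ≈ q → a ∷ p ≈ a ∷ q
    ∷-cong e = mk λ { zero → refl ; (suc n) → coeff-≡ e n }

    shift-[] : 0ℤ ∷ [] ≈ []
    shift-[] = mk λ { zero → refl ; (suc n) → refl }

    ·-cong : ∀ a {p q} → p ≈ q → a · p ≈ a · q
    ·-cong a {p} {q} e = mk λ n →
      trans (coeff-· a p n) (trans (cong (a ℤ.*_) (coeff-≡ e n)) (sym (coeff-· a q n)))

    ·-distribˡ : ∀ a p q → a · (p + q) ≈ a · p + a · q
    ·-distribˡ a p q = mk λ n →
      trans (coeff-· a (p + q) n)
        (trans (cong (a ℤ.*_) (coeff-+ p q n))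
          (trans (ℤ.*-distribˡ-+ a (coeff p n) (coeff q n))
            (trans (sym (cong₂ ℤ._+_ (coeff-· a p n) (coeff-· a q n)))
              (sym (coeff-+ (a · p) (a · q) n)))))

    ·-distribʳ : ∀ a b p → (a ℤ.+ b) · p ≈ a · p + b · p
    ·-distribʳ a b p = mk λ n →
      trans (coeff-· (a ℤ.+ b) p n)
        (trans (ℤ.*-distribʳ-+ (coeff p n) a b)
          (trans (sym (cong₂ ℤ._+_ (coeff-· a p n) (coeff-· b p n)))
            (sym (coeff-+ (a · p) (b · p) n))))

    ·-assoc : ∀ a b p → (a ℤ.* b) · p ≈ a · b · p
    ·-assoc a b p = mk λ n →
      trans (coeff-· (a ℤ.* b) p n)
        (trans (ℤ.*-assoc a b (coeff p n))
          (trans (cong (a ℤ.*_) (sym (coeff-· b p n)))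
            (sym (coeff-· a (b · p) n))))

    ·-zeroˡ : ∀ p → 0ℤ · p ≈ []
    ·-zeroˡ p = mk λ n → coeff-· 0ℤ p n

    ·-identityˡ : ∀ p → 1ℤ · p ≈ p
    ·-identityˡ p = mk λ n → trans (coeff-· 1ℤ p n) (ℤ.*-identityˡ (coeff p n))

    ·-shift : ∀ a p → a · (0ℤ ∷ p) ≈ 0ℤ ∷ a · p
    ·-shift a p = mk λ { zero → ℤ.*-zeroʳ a ; (suc n) → refl }

    *-congˡ : ∀ p {q r} → q ≈ r → p * q ≈ p * r
    *-congˡ []      e = ≈-refl
    *-congˡ (a ∷ p) e = +-cong (·-cong a e) (∷-cong (*-congˡ p e))

    *-zeroʳ : ∀ p → p * [] ≈ []
    *-zeroʳ []      = ≈-refl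
    *-zeroʳ (a ∷ p) = ≈-trans (∷-cong (*-zeroʳ p)) shift-[]

    swap-heads : ∀ a b (p q r : Poly) →
      (a ℤ.* b ∷ a · q) + (0ℤ ∷ (b · p + r)) ≈ (b ℤ.* a ∷ b · p) + (0ℤ ∷ (a · q + r))
    swap-heads a b p q r = mk λ
      { zero    → cong (ℤ._+ 0ℤ) (ℤ.*-comm a b)
      ; (suc n) → coeff-≡ lem n
      }
      where
      lem : a · q + (b · p + r) ≈ b · p + (a · q + r)
      lem = begin
        a · q + (b · p + r) ≈⟨ +-assoc (a · q) (b · p) r ⟨
        (a · q + b · p) + r ≈⟨ +-congʳ (+-comm (a · q) (b · p)) ⟩
        (b · p + a · q) + r ≈⟨ +-assoc (b · p) (a · q) r ⟩
        b · p + (a · q + r) ∎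

    *-∷ : ∀ p b q → p * (b ∷ q) ≈ b · p + (0ℤ ∷ p * q)
    *-∷ []      b q = ≈-sym shift-[]
    *-∷ (a ∷ p) b q = begin
      (a ℤ.* b ∷ a · q) + (0ℤ ∷ p * (b ∷ q))
        ≈⟨ +-congˡ {a ℤ.* b ∷ a · q} (∷-cong (*-∷ p b q)) ⟩
      (a ℤ.* b ∷ a · q) + (0ℤ ∷ (b · p + (0ℤ ∷ p * q)))
        ≈⟨ swap-heads a b p q (0ℤ ∷ p * q) ⟩
      (b ℤ.* a ∷ b · p) + (0ℤ ∷ (a · q + (0ℤ ∷ p * q))) ∎

    *-comm : ∀ p q → p * q ≈ q * p
    *-comm []      q = ≈-sym (*-zeroʳ q)
    *-comm (a ∷ p) q = begin
      a · q + (0ℤ ∷ p * q) ≈⟨ +-congˡ {a · q} (∷-cong (*-comm p q)) ⟩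
      a · q + (0ℤ ∷ q * p) ≈⟨ *-∷ q a p ⟨
      q * (a ∷ p)          ∎

    *-cong : ∀ {p q r s} → p ≈ q → r ≈ s → p * r ≈ q * s
    *-cong {p} {q} {r} {s} e f = begin
      p * r ≈⟨ *-congˡ p f ⟩
      p * s ≈⟨ *-comm p s ⟩
      s * p ≈⟨ *-congˡ s e ⟩
      s * q ≈⟨ *-comm s q ⟩
      q * s ∎

    *-distribˡ : ∀ p q r → p * (q + r) ≈ p * q + p * r
    *-distribˡ []      q r = ≈-refl
    *-distribˡ (a ∷ p) q r = begin
      a · (q + r) + (0ℤ ∷ p * (q + r))
        ≈⟨ +-cong (·-distribˡ a q r) (∷-cong (*-distribˡ p q r)) ⟩
      (a · q + a · r) + ((0ℤ ∷ p * q) + (0ℤ ∷ p * r))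
        ≈⟨ medial (a · q) (a · r) (0ℤ ∷ p * q) (0ℤ ∷ p * r) ⟩
      (a · q + (0ℤ ∷ p * q)) + (a · r + (0ℤ ∷ p * r)) ∎

    *-distribʳ : ∀ p q r → (q + r) * p ≈ q * p + r * p
    *-distribʳ p q r = begin
      (q + r) * p   ≈⟨ *-comm (q + r) p ⟩
      p * (q + r)   ≈⟨ *-distribˡ p q r ⟩
      p * q + p * r ≈⟨ +-cong (*-comm p q) (*-comm p r) ⟩
      q * p + r * p ∎

    ·-* : ∀ a p q → (a · p) * q ≈ a · (p * q)
    ·-* a []      q = ≈-refl
    ·-* a (b ∷ p) q = begin
      (a ℤ.* b) · q + (0ℤ ∷ (a · p) * q) ≈⟨ +-cong (·-assoc a b q) (∷-cong (·-* a p q)) ⟩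
      a · b · q + (0ℤ ∷ a · (p * q))     ≈⟨ +-congˡ {a · b · q} (·-shift a (p * q)) ⟨
      a · b · q + a · (0ℤ ∷ p * q)       ≈⟨ ·-distribˡ a (b · q) (0ℤ ∷ p * q) ⟨
      a · (b · q + (0ℤ ∷ p * q))         ∎

    shift-* : ∀ p q → (0ℤ ∷ p) * q ≈ 0ℤ ∷ p * q
    shift-* p q = +-congʳ (·-zeroˡ q)

    *-assoc : ∀ p q r → (p * q) * r ≈ p * (q * r)
    *-assoc []      q r = ≈-refl
    *-assoc (a ∷ p) q r = begin
      (a · q + (0ℤ ∷ p * q)) * r       ≈⟨ *-distribʳ r (a · q) (0ℤ ∷ p * q) ⟩
      (a · q) * r + (0ℤ ∷ p * q) * r   ≈⟨ +-cong (·-* a q r) (shift-* (p * q) r) ⟩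
      a · (q * r) + (0ℤ ∷ (p * q) * r) ≈⟨ +-congˡ {a · (q * r)} (∷-cong (*-assoc p q r)) ⟩
      a · (q * r) + (0ℤ ∷ p * (q * r)) ∎

    *-identityˡ : ∀ p → (1ℤ ∷ []) * p ≈ p
    *-identityˡ p = begin
      1ℤ · p + (0ℤ ∷ []) ≈⟨ +-cong (·-identityˡ p) shift-[] ⟩
      p + []             ≈⟨ +-identityʳ p ⟩
      p                  ∎

  ℤ[β] : CommutativeRing 0ℓ 0ℓ
  ℤ[β] = record
    { Carrier = Poly
    ; _≈_     = _≈_
    ; _+_     = _+_
    ; _*_     = _*_
    ; -_      = -_
    ; 0#      = []
    ; 1#      = 1ℤ ∷ []
    ; isCommutativeRing = record
      { isRing = record
        { +-isAbelianGroup = record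
          { isGroup = record
            { isMonoid = record
              { isSemigroup = record
                { isMagma = record
                  { isEquivalence = Setoid.isEquivalence setoid
                  ; ∙-cong        = +-cong
                  }
                ; assoc = +-assoc
                }
              ; identity = (λ _ → ≈-refl) , +-identityʳ
              }
            ; inverse = neg-inverseˡ , neg-inverseʳ
            ; ⁻¹-cong = neg-cong
            }
          ; comm = +-comm
          }
        ; *-cong     = *-cong
        ; *-assoc    = *-assoc
        ; *-identity = *-identityˡ , λ p → ≈-trans (*-comm p _) (*-identityˡ p)
        ; distrib    = *-distribˡ , *-distribʳ
        }
      ; *-comm = *-comm
      }
    }

  β : Poly
  β = 0ℤ ∷ 1ℤ ∷ []

module LinearlyCompact (R : CommutativeRing 0ℓ 0ℓ) where

  private module R = CommutativeRing R

  -- As R is commutative, left R-modules are R-modules.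

  Mod : Set₁
  Mod = LeftModule R.ring 0ℓ 0ℓ

  infix 1 _⟶_

  record _⟶_ (M N : Mod) : Set where
    private
      module M = LeftModule M
      module N = LeftModule N
    open LeftModuleMorphisms M.rawLeftModule N.rawLeftModule
    infixl 11 _⟨$⟩_
    field
      _⟨$⟩_ : M.Carrierᴹ → N.Carrierᴹ
      isLeftModuleHomomorphism : IsLeftModuleHomomorphism _⟨$⟩_
    open IsLeftModuleHomomorphism isLeftModuleHomomorphism public

  open _⟶_ public

  module _ (M N : Mod) where
    private
      module M = LeftModule M
      module N = LeftModule N
      open GroupProperties N.+ᴹ-group using (identityˡ-unique; inverseˡ-unique)

    linear : (f : M.Carrierᴹ → N.Carrierᴹ) →
      (∀ {x y} → x M.≈ᴹ y → f x N.≈ᴹ f y) →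
      (∀ x y → f (x M.+ᴹ y) N.≈ᴹ f x N.+ᴹ f y) →
      (∀ r x → f (r M.*ₗ x) N.≈ᴹ r N.*ₗ f x) →
      M ⟶ N
    linear f f-cong f-+ f-* = record
      { _⟨$⟩_ = f
      ; isLeftModuleHomomorphism = record
        { +ᴹ-isGroupHomomorphism = record
          { isMonoidHomomorphism = record
            { isMagmaHomomorphism = record
              { isRelHomomorphism = record { cong = f-cong }
              ; homo = f-+
              }
            ; ε-homo = f-0
            }
          ; ⁻¹-homo = λ x → inverseˡ-unique _ _
              (N.≈ᴹ-trans (N.≈ᴹ-sym (f-+ _ _)) (N.≈ᴹ-trans (f-cong (M.-ᴹ‿inverseˡ x)) f-0))
          }
        ; *ₗ-homo = f-*
        }
      }
      where
      f-0 : f M.0ᴹ N.≈ᴹ N.0ᴹ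
      f-0 = identityˡ-unique (f M.0ᴹ) (f M.0ᴹ)
        (N.≈ᴹ-trans (N.≈ᴹ-sym (f-+ _ _)) (f-cong (M.+ᴹ-identityˡ M.0ᴹ)))

  idₗ : ∀ {M} → M ⟶ M
  idₗ {M} = linear M M id id (λ _ _ → ≈ᴹ-refl) (λ _ _ → ≈ᴹ-refl)
    where open LeftModule M

  infixr 9 _∘ₗ_

  _∘ₗ_ : ∀ {M N P} → N ⟶ P → M ⟶ N → M ⟶ P
  _∘ₗ_ {M} {N} {P} g f = linear M P (λ x → g ⟨$⟩ (f ⟨$⟩ x))
    (λ e → ⟦⟧-cong g (⟦⟧-cong f e))
    (λ x y → ≈ᴹ-trans (⟦⟧-cong g (+ᴹ-homo f x y)) (+ᴹ-homo g _ _))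
    (λ r x → ≈ᴹ-trans (⟦⟧-cong g (*ₗ-homo f r x)) (*ₗ-homo g r _))
    where open LeftModule P

  infix 4 _≗_

  record _≗_ {M N : Mod} (f g : M ⟶ N) : Set where
    constructor mk
    open LeftModule N using (_≈ᴹ_)
    field at : ∀ x → f ⟨$⟩ x ≈ᴹ g ⟨$⟩ x

  open _≗_ public

  Hom : Mod → Mod → Mod
  Hom M N = record
    { Carrierᴹ = M ⟶ N
    ; _≈ᴹ_     = _≗_
    ; _+ᴹ_     = λ f g → linear M N (λ x → f ⟨$⟩ x +ᴹ g ⟨$⟩ x)
        (λ e → +ᴹ-cong (⟦⟧-cong f e) (⟦⟧-cong g e))
        (λ x y → ≈ᴹ-trans (+ᴹ-cong (+ᴹ-homo f x y) (+ᴹ-homo g x y)) (medial _ _ _ _))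
        (λ r x → ≈ᴹ-trans (+ᴹ-cong (*ₗ-homo f r x) (*ₗ-homo g r x)) (≈ᴹ-sym (*ₗ-distribˡ r _ _)))
    ; _*ₗ_     = λ s f → linear M N (λ x → s *ₗ (f ⟨$⟩ x))
        (λ e → *ₗ-congˡ (⟦⟧-cong f e))
        (λ x y → ≈ᴹ-trans (*ₗ-congˡ (+ᴹ-homo f x y)) (*ₗ-distribˡ s _ _))
        (λ r x → ≈ᴹ-trans (*ₗ-congˡ (*ₗ-homo f r x)) (*ₗ-swap s r _))
    ; 0ᴹ       = linear M N (λ _ → 0ᴹ)
        (λ _ → ≈ᴹ-refl) (λ _ _ → ≈ᴹ-sym (+ᴹ-identityˡ 0ᴹ)) (λ r _ → ≈ᴹ-sym (*ₗ-zeroʳ r))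
    ; -ᴹ_      = λ f → linear M N (λ x → -ᴹ (f ⟨$⟩ x))
        (λ e → -ᴹ‿cong (⟦⟧-cong f e))
        (λ x y → ≈ᴹ-trans (-ᴹ‿cong (+ᴹ-homo f x y)) (-ᴹ-+ _ _))
        (λ r x → ≈ᴹ-trans (-ᴹ‿cong (*ₗ-homo f r x)) (-ᴹ-* r _))
    ; isLeftModule = record
      { isLeftSemimodule = record
        { +ᴹ-isCommutativeMonoid = record
          { isMonoid = record
            { isSemigroup = record
              { isMagma = record
                { isEquivalence = record
                  { refl  = mk λ _ → ≈ᴹ-refl
                  ; sym   = λ e → mk λ x → ≈ᴹ-sym (at e x)
                  ; trans = λ e e′ → mk λ x → ≈ᴹ-trans (at e x) (at e′ x)
                  }
                ; ∙-cong = λ e e′ → mk λ x → +ᴹ-cong (at e x) (at e′ x)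
                }
              ; assoc = λ _ _ _ → mk λ _ → +ᴹ-assoc _ _ _
              }
            ; identity = (λ _ → mk λ _ → +ᴹ-identityˡ _) , (λ _ → mk λ _ → +ᴹ-identityʳ _)
            }
          ; comm = λ _ _ → mk λ _ → +ᴹ-comm _ _
          }
        ; isPreleftSemimodule = record
          { *ₗ-cong      = λ e e′ → mk λ x → *ₗ-cong e (at e′ x)
          ; *ₗ-zeroˡ     = λ _ → mk λ _ → *ₗ-zeroˡ _
          ; *ₗ-distribʳ  = λ _ _ _ → mk λ _ → *ₗ-distribʳ _ _ _
          ; *ₗ-identityˡ = λ _ → mk λ _ → *ₗ-identityˡ _
          ; *ₗ-assoc     = λ _ _ _ → mk λ _ → *ₗ-assoc _ _ _
          ; *ₗ-zeroʳ     = λ _ → mk λ _ → *ₗ-zeroʳ _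
          ; *ₗ-distribˡ  = λ _ _ _ → mk λ _ → *ₗ-distribˡ _ _ _
          }
        }
      ; -ᴹ‿cong    = λ e → mk λ x → -ᴹ‿cong (at e x)
      ; -ᴹ‿inverse = (λ _ → mk λ _ → -ᴹ‿inverseˡ _) , (λ _ → mk λ _ → -ᴹ‿inverseʳ _)
      }
    }
    where
    open LeftModule N
    open GroupProperties +ᴹ-group using (inverseˡ-unique)
    open SetoidReasoning (≈ᴹ-setoid)

    medial : ∀ a b c d → (a +ᴹ b) +ᴹ (c +ᴹ d) ≈ᴹ (a +ᴹ c) +ᴹ (b +ᴹ d)
    medial a b c d = begin
      (a +ᴹ b) +ᴹ (c +ᴹ d) ≈⟨ +ᴹ-assoc a b (c +ᴹ d) ⟩
      a +ᴹ (b +ᴹ (c +ᴹ d)) ≈⟨ +ᴹ-congˡ (+ᴹ-assoc b c d) ⟨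
      a +ᴹ ((b +ᴹ c) +ᴹ d) ≈⟨ +ᴹ-congˡ (+ᴹ-congʳ (+ᴹ-comm b c)) ⟩
      a +ᴹ ((c +ᴹ b) +ᴹ d) ≈⟨ +ᴹ-congˡ (+ᴹ-assoc c b d) ⟩
      a +ᴹ (c +ᴹ (b +ᴹ d)) ≈⟨ +ᴹ-assoc a c (b +ᴹ d) ⟨
      (a +ᴹ c) +ᴹ (b +ᴹ d) ∎

    *ₗ-swap : ∀ s r a → s *ₗ (r *ₗ a) ≈ᴹ r *ₗ (s *ₗ a)
    *ₗ-swap s r a = begin
      s *ₗ (r *ₗ a)    ≈⟨ *ₗ-assoc s r a ⟨
      (s R.* r) *ₗ a   ≈⟨ *ₗ-congʳ (R.*-comm s r) ⟩
      (r R.* s) *ₗ a   ≈⟨ *ₗ-assoc r s a ⟩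
      r *ₗ (s *ₗ a)    ∎

    -ᴹ-+ : ∀ a b → -ᴹ (a +ᴹ b) ≈ᴹ -ᴹ a +ᴹ -ᴹ b
    -ᴹ-+ a b = ≈ᴹ-sym (inverseˡ-unique _ _ (begin
      (-ᴹ a +ᴹ -ᴹ b) +ᴹ (a +ᴹ b) ≈⟨ medial _ _ _ _ ⟩
      (-ᴹ a +ᴹ a) +ᴹ (-ᴹ b +ᴹ b) ≈⟨ +ᴹ-cong (-ᴹ‿inverseˡ a) (-ᴹ‿inverseˡ b) ⟩
      0ᴹ +ᴹ 0ᴹ                   ≈⟨ +ᴹ-identityˡ 0ᴹ ⟩
      0ᴹ                         ∎))

    -ᴹ-* : ∀ r a → -ᴹ (r *ₗ a) ≈ᴹ r *ₗ (-ᴹ a)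
    -ᴹ-* r a = ≈ᴹ-sym (inverseˡ-unique _ _ (begin
      r *ₗ (-ᴹ a) +ᴹ r *ₗ a ≈⟨ *ₗ-distribˡ r _ _ ⟨
      r *ₗ (-ᴹ a +ᴹ a)      ≈⟨ *ₗ-congˡ (-ᴹ‿inverseˡ a) ⟩
      r *ₗ 0ᴹ               ≈⟨ *ₗ-zeroʳ r ⟩
      0ᴹ                    ∎))

  𝟙 : Mod
  𝟙 = TensorUnit.leftModule

  Dual : Mod → Mod
  Dual M = Hom M 𝟙

  -- The R-module presented by a set G of generators and relations _~_:
  -- formal R-linear expressions in G modulo the least congruence that
  -- satisfies the module axioms and contains _~_.

  infixl 6 _⊕_
  infixr 7 _⊙_
  infixr 8 ⊖_

  data Term (G : Set) : Set where
    gen : G → Term G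
    𝟘   : Term G
    _⊕_ : Term G → Term G → Term G
    ⊖_  : Term G → Term G
    _⊙_ : R.Carrier → Term G → Term G

  module _ {G : Set} (_~_ : Rel (Term G) 0ℓ) where

    infix 4 _≋_

    data _≋_ : Rel (Term G) 0ℓ where
      ≋-relation    : ∀ {s t} → s ~ t → s ≋ t
      ≋-refl        : ∀ {s} → s ≋ s
      ≋-sym         : ∀ {s t} → s ≋ t → t ≋ s
      ≋-trans       : ∀ {s t u} → s ≋ t → t ≋ u → s ≋ u
      ⊕-cong        : ∀ {s s′ t t′} → s ≋ s′ → t ≋ t′ → s ⊕ t ≋ s′ ⊕ t′
      ⊕-assoc       : ∀ s t u → (s ⊕ t) ⊕ u ≋ s ⊕ (t ⊕ u)
      ⊕-comm        : ∀ s t → s ⊕ t ≋ t ⊕ s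
      ⊕-identityˡ   : ∀ s → 𝟘 ⊕ s ≋ s
      ⊖-cong        : ∀ {s t} → s ≋ t → ⊖ s ≋ ⊖ t
      ⊖-inverseˡ    : ∀ s → ⊖ s ⊕ s ≋ 𝟘
      ⊙-cong        : ∀ {q r s t} → q R.≈ r → s ≋ t → q ⊙ s ≋ r ⊙ t
      ⊙-zeroˡ       : ∀ s → R.0# ⊙ s ≋ 𝟘
      ⊙-zeroʳ       : ∀ r → r ⊙ 𝟘 ≋ 𝟘
      ⊙-distribˡ    : ∀ r s t → r ⊙ (s ⊕ t) ≋ r ⊙ s ⊕ r ⊙ t
      ⊙-distribʳ    : ∀ s q r → (q R.+ r) ⊙ s ≋ q ⊙ s ⊕ r ⊙ s
      ⊙-identityˡ   : ∀ s → R.1# ⊙ s ≋ s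
      ⊙-assoc       : ∀ q r s → (q R.* r) ⊙ s ≋ q ⊙ (r ⊙ s)

    Presented : Mod
    Presented = record
      { Carrierᴹ = Term G
      ; _≈ᴹ_     = _≋_
      ; _+ᴹ_     = _⊕_
      ; _*ₗ_     = _⊙_
      ; 0ᴹ       = 𝟘
      ; -ᴹ_      = ⊖_
      ; isLeftModule = record
        { isLeftSemimodule = record
          { +ᴹ-isCommutativeMonoid = record
            { isMonoid = record
              { isSemigroup = record
                { isMagma = record
                  { isEquivalence = record { refl = ≋-refl ; sym = ≋-sym ; trans = ≋-trans }
                  ; ∙-cong        = ⊕-cong
                  }
                ; assoc = ⊕-assoc
                }
              ; identity = ⊕-identityˡ , λ s → ≋-trans (⊕-comm s 𝟘) (⊕-identityˡ s)
              }
            ; comm = ⊕-comm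
            }
          ; isPreleftSemimodule = record
            { *ₗ-cong      = ⊙-cong
            ; *ₗ-zeroˡ     = ⊙-zeroˡ
            ; *ₗ-distribʳ  = ⊙-distribʳ
            ; *ₗ-identityˡ = ⊙-identityˡ
            ; *ₗ-assoc     = ⊙-assoc
            ; *ₗ-zeroʳ     = ⊙-zeroʳ
            ; *ₗ-distribˡ  = ⊙-distribˡ
            }
          }
        ; -ᴹ‿cong    = ⊖-cong
        ; -ᴹ‿inverse = ⊖-inverseˡ , λ s → ≋-trans (⊕-comm s (⊖ s)) (⊖-inverseˡ s)
        }
      }

  module _ (M : Mod) where
    private module M = LeftModule M

    eval : ∀ {G} → (G → M.Carrierᴹ) → Term G → M.Carrierᴹ
    eval f (gen x) = f x
    eval f 𝟘       = M.0ᴹ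
    eval f (s ⊕ t) = eval f s M.+ᴹ eval f t
    eval f (⊖ s)   = M.-ᴹ eval f s
    eval f (r ⊙ s) = r M.*ₗ eval f s

    module _ {G : Set} {_~_ : Rel (Term G) 0ℓ} where

      eval-resp : (f : G → M.Carrierᴹ) →
        (∀ {s t} → s ~ t → eval f s M.≈ᴹ eval f t) →
        ∀ {s t} → _≋_ _~_ s t → eval f s M.≈ᴹ eval f t
      eval-resp f resp (≋-relation e)     = resp e
      eval-resp f resp ≋-refl             = M.≈ᴹ-refl
      eval-resp f resp (≋-sym e)          = M.≈ᴹ-sym (eval-resp f resp e)
      eval-resp f resp (≋-trans e e′)     = M.≈ᴹ-trans (eval-resp f resp e) (eval-resp f resp e′)
      eval-resp f resp (⊕-cong e e′)      = M.+ᴹ-cong (eval-resp f resp e) (eval-resp f resp e′)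
      eval-resp f resp (⊕-assoc s t u)    = M.+ᴹ-assoc _ _ _
      eval-resp f resp (⊕-comm s t)       = M.+ᴹ-comm _ _
      eval-resp f resp (⊕-identityˡ s)    = M.+ᴹ-identityˡ _
      eval-resp f resp (⊖-cong e)         = M.-ᴹ‿cong (eval-resp f resp e)
      eval-resp f resp (⊖-inverseˡ s)     = M.-ᴹ‿inverseˡ _
      eval-resp f resp (⊙-cong q e)       = M.*ₗ-cong q (eval-resp f resp e)
      eval-resp f resp (⊙-zeroˡ s)        = M.*ₗ-zeroˡ _
      eval-resp f resp (⊙-zeroʳ r)        = M.*ₗ-zeroʳ r
      eval-resp f resp (⊙-distribˡ r s t) = M.*ₗ-distribˡ r _ _
      eval-resp f resp (⊙-distribʳ s q r) = M.*ₗ-distribʳ _ q r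
      eval-resp f resp (⊙-identityˡ s)    = M.*ₗ-identityˡ _
      eval-resp f resp (⊙-assoc q r s)    = M.*ₗ-assoc q r _

      present : (f : G → M.Carrierᴹ) →
        (∀ {s t} → s ~ t → eval f s M.≈ᴹ eval f t) → Presented _~_ ⟶ M
      present f resp = linear (Presented _~_) M (eval f) (eval-resp f resp)
        (λ _ _ → M.≈ᴹ-refl) (λ _ _ → M.≈ᴹ-refl)

      ≗-on-generators : {f g : Presented _~_ ⟶ M} →
        (∀ x → f ⟨$⟩ gen x M.≈ᴹ g ⟨$⟩ gen x) → f ≗ g
      ≗-on-generators {f} {g} e = mk go
        where
        go : ∀ s → f ⟨$⟩ s M.≈ᴹ g ⟨$⟩ s
        go (gen x) = e x
        go 𝟘       = M.≈ᴹ-trans (0ᴹ-homo f) (M.≈ᴹ-sym (0ᴹ-homo g))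
        go (s ⊕ t) = M.≈ᴹ-trans (+ᴹ-homo f s t)
          (M.≈ᴹ-trans (M.+ᴹ-cong (go s) (go t)) (M.≈ᴹ-sym (+ᴹ-homo g s t)))
        go (⊖ s)   = M.≈ᴹ-trans (-ᴹ-homo f s)
          (M.≈ᴹ-trans (M.-ᴹ‿cong (go s)) (M.≈ᴹ-sym (-ᴹ-homo g s)))
        go (r ⊙ s) = M.≈ᴹ-trans (*ₗ-homo f r s)
          (M.≈ᴹ-trans (M.*ₗ-congˡ (go s)) (M.≈ᴹ-sym (*ₗ-homo g r s)))

  module _ (X : Setoid 0ℓ 0ℓ) where
    private module X = Setoid X

    data FreeRelation : Rel (Term X.Carrier) 0ℓ where
      gen-cong : ∀ {x y} → x X.≈ y → FreeRelation (gen x) (gen y)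

    Free : Mod
    Free = Presented FreeRelation

    extend : (M : Mod) → Func X (LeftModule.≈ᴹ-setoid M) → Free ⟶ M
    extend M f = present M (Func.to f) λ { (gen-cong e) → Func.cong f e }

    IsBasis : (M : Mod) → Func X (LeftModule.≈ᴹ-setoid M) → Set
    IsBasis M a = Bijective Free.≈ᴹ M.≈ᴹ (extend M a ⟨$⟩_)
      where
      module Free = LeftModule Free renaming (_≈ᴹ_ to ≈ᴹ)
      module M = LeftModule M renaming (_≈ᴹ_ to ≈ᴹ)

  module _ (M N : Mod) where
    private
      module M = LeftModule M
      module N = LeftModule N

    data TensorRelation : Rel (Term (M.Carrierᴹ × N.Carrierᴹ)) 0ℓ where
      ⊗-cong : ∀ {x x′ y y′} → x M.≈ᴹ x′ → y N.≈ᴹ y′ →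
               TensorRelation (gen (x , y)) (gen (x′ , y′))
      ⊗-+ˡ   : ∀ x x′ y → TensorRelation (gen (x M.+ᴹ x′ , y)) (gen (x , y) ⊕ gen (x′ , y))
      ⊗-+ʳ   : ∀ x y y′ → TensorRelation (gen (x , y N.+ᴹ y′)) (gen (x , y) ⊕ gen (x , y′))
      ⊗-*ˡ   : ∀ r x y → TensorRelation (gen (r M.*ₗ x , y)) (r ⊙ gen (x , y))
      ⊗-*ʳ   : ∀ r x y → TensorRelation (gen (x , r N.*ₗ y)) (r ⊙ gen (x , y))

    infixr 7 _⊗_

    _⊗_ : Mod
    _⊗_ = Presented TensorRelation

    ⊗-rec : (P : Mod) → M ⟶ Hom N P → _⊗_ ⟶ P
    ⊗-rec P f = present P (λ (x , y) → (f ⟨$⟩ x) ⟨$⟩ y) λ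
      { (⊗-cong e e′)   → P.≈ᴹ-trans (at (⟦⟧-cong f e) _) (⟦⟧-cong (f ⟨$⟩ _) e′)
      ; (⊗-+ˡ x x′ y)   → at (+ᴹ-homo f x x′) y
      ; (⊗-+ʳ x y y′)   → +ᴹ-homo (f ⟨$⟩ x) y y′
      ; (⊗-*ˡ r x y)    → at (*ₗ-homo f r x) y
      ; (⊗-*ʳ r x y)    → *ₗ-homo (f ⟨$⟩ x) r y
      }
      where module P = LeftModule P

    pure : M ⟶ Hom N _⊗_
    pure = linear M (Hom N _⊗_)
      (λ x → linear N _⊗_ (λ y → gen (x , y))
        (λ e → ≋-relation (⊗-cong M.≈ᴹ-refl e))
        (λ y y′ → ≋-relation (⊗-+ʳ x y y′))
        (λ r y → ≋-relation (⊗-*ʳ r x y)))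
      (λ e → mk λ y → ≋-relation (⊗-cong e N.≈ᴹ-refl))
      (λ x x′ → mk λ y → ≋-relation (⊗-+ˡ x x′ y))
      (λ r x → mk λ y → ≋-relation (⊗-*ˡ r x y))

  infixr 10 _⊗₁_

  _⊗₁_ : ∀ {M M′ N N′} → M ⟶ M′ → N ⟶ N′ → M ⊗ N ⟶ M′ ⊗ N′
  _⊗₁_ {M} {M′} {N} {N′} f g = ⊗-rec M N (M′ ⊗ N′)
    (linear M (Hom N (M′ ⊗ N′))
      (λ x → (pure M′ N′ ⟨$⟩ (f ⟨$⟩ x)) ∘ₗ g)
      (λ e → mk λ y → at (⟦⟧-cong (pure M′ N′) (⟦⟧-cong f e)) (g ⟨$⟩ y))
      (λ x x′ → mk λ y → ≋-trans
        (at (⟦⟧-cong (pure M′ N′) (+ᴹ-homo f x x′)) (g ⟨$⟩ y))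
        (at (+ᴹ-homo (pure M′ N′) (f ⟨$⟩ x) (f ⟨$⟩ x′)) (g ⟨$⟩ y)))
      (λ r x → mk λ y → ≋-trans
        (at (⟦⟧-cong (pure M′ N′) (*ₗ-homo f r x)) (g ⟨$⟩ y))
        (at (*ₗ-homo (pure M′ N′) r (f ⟨$⟩ x)) (g ⟨$⟩ y))))

  module _ (M N : Mod) where
    private
      module M = LeftModule M
      module N = LeftModule N

    ⊗-swap : M ⊗ N ⟶ N ⊗ M
    ⊗-swap = ⊗-rec M N (N ⊗ M)
      (linear M (Hom N (N ⊗ M))
        (λ x → linear N (N ⊗ M) (λ y → gen (y , x))
          (λ e → ≋-relation (⊗-cong e M.≈ᴹ-refl))
          (λ y y′ → ≋-relation (⊗-+ˡ y y′ x))
          (λ r y → ≋-relation (⊗-*ˡ r y x)))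
        (λ e → mk λ y → ≋-relation (⊗-cong N.≈ᴹ-refl e))
        (λ x x′ → mk λ y → ≋-relation (⊗-+ʳ y x x′))
        (λ r x → mk λ y → ≋-relation (⊗-*ʳ r y x)))

  module _ (M : Mod) where
    private module M = LeftModule M

    -- r ⊗ x ↦ r x
    unitˡ : 𝟙 ⊗ M ⟶ M
    unitˡ = ⊗-rec 𝟙 M M
      (linear 𝟙 (Hom M M)
        (λ r → linear M M (r M.*ₗ_) M.*ₗ-congˡ (M.*ₗ-distribˡ r) (λ s x →
          M.≈ᴹ-trans (M.≈ᴹ-sym (M.*ₗ-assoc r s x))
            (M.≈ᴹ-trans (M.*ₗ-congʳ (R.*-comm r s)) (M.*ₗ-assoc s r x))))
        (λ e → mk λ _ → M.*ₗ-congʳ e)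
        (λ r s → mk λ x → M.*ₗ-distribʳ x r s)
        (λ r s → mk λ x → M.*ₗ-assoc r s x))

    -- x ⊗ r ↦ r x
    unitʳ : M ⊗ 𝟙 ⟶ M
    unitʳ = unitˡ ∘ₗ ⊗-swap M 𝟙

  module _ (M N P : Mod) where

    -- (x ⊗ y) ⊗ z ↦ x ⊗ (y ⊗ z)
    ⊗-assoc : (M ⊗ N) ⊗ P ⟶ M ⊗ (N ⊗ P)
    ⊗-assoc = ⊗-rec (M ⊗ N) P (M ⊗ (N ⊗ P)) (⊗-rec M N (Hom P (M ⊗ (N ⊗ P)))
      (linear M (Hom N (Hom P (M ⊗ (N ⊗ P))))
        (λ x → linear N (Hom P (M ⊗ (N ⊗ P)))
          (λ y → (pure M (N ⊗ P) ⟨$⟩ x) ∘ₗ (pure N P ⟨$⟩ y))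
          (λ e → mk λ z → ⟦⟧-cong (pure M (N ⊗ P) ⟨$⟩ x) (at (⟦⟧-cong (pure N P) e) z))
          (λ y y′ → mk λ z → ≋-trans
            (⟦⟧-cong (pure M (N ⊗ P) ⟨$⟩ x) (at (+ᴹ-homo (pure N P) y y′) z))
            (+ᴹ-homo (pure M (N ⊗ P) ⟨$⟩ x) _ _))
          (λ r y → mk λ z → ≋-trans
            (⟦⟧-cong (pure M (N ⊗ P) ⟨$⟩ x) (at (*ₗ-homo (pure N P) r y) z))
            (*ₗ-homo (pure M (N ⊗ P) ⟨$⟩ x) r _)))
        (λ e → mk λ y → mk λ z → at (⟦⟧-cong (pure M (N ⊗ P)) e) _)
        (λ x x′ → mk λ y → mk λ z → at (+ᴹ-homo (pure M (N ⊗ P)) x x′) _)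
        (λ r x → mk λ y → mk λ z → at (*ₗ-homo (pure M (N ⊗ P)) r x) _)))

    -- x ⊗ (y ⊗ z) ↦ (x ⊗ y) ⊗ z
    ⊗-assoc⁻¹ : M ⊗ (N ⊗ P) ⟶ (M ⊗ N) ⊗ P
    ⊗-assoc⁻¹ = ⊗-rec M (N ⊗ P) ((M ⊗ N) ⊗ P)
      (linear M (Hom (N ⊗ P) ((M ⊗ N) ⊗ P))
        (λ x → (pure M N ⟨$⟩ x) ⊗₁ idₗ)
        (λ e → ≗-on-generators _ λ (y , z) →
          at (⟦⟧-cong (pure (M ⊗ N) P) (at (⟦⟧-cong (pure M N) e) y)) z)
        (λ x x′ → ≗-on-generators _ λ (y , z) → ≋-trans
          (at (⟦⟧-cong (pure (M ⊗ N) P) (at (+ᴹ-homo (pure M N) x x′) y)) z)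
          (at (+ᴹ-homo (pure (M ⊗ N) P) _ _) z))
        (λ r x → ≗-on-generators _ λ (y , z) → ≋-trans
          (at (⟦⟧-cong (pure (M ⊗ N) P) (at (*ₗ-homo (pure M N) r x) y)) z)
          (at (*ₗ-homo (pure (M ⊗ N) P) r _) z)))

  -- (x ⊗ x′) ⊗ (y ⊗ y′) ↦ (x ⊗ y) ⊗ (x′ ⊗ y′)
  ⊗-interchange : (A : Mod) → (A ⊗ A) ⊗ (A ⊗ A) ⟶ (A ⊗ A) ⊗ (A ⊗ A)
  ⊗-interchange A =
    ⊗-assoc⁻¹ A A (A ⊗ A)
      ∘ₗ idₗ ⊗₁ (⊗-assoc A A A ∘ₗ ⊗-swap A A ⊗₁ idₗ ∘ₗ ⊗-assoc⁻¹ A A A)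
      ∘ₗ ⊗-assoc A A (A ⊗ A)

  record IsAlgebra (A : Mod) (μ : A ⊗ A ⟶ A) (η : 𝟙 ⟶ A) : Set where
    field
      assoc     : μ ∘ₗ μ ⊗₁ idₗ ≗ μ ∘ₗ idₗ ⊗₁ μ ∘ₗ ⊗-assoc A A A
      identityˡ : μ ∘ₗ η ⊗₁ idₗ ≗ unitˡ A
      identityʳ : μ ∘ₗ idₗ ⊗₁ η ≗ unitʳ A

  record IsCoalgebra (A : Mod) (δ : A ⟶ A ⊗ A) (ε : A ⟶ 𝟙) : Set where
    field
      coassoc     : ⊗-assoc A A A ∘ₗ δ ⊗₁ idₗ ∘ₗ δ ≗ idₗ ⊗₁ δ ∘ₗ δ
      coidentityˡ : unitˡ A ∘ₗ ε ⊗₁ idₗ ∘ₗ δ ≗ idₗ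
      coidentityʳ : unitʳ A ∘ₗ idₗ ⊗₁ ε ∘ₗ δ ≗ idₗ

  record IsBialgebra (A : Mod) (μ : A ⊗ A ⟶ A) (η : 𝟙 ⟶ A)
                     (δ : A ⟶ A ⊗ A) (ε : A ⟶ 𝟙) : Set where
    field
      isAlgebra   : IsAlgebra A μ η
      isCoalgebra : IsCoalgebra A δ ε
      δ-μ         : δ ∘ₗ μ ≗ μ ⊗₁ μ ∘ₗ ⊗-interchange A ∘ₗ δ ⊗₁ δ
      ε-μ         : ε ∘ₗ μ ≗ unitˡ 𝟙 ∘ₗ ε ⊗₁ ε
      δ-η         : δ ∘ₗ η ∘ₗ unitˡ 𝟙 ≗ η ⊗₁ η
      ε-η         : ε ∘ₗ η ≗ idₗ

  record IsHopfAlgebra (A : Mod) (μ : A ⊗ A ⟶ A) (η : 𝟙 ⟶ A)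
                       (δ : A ⟶ A ⊗ A) (ε : A ⟶ 𝟙) (S : A ⟶ A) : Set where
    field
      isBialgebra : IsBialgebra A μ η δ ε
      antipodeˡ   : μ ∘ₗ S ⊗₁ idₗ ∘ₗ δ ≗ η ∘ₗ ε
      antipodeʳ   : μ ∘ₗ idₗ ⊗₁ S ∘ₗ δ ≗ η ∘ₗ ε

  -- An LC-module B, dual to the free module A.  The pairing A × B → R is
  -- given in curried form b ↦ ⟨ · , b ⟩.

  record LCModule : Set₁ where
    field
      A       : Mod
      Index   : Setoid 0ℓ 0ℓ
      basis   : Func Index (LeftModule.≈ᴹ-setoid A)
      isBasis : IsBasis Index A basis
      B       : Mod
      pairing : B ⟶ Dual A
      perfect : Bijective (LeftModule._≈ᴹ_ B) _≗_ (pairing ⟨$⟩_)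

    ⟨_,_⟩ : LeftModule.Carrierᴹ A → LeftModule.Carrierᴹ B → R.Carrier
    ⟨ a , b ⟩ = (pairing ⟨$⟩ b) ⟨$⟩ a

  open LCModule using (A; B)

  module _ (M N : LCModule) where
    private
      module M = LCModule M
      module N = LCModule N
      module MA = LeftModule (A M)
      module NA = LeftModule (A N)
      module MB = LeftModule (B M)

    -- With R discrete, the sets { b′ ∣ ⟨ a′ , b′ ⟩ = ⟨ a′ , b ⟩ for all a′ ∈ as },
    -- as a finite list, form a neighbourhood basis of b in the coarsest
    -- topology for which every ⟨ a′ , · ⟩ is continuous.  A map f into B N is
    -- continuous iff every ⟨ a , f · ⟩ is continuous.

    Continuous : (B M ⟶ B N) → Set
    Continuous f = ∀ (a : NA.Carrierᴹ) (b : MB.Carrierᴹ) →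
      ∃ λ (as : List MA.Carrierᴹ) → ∀ b′ →
        All (λ a′ → M.⟨ a′ , b′ ⟩ R.≈ M.⟨ a′ , b ⟩) as →
        N.⟨ a , f ⟨$⟩ b′ ⟩ R.≈ N.⟨ a , f ⟨$⟩ b ⟩

    record ContinuousLinear : Set where
      field
        toLinear   : B M ⟶ B N
        continuous : Continuous toLinear

    IsAdjoint : ContinuousLinear → (A N ⟶ A M) → Set
    IsAdjoint f g = ∀ a b →
      M.⟨ g ⟨$⟩ a , b ⟩ R.≈ N.⟨ a , ContinuousLinear.toLinear f ⟨$⟩ b ⟩

    infix 4 _≈ᶜ_

    _≈ᶜ_ : Rel ContinuousLinear 0ℓ
    f ≈ᶜ g = ContinuousLinear.toLinear f ≗ ContinuousLinear.toLinear g

  open ContinuousLinear public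

  module _ {X Y : Setoid 0ℓ 0ℓ} {M N : Mod}
           (a : Func X (LeftModule.≈ᴹ-setoid M)) (b : Func Y (LeftModule.≈ᴹ-setoid N)) where
    private
      module X = Setoid X
      module Y = Setoid Y
      module M = LeftModule M
      module N = LeftModule N
      X×Y = ×-setoid X Y
      F = Free X×Y
      module F = LeftModule F

    ⊗-basis : Func X×Y (LeftModule.≈ᴹ-setoid (M ⊗ N))
    ⊗-basis = record
      { to   = λ (x , y) → gen (Func.to a x , Func.to b y)
      ; cong = λ (e , e′) → ≋-relation (⊗-cong (Func.cong a e) (Func.cong b e′))
      }

    ⊗-isBasis : IsBasis X M a → IsBasis Y N b → IsBasis X×Y (M ⊗ N) ⊗-basis
    ⊗-isBasis (injᵃ , surjᵃ) (injᵇ , surjᵇ) = inj , surj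
      where
      f = extend X M a
      g = extend Y N b
      h = extend X×Y (M ⊗ N) ⊗-basis

      coordᵃ : M ⟶ Free X
      coordᵃ = linear M (Free X) (λ m → proj₁ (surjᵃ m))
        (λ {m} {m′} e → injᵃ (M.≈ᴹ-trans (img m) (M.≈ᴹ-trans e (M.≈ᴹ-sym (img m′)))))
        (λ m m′ → injᵃ (M.≈ᴹ-trans (img _) (M.≈ᴹ-sym (M.+ᴹ-cong (img m) (img m′)))))
        (λ r m → injᵃ (M.≈ᴹ-trans (img _) (M.≈ᴹ-sym (M.*ₗ-congˡ (img m)))))
        where
        img : ∀ m → f ⟨$⟩ proj₁ (surjᵃ m) M.≈ᴹ m
        img m = proj₂ (surjᵃ m) ≋-refl

      coordᵇ : N ⟶ Free Y
      coordᵇ = linear N (Free Y) (λ n → proj₁ (surjᵇ n))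
        (λ {n} {n′} e → injᵇ (N.≈ᴹ-trans (img n) (N.≈ᴹ-trans e (N.≈ᴹ-sym (img n′)))))
        (λ n n′ → injᵇ (N.≈ᴹ-trans (img _) (N.≈ᴹ-sym (N.+ᴹ-cong (img n) (img n′)))))
        (λ r n → injᵇ (N.≈ᴹ-trans (img _) (N.≈ᴹ-sym (N.*ₗ-congˡ (img n)))))
        where
        img : ∀ n → g ⟨$⟩ proj₁ (surjᵇ n) N.≈ᴹ n
        img n = proj₂ (surjᵇ n) ≋-refl

      pairs : Free X ⊗ Free Y ⟶ F
      pairs = ⊗-rec (Free X) (Free Y) F (extend X (Hom (Free Y) F) (record
        { to   = λ x → extend Y F (record
            { to = λ y → gen (x , y) ; cong = λ e → ≋-relation (gen-cong (X.refl , e)) })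
        ; cong = λ e → ≗-on-generators F λ y → ≋-relation (gen-cong (e , Y.refl))
        }))

      k : M ⊗ N ⟶ F
      k = pairs ∘ₗ coordᵃ ⊗₁ coordᵇ

      k∘h : k ∘ₗ h ≗ idₗ
      k∘h = ≗-on-generators F λ (x , y) → ⟦⟧-cong pairs {y = gen (gen x , gen y)} (≋-relation (⊗-cong
        (injᵃ {coordᵃ ⟨$⟩ Func.to a x} {gen x} (proj₂ (surjᵃ (Func.to a x)) ≋-refl))
        (injᵇ {coordᵇ ⟨$⟩ Func.to b y} {gen y} (proj₂ (surjᵇ (Func.to b y)) ≋-refl))))

      h∘pairs-gen : ∀ x → h ∘ₗ (pairs ∘ₗ (pure (Free X) (Free Y) ⟨$⟩ gen x))
                          ≗ (pure M N ⟨$⟩ Func.to a x) ∘ₗ g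
      h∘pairs-gen x = ≗-on-generators (M ⊗ N) λ y → ≋-refl

      pull : Free X ⟶ Hom (Free Y) (M ⊗ N)
      pull = linear (Free X) (Hom (Free Y) (M ⊗ N))
        (λ s → h ∘ₗ (pairs ∘ₗ (pure (Free X) (Free Y) ⟨$⟩ s)))
        (λ e → mk λ t → ⟦⟧-cong h (⟦⟧-cong pairs (at (⟦⟧-cong (pure (Free X) (Free Y)) e) t)))
        (λ _ _ → mk λ t → ≋-refl)
        (λ _ _ → mk λ t → ≋-refl)

      push : Free X ⟶ Hom (Free Y) (M ⊗ N)
      push = linear (Free X) (Hom (Free Y) (M ⊗ N))
        (λ s → (pure M N ⟨$⟩ (f ⟨$⟩ s)) ∘ₗ g)
        (λ e → mk λ t → at (⟦⟧-cong (pure M N) (⟦⟧-cong f e)) (g ⟨$⟩ t))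
        (λ s s′ → mk λ t → at (+ᴹ-homo (pure M N) (f ⟨$⟩ s) (f ⟨$⟩ s′)) (g ⟨$⟩ t))
        (λ r s → mk λ t → at (*ₗ-homo (pure M N) r (f ⟨$⟩ s)) (g ⟨$⟩ t))

      h∘k : h ∘ₗ k ≗ idₗ
      h∘k = ≗-on-generators (M ⊗ N) λ (m , n) → ≋-trans
        (at (at (≗-on-generators (Hom (Free Y) (M ⊗ N)) {f = pull} {g = push} h∘pairs-gen)
               (coordᵃ ⟨$⟩ m))
            (coordᵇ ⟨$⟩ n))
        (≋-relation (⊗-cong (proj₂ (surjᵃ m) ≋-refl) (proj₂ (surjᵇ n) ≋-refl)))

      inj : ∀ {s t} → LeftModule._≈ᴹ_ (M ⊗ N) (h ⟨$⟩ s) (h ⟨$⟩ t) → s F.≈ᴹ t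
      inj {s} {t} e = ≋-trans (≋-sym (at k∘h s)) (≋-trans (⟦⟧-cong k e) (at k∘h t))

      surj : ∀ u → ∃ λ s → ∀ {t} → t F.≈ᴹ s → LeftModule._≈ᴹ_ (M ⊗ N) (h ⟨$⟩ t) u
      surj u = k ⟨$⟩ u , λ e → ≋-trans (⟦⟧-cong h e) (at h∘k u)

  infixr 7 _⊗̂_

  _⊗̂_ : LCModule → LCModule → LCModule
  M ⊗̂ N = record
    { A       = A M ⊗ A N
    ; Index   = ×-setoid M.Index N.Index
    ; basis   = ⊗-basis M.basis N.basis
    ; isBasis = ⊗-isBasis M.basis N.basis M.isBasis N.isBasis
    ; B       = Dual (A M ⊗ A N)
    ; pairing = idₗ
    ; perfect = id , λ f → f , id
    }
    where
    module M = LCModule M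
    module N = LCModule N

  module _ (M N : LCModule) where
    private
      module M = LCModule M
      module N = LCModule N

    -- ⟨ a ⊗ a′ , b ⊗ b′ ⟩ = ⟨ a , b ⟩ ⟨ a′ , b′ ⟩
    tensor : LeftModule.Carrierᴹ M.B → LeftModule.Carrierᴹ N.B → LeftModule.Carrierᴹ (B (M ⊗̂ N))
    tensor b b′ = unitˡ 𝟙 ∘ₗ (M.pairing ⟨$⟩ b) ⊗₁ (N.pairing ⟨$⟩ b′)

  -- the continuous linear extension of b ⊗ b′ ↦ b′ ⊗ b
  τ : (M : LCModule) → B (M ⊗̂ M) ⟶ B (M ⊗̂ M)
  τ M = linear (B (M ⊗̂ M)) (B (M ⊗̂ M)) (_∘ₗ ⊗-swap (A M) (A M))
    (λ e → mk λ t → at e (⊗-swap (A M) (A M) ⟨$⟩ t))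
    (λ _ _ → mk λ _ → R.refl)
    (λ _ _ → mk λ _ → R.refl)

  𝕂 : LCModule
  𝕂 = record
    { A       = 𝟙
    ; Index   = ⊤-setoid
    ; basis   = one
    ; isBasis = (λ {s} {t} e → ≋-trans (collect s) (≋-trans (⊙-cong e ≋-refl) (≋-sym (collect t))))
              , λ r → r ⊙ gen tt , λ e →
                  R.trans (⟦⟧-cong (extend ⊤-setoid 𝟙 one) e) (R.*-identityʳ r)
    ; B       = 𝟙
    ; pairing = linear 𝟙 (Dual 𝟙)
        (λ r → linear 𝟙 𝟙 (R._* r) R.*-congʳ (R.distribʳ r) (λ s a → R.*-assoc s a r))
        (λ e → mk λ _ → R.*-congˡ e)
        (λ r r′ → mk λ a → R.distribˡ a r r′)
        (λ s r → mk λ a → R.trans (R.sym (R.*-assoc a s r))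
          (R.trans (R.*-congʳ (R.*-comm a s)) (R.*-assoc s a r)))
    ; perfect = (λ {r} {r′} e → R.trans (R.sym (R.*-identityˡ r))
                  (R.trans (at e R.1#) (R.*-identityˡ r′)))
              , λ f → f ⟨$⟩ R.1# , λ {r} e → mk λ a → R.trans (R.*-congˡ e)
                  (R.trans (R.sym (*ₗ-homo f a R.1#)) (⟦⟧-cong f (R.*-identityʳ a)))
    }
    where
    ⊤-setoid : Setoid 0ℓ 0ℓ
    ⊤-setoid = ≡.setoid ⊤

    one : Func ⊤-setoid (LeftModule.≈ᴹ-setoid 𝟙)
    one = record { to = λ _ → R.1# ; cong = λ _ → R.refl }

    open LeftModule (Free ⊤-setoid) using (*ₗ-congˡ)

    collect : ∀ s → LeftModule._≈ᴹ_ (Free ⊤-setoid) s ((extend ⊤-setoid 𝟙 one ⟨$⟩ s) ⊙ gen tt)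
    collect s = at (≗-on-generators (Free ⊤-setoid) {f = idₗ} {g = g} λ _ → ≋-sym (⊙-identityˡ _)) s
      where
      g : Free ⊤-setoid ⟶ Free ⊤-setoid
      g = linear 𝟙 (Free ⊤-setoid) (_⊙ gen tt) (λ e → ⊙-cong e ≋-refl)
            (λ q r → ⊙-distribʳ _ q r) (λ q r → ⊙-assoc q r _)
          ∘ₗ extend ⊤-setoid 𝟙 one

  -- The LC-module with pseudobasis X is dual to the free module on X: its
  -- elements, the functions X → R, are the formal infinite combinations of X.

  module _ (X : DecSetoid 0ℓ 0ℓ) where
    private module X = DecSetoid X

    LC : LCModule
    LC = record
      { A       = Free X.setoid
      ; Index   = X.setoid
      ; basis   = generators
      ; isBasis = (λ {s} {t} e → ≋-trans (≋-sym (at extend≗id s)) (≋-trans e (at extend≗id t)))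
                , λ s → s , λ {t} e → ≋-trans (at extend≗id t) e
      ; B       = Dual (Free X.setoid)
      ; pairing = idₗ
      ; perfect = id , λ f → f , id
      }
      where
      generators : Func X.setoid (LeftModule.≈ᴹ-setoid (Free X.setoid))
      generators = record { to = gen ; cong = λ e → ≋-relation (gen-cong e) }

      extend≗id : extend X.setoid (Free X.setoid) generators ≗ idₗ
      extend≗id = ≗-on-generators (Free X.setoid) λ _ → ≋-refl

    kronecker : X.Carrier → X.Carrier → R.Carrier
    kronecker x y = if does (x X.≟ y) then R.1# else R.0#

    pseudobasis : X.Carrier → LeftModule.Carrierᴹ (B LC)
    pseudobasis y = extend X.setoid 𝟙 (record
      { to   = λ x → kronecker x y
      ; cong = λ {x} {x′} e → R.reflexive (cong (λ b → if b then R.1# else R.0#)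
          (does-⇔ (mk⇔ (X.trans (X.sym e)) (X.trans e)) (x X.≟ y) (x′ X.≟ y)))
      })

  -- The adjoint of the product of B is the coproduct of A, and vice versa.

  record IsLCHopfAlgebra (M : LCModule)
    (∇ : ContinuousLinear (M ⊗̂ M) M) (ι : ContinuousLinear 𝕂 M)
    (Δ : ContinuousLinear M (M ⊗̂ M)) (ε : ContinuousLinear M 𝕂) : Set where
    field
      antipode : ContinuousLinear M M
      ∇*       : A M ⟶ A M ⊗ A M
      ι*       : A M ⟶ 𝟙
      Δ*       : A M ⊗ A M ⟶ A M
      ε*       : 𝟙 ⟶ A M
      S*       : A M ⟶ A M
      ∇-adjoint : IsAdjoint (M ⊗̂ M) M ∇ ∇*
      ι-adjoint : IsAdjoint 𝕂 M ι ι*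
      Δ-adjoint : IsAdjoint M (M ⊗̂ M) Δ Δ*
      ε-adjoint : IsAdjoint M 𝕂 ε ε*
      antipode-adjoint : IsAdjoint M M antipode S*
      isHopfAlgebra : IsHopfAlgebra (A M) Δ* ε* ∇* ι* S*

  record IsCommutativeLCHopfAlgebra (M : LCModule)
    (∇ : ContinuousLinear (M ⊗̂ M) M) (ι : ContinuousLinear 𝕂 M)
    (Δ : ContinuousLinear M (M ⊗̂ M)) (ε : ContinuousLinear M 𝕂) : Set where
    field
      isLCHopfAlgebra : IsLCHopfAlgebra M ∇ ι Δ ε
      commutative     : toLinear ∇ ∘ₗ τ M ≗ toLinear ∇

-- Up to isomorphism every finite poset has underlying set Fin n, and its
-- order, being decidable, is given by a Boolean-valued function.

record LPoset : Set where
  field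
    size : ℕ
    _≤ᵇ_ : Fin size → Fin size → Bool

  infix 4 _≤_ _<_ _⋖_

  _≤_ : Rel (Fin size) 0ℓ
  s ≤ t = T (s ≤ᵇ t)

  field
    isPartialOrder : IsPartialOrder _≡_ _≤_
    γ              : Fin size → ℤ
    γ-injective    : Injective _≡_ _≡_ γ

  open IsPartialOrder isPartialOrder public using (antisym) renaming (refl to ≤-refl)

  _<_ : Rel (Fin size) 0ℓ
  s < t = s ≤ t × s ≢ t

  _⋖_ : Rel (Fin size) 0ℓ
  s ⋖ t = s < t × ¬ (∃ λ u → s < u × u < t)

  infix 4 _≤?_ _<?_ _⋖?_

  _≤?_ : Decidable _≤_
  s ≤? t = T? (s ≤ᵇ t)

  _<?_ : Decidable _<_
  s <? t = (s ≤? t) ×-dec ¬? (s Fin.≟ t)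

  _⋖?_ : Decidable _⋖_
  s ⋖? t = (s <? t) ×-dec ¬? (any? λ u → (s <? u) ×-dec (u <? t))

infix 4 _≅_ _≅?_

record _≅_ (P Q : LPoset) : Set where
  private
    module P = LPoset P
    module Q = LPoset Q
  field
    φ                  : Fin P.size → Fin Q.size
    isOrderIsomorphism : IsOrderIsomorphism _≡_ _≡_ P._≤_ Q._≤_ φ
    descents           : ∀ {s t} → s P.⋖ t → (P.γ s ℤ.> P.γ t) ⇔ (Q.γ (φ s) ℤ.> Q.γ (φ t))

  open IsOrderIsomorphism isOrderIsomorphism public

≅-refl : ∀ {P} → P ≅ P
≅-refl = record
  { φ                  = id
  ; isOrderIsomorphism = record
    { isOrderMonomorphism = record
      { isOrderHomomorphism = record { cong = id ; mono = id }
      ; injective           = id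
      ; cancel              = id
      }
    ; surjective = λ y → y , id
    }
  ; descents = λ _ → mk⇔ id id
  }

module _ {P Q : LPoset} (i : P ≅ Q) where
  private
    module P = LPoset P
    module Q = LPoset Q
    module i = _≅_ i

  ψ : Fin Q.size → Fin P.size
  ψ y = proj₁ (i.surjective y)

  φψ : ∀ y → i.φ (ψ y) ≡ y
  φψ y = proj₂ (i.surjective y) refl

  ψφ : ∀ x → ψ (i.φ x) ≡ x
  ψφ x = i.injective (φψ (i.φ x))

  ψ-injective : Injective _≡_ _≡_ ψ
  ψ-injective {y} {z} e = trans (sym (φψ y)) (trans (cong i.φ e) (φψ z))

  ψ-mono : ∀ {y z} → y Q.≤ z → ψ y P.≤ ψ z
  ψ-mono le = i.cancel (subst₂ Q._≤_ (sym (φψ _)) (sym (φψ _)) le)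

  ψ-cancel : ∀ {y z} → ψ y P.≤ ψ z → y Q.≤ z
  ψ-cancel le = subst₂ Q._≤_ (φψ _) (φψ _) (i.mono le)

  ≅-mono-⋖ : ∀ {s t} → s P.⋖ t → i.φ s Q.⋖ i.φ t
  ≅-mono-⋖ ((s≤t , s≢t) , nothing-between) =
    (i.mono s≤t , s≢t ∘ i.injective) , λ (u , (s≤u , s≢u) , (u≤t , u≢t)) →
      nothing-between
        ( ψ u
        , (subst (P._≤ ψ u) (ψφ _) (ψ-mono s≤u) , λ e → s≢u (trans (cong i.φ e) (φψ u)))
        , (subst (ψ u P.≤_) (ψφ _) (ψ-mono u≤t) , λ e → u≢t (trans (sym (φψ u)) (cong i.φ e)))
        )

  ≅-sym : Q ≅ P
  ≅-sym = record
    { φ                  = ψ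
    ; isOrderIsomorphism = record
      { isOrderMonomorphism = record
        { isOrderHomomorphism = record { cong = cong ψ ; mono = ψ-mono }
        ; injective           = ψ-injective
        ; cancel              = ψ-cancel
        }
      ; surjective = λ x → i.φ x , λ { refl → ψφ x }
      }
    ; descents = descents
    }
    where
    ψ-mono-⋖ : ∀ {y z} → y Q.⋖ z → ψ y P.⋖ ψ z
    ψ-mono-⋖ ((y≤z , y≢z) , nothing-between) =
      (ψ-mono y≤z , y≢z ∘ ψ-injective) , λ (u , (y≤u , y≢u) , (u≤z , u≢z)) →
        nothing-between
          ( i.φ u
          , (subst (Q._≤ i.φ u) (φψ _) (i.mono y≤u) , λ e → y≢u (trans (cong ψ e) (ψφ u)))
          , (subst (i.φ u Q.≤_) (φψ _) (i.mono u≤z) , λ e → u≢z (trans (sym (ψφ u)) (cong ψ e)))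
          )

    descents : ∀ {y z} → y Q.⋖ z → (Q.γ y ℤ.> Q.γ z) ⇔ (P.γ (ψ y) ℤ.> P.γ (ψ z))
    descents {y} {z} y⋖z = mk⇔
      (λ d → from (subst₂ (λ a b → Q.γ a ℤ.> Q.γ b) (sym (φψ y)) (sym (φψ z)) d))
      (λ d → subst₂ (λ a b → Q.γ a ℤ.> Q.γ b) (φψ y) (φψ z) (to d))
      where open Equivalence (i.descents (ψ-mono-⋖ y⋖z))

≅-trans : ∀ {P Q S} → P ≅ Q → Q ≅ S → P ≅ S
≅-trans i j = record
  { φ                  = j.φ ∘ i.φ
  ; isOrderIsomorphism = record
    { isOrderMonomorphism = record
      { isOrderHomomorphism = record { cong = cong (j.φ ∘ i.φ) ; mono = j.mono ∘ i.mono }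
      ; injective           = i.injective ∘ j.injective
      ; cancel              = i.cancel ∘ j.cancel
      }
    ; surjective = λ z →
        proj₁ (i.surjective (proj₁ (j.surjective z))) ,
        λ { refl → proj₂ (j.surjective z) (proj₂ (i.surjective _) refl) }
    }
  ; descents = λ c → mk⇔
      (Equivalence.to (j.descents (≅-mono-⋖ i c)) ∘ Equivalence.to (i.descents c))
      (Equivalence.from (i.descents c) ∘ Equivalence.from (j.descents (≅-mono-⋖ i c)))
  }
  where
  module i = _≅_ i
  module j = _≅_ j

any-Vec? : ∀ m {n} {F : Vec (Fin n) m → Set} → (∀ v → Dec (F v)) → Dec (∃ F)
any-Vec? zero    F? = map′ ([] ,_) (λ { ([] , p) → p }) (F? [])
any-Vec? (suc m) F? = map′ (λ (x , v , p) → x ∷ v , p) (λ { (x ∷ v , p) → x , v , p })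
  (any? λ x → any-Vec? m λ v → F? (x ∷ v))

_⇔-dec_ : ∀ {X Y : Set} → Dec X → Dec Y → Dec (X ⇔ Y)
x? ⇔-dec y? = map′ (uncurry mk⇔) (λ e → Equivalence.to e , Equivalence.from e)
  ((x? →-dec y?) ×-dec (y? →-dec x?))

_≅?_ : Decidable _≅_
P ≅? Q = map′ to from (any-Vec? P.size λ v → check? (lookup v))
  where
  module P = LPoset P
  module Q = LPoset Q

  Check : (Fin P.size → Fin Q.size) → Set
  Check φ =
    (∀ s t → (s P.≤ t) ⇔ (φ s Q.≤ φ t)) ×
    (∀ y → ∃ λ x → φ x ≡ y) ×
    (∀ s t → s P.⋖ t → (P.γ s ℤ.> P.γ t) ⇔ (Q.γ (φ s) ℤ.> Q.γ (φ t)))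

  check? : ∀ φ → Dec (Check φ)
  check? φ =
    all? (λ s → all? λ t → (s P.≤? t) ⇔-dec (φ s Q.≤? φ t)) ×-dec
    all? (λ y → any? λ x → φ x Fin.≟ y) ×-dec
    all? (λ s → all? λ t → (s P.⋖? t) →-dec
      ((P.γ t ℤ.<? P.γ s) ⇔-dec (Q.γ (φ t) ℤ.<? Q.γ (φ s))))

  to : (∃ λ v → Check (lookup v)) → P ≅ Q
  to (v , order , onto , descents) = record
    { φ                  = lookup v
    ; isOrderIsomorphism = record
      { isOrderMonomorphism = record
        { isOrderHomomorphism = record
          { cong = cong (lookup v) ; mono = Equivalence.to (order _ _) }
        ; injective = λ {s} {t} e → P.antisym
            (Equivalence.from (order s t) (subst (lookup v s Q.≤_) e Q.≤-refl))
            (Equivalence.from (order t s) (subst (Q._≤ lookup v s) e Q.≤-refl))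
        ; cancel = Equivalence.from (order _ _)
        }
      ; surjective = λ y → proj₁ (onto y) , λ { refl → proj₂ (onto y) }
      }
    ; descents = descents _ _
    }

  from : P ≅ Q → ∃ λ v → Check (lookup v)
  from i = tabulate φ
    , (λ s t → subst₂ (λ a b → (s P.≤ t) ⇔ (a Q.≤ b)) (eq s) (eq t) (mk⇔ mono cancel))
    , (λ y → proj₁ (surjective y) , trans (sym (eq _)) (proj₂ (surjective y) refl))
    , (λ s t c → subst₂ (λ a b → (P.γ s ℤ.> P.γ t) ⇔ (Q.γ a ℤ.> Q.γ b)) (eq s) (eq t) (descents c))
    where
    open _≅_ i
    eq : ∀ s → φ s ≡ lookup (tabulate φ) s
    eq s = sym (Vec.lookup∘tabulate φ s)

LPosets : DecSetoid 0ℓ 0ℓ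
LPosets = record
  { Carrier          = LPoset
  ; _≈_              = _≅_
  ; isDecEquivalence = record
    { isEquivalence = record { refl = ≅-refl ; sym = ≅-sym ; trans = ≅-trans }
    ; _≟_           = _≅?_
    }
  }

∅ : LPoset
∅ = record
  { size           = 0
  ; _≤ᵇ_           = λ ()
  ; isPartialOrder = record
    { isPreorder = record
      { isEquivalence = isEquivalence
      ; reflexive     = λ { {()} }
      ; trans         = λ { {()} }
      }
    ; antisym = λ { {()} }
    }
  ; γ           = λ ()
  ; γ-injective = λ { {()} }
  }

-- The values at n = 0 are junk: the label of an element of P ⊔ Q uses the
-- maximum or minimum of the component containing that element.

max min : ∀ {n} → (Fin n → ℤ) → ℤ
max {zero}        f = 0ℤ
max {suc zero}    f = f zero
max {suc (suc n)} f = f zero ℤ.⊔ max (f ∘ suc)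
min {zero}        f = 0ℤ
min {suc zero}    f = f zero
min {suc (suc n)} f = f zero ℤ.⊓ min (f ∘ suc)

≤-max : ∀ {n} (f : Fin n → ℤ) i → f i ℤ.≤ max f
≤-max {suc zero}    f zero    = ℤ.≤-refl
≤-max {suc (suc n)} f zero    = ℤ.i≤i⊔j _ _
≤-max {suc (suc n)} f (suc i) = ℤ.≤-trans (≤-max (f ∘ suc) i) (ℤ.i≤j⊔i _ _)

min-≤ : ∀ {n} (f : Fin n → ℤ) i → min f ℤ.≤ f i
min-≤ {suc zero}    f zero    = ℤ.≤-refl
min-≤ {suc (suc n)} f zero    = ℤ.i⊓j≤i _ _
min-≤ {suc (suc n)} f (suc i) = ℤ.≤-trans (ℤ.i⊓j≤j _ _) (min-≤ (f ∘ suc) i)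

module DisjointUnion (P Q : LPoset) where
  private
    module P = LPoset P
    module Q = LPoset Q
    open GroupProperties (CommutativeRing.+-group ℤ.+-*-commutativeRing)
      using () renaming (∙-cancelʳ to +-cancelʳ)

  ⊎-order : Fin P.size ⊎ Fin Q.size → Fin P.size ⊎ Fin Q.size → Bool
  ⊎-order (inj₁ s) (inj₁ t) = s P.≤ᵇ t
  ⊎-order (inj₁ s) (inj₂ t) = false
  ⊎-order (inj₂ s) (inj₁ t) = false
  ⊎-order (inj₂ s) (inj₂ t) = s Q.≤ᵇ t

  _⊑_ : Fin (P.size ℕ.+ Q.size) → Fin (P.size ℕ.+ Q.size) → Bool
  s ⊑ t = ⊎-order (splitAt P.size s) (splitAt P.size t)

  label : Fin P.size ⊎ Fin Q.size → ℤ
  label (inj₁ s) = P.γ s ℤ.- max P.γ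
  label (inj₂ s) = Q.γ s ℤ.- min Q.γ ℤ.+ 1ℤ

  splitAt-injective : ∀ {s t} → splitAt P.size s ≡ splitAt P.size t → s ≡ t
  splitAt-injective {s} {t} e = trans (sym (Fin.join-splitAt P.size Q.size s))
    (trans (cong [ _↑ˡ Q.size , P.size ↑ʳ_ ]′ e) (Fin.join-splitAt P.size Q.size t))

  ⊎-refl : ∀ s → T (⊎-order s s)
  ⊎-refl (inj₁ s) = P.≤-refl
  ⊎-refl (inj₂ s) = Q.≤-refl

  ⊎-trans : ∀ s t u → T (⊎-order s t) → T (⊎-order t u) → T (⊎-order s u)
  ⊎-trans (inj₁ s) (inj₁ t) (inj₁ u) = IsPartialOrder.trans P.isPartialOrder
  ⊎-trans (inj₂ s) (inj₂ t) (inj₂ u) = IsPartialOrder.trans Q.isPartialOrder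

  ⊎-antisym : ∀ s t → T (⊎-order s t) → T (⊎-order t s) → s ≡ t
  ⊎-antisym (inj₁ s) (inj₁ t) a b = cong inj₁ (P.antisym a b)
  ⊎-antisym (inj₂ s) (inj₂ t) a b = cong inj₂ (Q.antisym a b)

  label-separates : ∀ s t → label (inj₁ s) ≢ label (inj₂ t)
  label-separates s t e = ℤ.<-irrefl e (ℤ.≤-<-trans
    (ℤ.i≤j⇒i-j≤0 (≤-max P.γ s))
    (ℤ.<-≤-trans (ℤ.+<+ (ℕ.s≤s ℕ.z≤n))
      (ℤ.+-monoˡ-≤ 1ℤ (ℤ.i≤j⇒0≤j-i (min-≤ Q.γ t)))))

  label-injective : ∀ s t → label s ≡ label t → s ≡ t
  label-injective (inj₁ s) (inj₁ t) e = cong inj₁ (P.γ-injective (+-cancelʳ _ _ _ e))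
  label-injective (inj₁ s) (inj₂ t) e = contradiction e (label-separates s t)
  label-injective (inj₂ s) (inj₁ t) e = contradiction (sym e) (label-separates t s)
  label-injective (inj₂ s) (inj₂ t) e =
    cong inj₂ (Q.γ-injective (+-cancelʳ _ _ _ (+-cancelʳ _ _ _ e)))

  union : LPoset
  union = record
    { size           = P.size ℕ.+ Q.size
    ; _≤ᵇ_           = _⊑_
    ; isPartialOrder = record
      { isPreorder = record
        { isEquivalence = isEquivalence
        ; reflexive     = λ { {s} refl → ⊎-refl (splitAt P.size s) }
        ; trans         = λ {s} {t} {u} → ⊎-trans (splitAt P.size s) (splitAt P.size t) (splitAt P.size u)
        }
      ; antisym = λ {s} {t} a b →
          splitAt-injective (⊎-antisym (splitAt P.size s) (splitAt P.size t) a b)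
      }
    ; γ           = λ s → label (splitAt P.size s)
    ; γ-injective = λ {s} {t} e →
        splitAt-injective (label-injective (splitAt P.size s) (splitAt P.size t) e)
    }

infixr 6 _⊔_

_⊔_ : LPoset → LPoset → LPoset
_⊔_ = DisjointUnion.union

-- the increasing enumeration of the elements of S
embed : ∀ {n} (S : Subset n) → Fin ∣ S ∣ → Fin n
embed (inside  ∷ S) zero    = zero
embed (inside  ∷ S) (suc i) = suc (embed S i)
embed (outside ∷ S) i       = suc (embed S i)

embed-injective : ∀ {n} (S : Subset n) → Injective _≡_ _≡_ (embed S)
embed-injective (inside  ∷ S) {zero}  {zero}  e = refl
embed-injective (inside  ∷ S) {suc i} {suc j} e =
  cong suc (embed-injective S (Fin.suc-injective e))
embed-injective (outside ∷ S) e = embed-injective S (Fin.suc-injective e)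

restrict : (P : LPoset) → Subset (LPoset.size P) → LPoset
restrict P S = record
  { size           = ∣ S ∣
  ; _≤ᵇ_           = λ s t → embed S s P.≤ᵇ embed S t
  ; isPartialOrder = record
    { isPreorder = record
      { isEquivalence = isEquivalence
      ; reflexive     = λ { refl → P.≤-refl }
      ; trans         = IsPartialOrder.trans P.isPartialOrder
      }
    ; antisym = λ a b → embed-injective S (P.antisym a b)
    }
  ; γ           = P.γ ∘ embed S
  ; γ-injective = embed-injective S ∘ P.γ-injective
  }
  where module P = LPoset P

module _ (P : LPoset) where
  open LPoset P

  IsLowerSet IsUpperSet IsAntichain : Subset size → Set
  IsLowerSet  S = ∀ x y → x < y → y ∈ S → x ∈ S
  IsUpperSet  S = ∀ x y → x < y → x ∈ S → y ∈ S
  IsAntichain S = ∀ x y → x ∈ S → y ∈ S → ¬ (x < y)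

  IsSplitting : Subset size × Subset size → Set
  IsSplitting (S , U) = IsLowerSet S × IsUpperSet U × S ∪ U ≡ full × IsAntichain (S ∩ U)

  isSplitting? : ∀ SU → Dec (IsSplitting SU)
  isSplitting? (S , U) =
    all? (λ x → all? λ y → (x <? y) →-dec (y ∈? S) →-dec (x ∈? S)) ×-dec
    all? (λ x → all? λ y → (x <? y) →-dec (x ∈? U) →-dec (y ∈? U)) ×-dec
    Vec.≡-dec Bool._≟_ (S ∪ U) full ×-dec
    all? (λ x → all? λ y → (x ∈? S ∩ U) →-dec (y ∈? S ∩ U) →-dec ¬? (x <? y))

-- each subset of Fin n exactly once
subsets : ∀ n → List (Subset n)
subsets zero    = [] ∷ []
subsets (suc n) = List.map (inside ∷_) (subsets n) ++ List.map (outside ∷_) (subsets n)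

splittings : (P : LPoset) → List (Subset (LPoset.size P) × Subset (LPoset.size P))
splittings P = filter (isSplitting? P)
  (cartesianProduct (subsets (LPoset.size P)) (subsets (LPoset.size P)))

open Polynomials public using (Poly; ℤ[β]; β)

module ℤ[β] = CommutativeRing ℤ[β]

open LinearlyCompact ℤ[β] public

𝔪LPoset : LCModule
𝔪LPoset = LC LPosets

[_] : LPoset → LeftModule.Carrierᴹ (LCModule.B 𝔪LPoset)
[_] = pseudobasis LPosets

[_]⊗[_] : LPoset → LPoset → LeftModule.Carrierᴹ (LCModule.B (𝔪LPoset ⊗̂ 𝔪LPoset))
[ P ]⊗[ Q ] = tensor 𝔪LPoset 𝔪LPoset [ P ] [ Q ]

β^_ : ℕ → Poly
β^ k = Exp._^_ ℤ[β].semiring β k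

sum : (M : Mod) → List (LeftModule.Carrierᴹ M) → LeftModule.Carrierᴹ M
sum M = foldr _+ᴹ_ 0ᴹ
  where open LeftModule M

IsLPosetProduct : ContinuousLinear (𝔪LPoset ⊗̂ 𝔪LPoset) 𝔪LPoset → Set
IsLPosetProduct ∇ = ∀ P Q → toLinear ∇ ⟨$⟩ [ P ]⊗[ Q ] ≈ᴹ [ P ⊔ Q ]
  where open LeftModule (LCModule.B 𝔪LPoset)

IsLPosetCoproduct : ContinuousLinear 𝔪LPoset (𝔪LPoset ⊗̂ 𝔪LPoset) → Set
IsLPosetCoproduct Δ = ∀ P → toLinear Δ ⟨$⟩ [ P ] ≈ᴹ
  sum (LCModule.B (𝔪LPoset ⊗̂ 𝔪LPoset))
    (List.map (λ (S , U) → (β^ ∣ S ∩ U ∣) *ₗ [ restrict P S ]⊗[ restrict P U ])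
      (splittings P))
  where open LeftModule (LCModule.B (𝔪LPoset ⊗̂ 𝔪LPoset))

IsLPosetUnit : ContinuousLinear 𝕂 𝔪LPoset → Set
IsLPosetUnit ι = toLinear ι ⟨$⟩ ℤ[β].1# ≈ᴹ [ ∅ ]
  where open LeftModule (LCModule.B 𝔪LPoset)

IsLPosetCounit : ContinuousLinear 𝔪LPoset 𝕂 → Set
IsLPosetCounit ε = ∀ P →
  toLinear ε ⟨$⟩ [ P ] ℤ[β].≈ (if does (LPoset.size P ℕ.≟ 0) then ℤ[β].1# else ℤ[β].0#)

{-# OPTIONS --safe #-}

-- The module 𝔪LPoset is dual to the free module A on isomorphism classes, so
-- the axioms are checked in A on the coefficient functionals [ P ], which
-- separate points.  The product μ of A is determined by
-- [ P ] ∘ μ = ∑ q^|S ∩ U| [ S ] ⊠ [ U ] over the splittings (S , U) of P, and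
-- its coproduct δ by ([ P ] ⊠ [ Q ]) ∘ δ = [ P ⊔ Q ]; they exist because there
-- are finitely many classes of each size.  A pair (S , U) is a splitting iff
-- S ∪ U = P and no x < y has x ∈ U and y ∈ S, so both ways of iterating a
-- splitting give the triples covering P with this property pairwise, and the
-- splittings of P ⊔ Q are the pairs of splittings of P and Q.  Embeddings that
-- respect descents at covers make these sums independent of representatives.
-- Since δ is graded and connected, the Neumann series ∑ (1 - id)^k for the
-- convolution inverse of the identity is finite on each class.

module Submission where

open import Algebra.Bundles using (CommutativeRing; Ring)
open import Algebra.Module.Bundles using (LeftModule)
import Algebra.Properties.Group as GroupProperties
import Algebra.Properties.Ring as RingProperties
import Algebra.Properties.Semiring.Exp as Exp
import Algebra.Solver.CommutativeMonoid as CommutativeMonoidSolver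
open import Data.Bool.Base using (Bool; T; true; false; if_then_else_)
open import Data.Bool.Properties as Bool using (T?)
open import Data.Fin.Base using (Fin; zero; suc; splitAt; _↑ˡ_; _↑ʳ_; toℕ; fromℕ<)
open import Data.Fin.Properties as Fin using (all?; any?)
open import Data.Fin.Subset using (Subset; inside; outside; _∈_; _∩_; _∪_; ∣_∣; ⊥) renaming (⊤ to full)
open import Data.Fin.Subset.Properties using (_∈?_; ∈⊤; ∉⊥; ⊆-antisym; ∪⇔⊎; ∩⇔×; ∣p∣≤n; p⊂q⇒∣p∣<∣q∣; ∣⊥∣≡0;
  ∪-assoc; ∪-identityˡ; ∪-identityʳ; ∩-zeroˡ; ∩-zeroʳ)
open import Data.Integer.Base as ℤ using (ℤ)
import Data.Integer.Properties as ℤ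
open import Data.List.Base
  using (List; []; _∷_; _++_; map; concatMap; foldr; filter; cartesianProduct; cartesianProductWith;
      deduplicate; allFin; upTo)
import Data.List.Membership.Propositional as List
import Data.List.Membership.Propositional.Properties as List
import Data.List.Membership.Setoid.Properties as Membership
open import Data.List.Relation.Unary.All as All using (All; []; _∷_)
import Data.List.Relation.Unary.All.Properties as All
open import Data.List.Relation.Unary.AllPairs using (AllPairs; []; _∷_)
open import Data.List.Relation.Unary.Any as Any using (Any; here; there)
import Data.List.Relation.Unary.Any.Properties as Any
import Data.List.Relation.Unary.Unique.DecSetoid.Properties as Unique
import Data.List.Relation.Unary.Unique.Propositional.Properties as Uniqueₚ
open import Data.Nat.Base as ℕ using (ℕ; zero; suc)
import Data.Nat.Properties as ℕ
open import Data.Product using (∃; ∃!; _×_; _,_; proj₁; proj₂)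
open import Data.Sum.Base as Sum using (_⊎_; inj₁; inj₂; [_,_]′)
open import Data.Vec.Base as Vec using (Vec; []; _∷_; here; there; lookup; tabulate)
import Data.Vec.Properties as Vec
open import Function.Base using (_∘_; id)
open import Function.Bundles using (Func; _⇔_; mk⇔; Equivalence)
open import Function.Definitions using (Injective)
open import Level using (0ℓ)
open import Relation.Binary.Bundles using (Setoid; DecSetoid)
open import Relation.Binary.Definitions using (Decidable; tri<; tri≈; tri>)
open import Relation.Binary.PropositionalEquality using (_≡_; refl; sym; trans; cong; cong₂; subst; subst₂)
open import Relation.Binary.PropositionalEquality.Properties using (isEquivalence; decSetoid)
import Relation.Binary.Reasoning.Setoid as SetoidReasoning
open import Relation.Binary.Structures using (IsPartialOrder)
open import Relation.Nullary.Decidable using (Dec; does; yes; no; does-⇔; dec-true; _×-dec_; _→-dec_; ¬?)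
open import Relation.Nullary.Negation using (¬_; contradiction)
open import Relation.Unary using (Pred) renaming (Decidable to Decidable₁)

open import Defs using (module LinearlyCompact; LPoset; LPosets; _≅_; _≅?_; ≅-refl; ≅-sym; ≅-trans; ψ; φψ; ∅; _⊔_;
  module DisjointUnion; embed; embed-injective; restrict; IsSplitting; isSplitting?; splittings; subsets)

-- A class remembers labels only at covers, and a cover of a subposet need not be a cover of the
-- whole poset: corresponding subsets of isomorphic labeled posets can carry non-isomorphic labeled
-- posets. The parts of a splitting are convex, and a cover of a convex subset is a cover of the
-- whole. This is what makes the coproduct well defined on classes.
--
-- Infinite combinations are avoided by dualising: a continuous map is the transpose of a matrix
-- with finite columns, so a map into a free module may be prescribed by its coordinate functionals
-- once all but finitely many classes of them vanish on each basis vector. For the product of A this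
-- is the bound |P| ≤ |S| + |T|. Overlaps make that product inhomogeneous, so it is the grading of δ
-- that has to stop the Neumann series.
--
-- The Hopf algebra A is built over an arbitrary commutative ring with a parameter q and specialised
-- to β at the end.

module LinearAlgebra (R : CommutativeRing 0ℓ 0ℓ) where
  open LinearlyCompact R
  private module R = CommutativeRing R

  -- Finite sums in modules

  ∑ : (M : Mod) {I : Set} → List I → (I → LeftModule.Carrierᴹ M) → LeftModule.Carrierᴹ M
  ∑ M L f = foldr _+ᴹ_ 0ᴹ (map f L)
    where open LeftModule M

  module _ (M : Mod) where
    open LeftModule M
    open SetoidReasoning ≈ᴹ-setoid

    +ᴹ-medial : ∀ a b c d → (a +ᴹ b) +ᴹ (c +ᴹ d) ≈ᴹ (a +ᴹ c) +ᴹ (b +ᴹ d)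
    +ᴹ-medial a b c d = begin
      (a +ᴹ b) +ᴹ (c +ᴹ d) ≈⟨ +ᴹ-assoc a b (c +ᴹ d) ⟩
      a +ᴹ (b +ᴹ (c +ᴹ d)) ≈⟨ +ᴹ-congˡ (+ᴹ-assoc b c d) ⟨
      a +ᴹ ((b +ᴹ c) +ᴹ d) ≈⟨ +ᴹ-congˡ (+ᴹ-congʳ (+ᴹ-comm b c)) ⟩
      a +ᴹ ((c +ᴹ b) +ᴹ d) ≈⟨ +ᴹ-congˡ (+ᴹ-assoc c b d) ⟩
      a +ᴹ (c +ᴹ (b +ᴹ d)) ≈⟨ +ᴹ-assoc a c (b +ᴹ d) ⟨
      (a +ᴹ c) +ᴹ (b +ᴹ d) ∎

    module _ {I : Set} where

      ∑-cong : ∀ (L : List I) {f g} → (∀ i → f i ≈ᴹ g i) → ∑ M L f ≈ᴹ ∑ M L g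
      ∑-cong []      e = ≈ᴹ-refl
      ∑-cong (i ∷ L) e = +ᴹ-cong (e i) (∑-cong L e)

      ∑-zero : ∀ (L : List I) {f} → (∀ i → f i ≈ᴹ 0ᴹ) → ∑ M L f ≈ᴹ 0ᴹ
      ∑-zero []      e = ≈ᴹ-refl
      ∑-zero (i ∷ L) e = ≈ᴹ-trans (+ᴹ-cong (e i) (∑-zero L e)) (+ᴹ-identityˡ 0ᴹ)

      ∑-+ : ∀ (L : List I) f g → ∑ M L (λ i → f i +ᴹ g i) ≈ᴹ ∑ M L f +ᴹ ∑ M L g
      ∑-+ []      f g = ≈ᴹ-sym (+ᴹ-identityˡ 0ᴹ)
      ∑-+ (i ∷ L) f g = ≈ᴹ-trans (+ᴹ-congˡ (∑-+ L f g)) (+ᴹ-medial _ _ _ _)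

      ∑-++ : ∀ (L L′ : List I) f → ∑ M (L ++ L′) f ≈ᴹ ∑ M L f +ᴹ ∑ M L′ f
      ∑-++ []      L′ f = ≈ᴹ-sym (+ᴹ-identityˡ _)
      ∑-++ (i ∷ L) L′ f = ≈ᴹ-trans (+ᴹ-congˡ (∑-++ L L′ f)) (≈ᴹ-sym (+ᴹ-assoc _ _ _))

    ∑-map : ∀ {I J : Set} (h : I → J) L f → ∑ M (map h L) f ≡ ∑ M L (f ∘ h)
    ∑-map h []      f = refl
    ∑-map h (i ∷ L) f = cong (f (h i) +ᴹ_) (∑-map h L f)

    ∑-swap : ∀ {I J : Set} (L : List I) (L′ : List J) (f : I → J → Carrierᴹ) →
      ∑ M L (λ i → ∑ M L′ (f i)) ≈ᴹ ∑ M L′ (λ j → ∑ M L (λ i → f i j))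
    ∑-swap []      L′ f = ≈ᴹ-sym (∑-zero L′ (λ _ → ≈ᴹ-refl))
    ∑-swap (i ∷ L) L′ f = ≈ᴹ-trans (+ᴹ-congˡ (∑-swap L L′ f)) (≈ᴹ-sym (∑-+ L′ (f i) _))

    ∑-cartesianProduct : ∀ {I J : Set} (L : List I) (L′ : List J) (f : I × J → Carrierᴹ) →
      ∑ M (cartesianProduct L L′) f ≈ᴹ ∑ M L (λ i → ∑ M L′ (λ j → f (i , j)))
    ∑-cartesianProduct []      L′ f = ≈ᴹ-refl
    ∑-cartesianProduct (i ∷ L) L′ f = ≈ᴹ-trans (∑-++ (map (i ,_) L′) _ f)
      (+ᴹ-cong (≈ᴹ-reflexive (∑-map (i ,_) L′ f)) (∑-cartesianProduct L L′ f))

  module _ {M N : Mod} where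
    private
      module M = LeftModule M
      module N = LeftModule N

    ∑-homo : (h : M ⟶ N) {I : Set} (L : List I) (f : I → M.Carrierᴹ) →
      h ⟨$⟩ ∑ M L f N.≈ᴹ ∑ N L (λ i → h ⟨$⟩ f i)
    ∑-homo h []      f = 0ᴹ-homo h
    ∑-homo h (i ∷ L) f = N.≈ᴹ-trans (+ᴹ-homo h _ _) (N.+ᴹ-congˡ (∑-homo h L f))

  module _ (M N : Mod) where
    private
      module M = LeftModule M
      module N = LeftModule N

    ∑-at : {I : Set} (L : List I) (f : I → M ⟶ N) (x : M.Carrierᴹ) →
      ∑ (Hom M N) L f ⟨$⟩ x N.≈ᴹ ∑ N L (λ i → f i ⟨$⟩ x)
    ∑-at []      f x = N.≈ᴹ-refl
    ∑-at (i ∷ L) f x = N.+ᴹ-congˡ (∑-at L f x)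

  -- The Iverson bracket. It turns a sum over a filtered list into a sum over the whole list, where
  -- conditions become factors that can be split, exchanged and absorbed.
  𝟏 : {P : Set} → Dec P → R.Carrier
  𝟏 d = if does d then R.1# else R.0#

  𝟏-⇔ : {P Q : Set} → P ⇔ Q → (p? : Dec P) (q? : Dec Q) → 𝟏 p? R.≈ 𝟏 q?
  𝟏-⇔ e p? q? = R.reflexive (cong (λ b → if b then R.1# else R.0#) (does-⇔ e p? q?))

  𝟏-yes : {P : Set} (p? : Dec P) → P → 𝟏 p? R.≈ R.1#
  𝟏-yes (yes p) _ = R.refl
  𝟏-yes (no ¬p) p = contradiction p ¬p

  𝟏-no : {P : Set} (p? : Dec P) → ¬ P → 𝟏 p? R.≈ R.0#
  𝟏-no (yes p) ¬p = contradiction p ¬p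
  𝟏-no (no _)  _  = R.refl

  𝟏-× : {P Q : Set} (p? : Dec P) (q? : Dec Q) → 𝟏 (p? ×-dec q?) R.≈ 𝟏 p? R.* 𝟏 q?
  𝟏-× (yes _) (yes _) = R.sym (R.*-identityˡ _)
  𝟏-× (yes _) (no _)  = R.sym (R.*-identityˡ _)
  𝟏-× (no _)  _       = R.sym (R.zeroˡ _)

  module _ (M : Mod) where
    open LeftModule M

    𝟏*-cong : {P : Set} (p? : Dec P) {x y : Carrierᴹ} → (P → x ≈ᴹ y) → 𝟏 p? *ₗ x ≈ᴹ 𝟏 p? *ₗ y
    𝟏*-cong (yes p) e = *ₗ-congˡ (e p)
    𝟏*-cong (no _)  e = ≈ᴹ-trans (*ₗ-zeroˡ _) (≈ᴹ-sym (*ₗ-zeroˡ _))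

    ∑-filter : {I : Set} {P : Pred I 0ℓ} (P? : Decidable₁ P) (L : List I) (f : I → Carrierᴹ) →
      ∑ M (filter P? L) f ≈ᴹ ∑ M L (λ i → 𝟏 (P? i) *ₗ f i)
    ∑-filter P? []      f = ≈ᴹ-refl
    ∑-filter P? (i ∷ L) f with P? i
    ... | yes _ = +ᴹ-cong (≈ᴹ-sym (*ₗ-identityˡ _)) (∑-filter P? L f)
    ... | no _  = ≈ᴹ-trans (∑-filter P? L f)
      (≈ᴹ-trans (≈ᴹ-sym (+ᴹ-identityˡ _)) (+ᴹ-congʳ (≈ᴹ-sym (*ₗ-zeroˡ _))))

  module _ (X : DecSetoid 0ℓ 0ℓ) (M : Mod) where
    private module X = DecSetoid X
    open LeftModule M

    ∑-kronecker : {L : List X.Carrier} → AllPairs (λ x y → ¬ (x X.≈ y)) L →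
      ∀ {y} → Any (y X.≈_) L → (f : X.Carrier → Carrierᴹ) → (∀ {x x′} → x X.≈ x′ → f x ≈ᴹ f x′) →
      ∑ M L (λ x → 𝟏 (y X.≟ x) *ₗ f x) ≈ᴹ f y
    ∑-kronecker {x ∷ L} (x∉ ∷ u) {y} (here y≈x) f f-cong = ≈ᴹ-trans
      (+ᴹ-cong
        (≈ᴹ-trans (*ₗ-congʳ (𝟏-yes (y X.≟ x) y≈x)) (≈ᴹ-trans (*ₗ-identityˡ _) (f-cong (X.sym y≈x))))
        (rest L x∉))
      (+ᴹ-identityʳ _)
      where
      rest : ∀ L → All (λ z → ¬ (x X.≈ z)) L → ∑ M L (λ x → 𝟏 (y X.≟ x) *ₗ f x) ≈ᴹ 0ᴹ
      rest []      []       = ≈ᴹ-refl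
      rest (z ∷ L) (p ∷ ps) = ≈ᴹ-trans (+ᴹ-cong
        (≈ᴹ-trans (*ₗ-congʳ (𝟏-no (y X.≟ z) λ y≈z → p (X.trans (X.sym y≈x) y≈z))) (*ₗ-zeroˡ _))
        (rest L ps)) (+ᴹ-identityˡ 0ᴹ)
    ∑-kronecker {x ∷ L} (x∉ ∷ u) {y} (there y∈) f f-cong = ≈ᴹ-trans
      (+ᴹ-cong
        (≈ᴹ-trans (*ₗ-congʳ (𝟏-no (y X.≟ x) λ y≈x → absurd x∉ y∈ (X.sym y≈x))) (*ₗ-zeroˡ _))
        (∑-kronecker u y∈ f f-cong))
      (+ᴹ-identityˡ _)
      where
      absurd : ∀ {x L} → All (λ z → ¬ (x X.≈ z)) L → Any (y X.≈_) L → ¬ (x X.≈ y)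
      absurd (p ∷ ps) (here e)  x≈y = p (X.trans x≈y e)
      absurd (p ∷ ps) (there a) x≈y = absurd ps a x≈y

  -- Tensor products, dual bases and adjoints

  open LCModule using (A; B)

  module _ {M N : Mod} where
    private
      module M = LeftModule M
      module N = LeftModule N

    rankOne : M ⟶ 𝟙 → N.Carrierᴹ → M ⟶ N
    rankOne f y = linear M N (λ x → (f ⟨$⟩ x) N.*ₗ y)
      (λ e → N.*ₗ-congʳ (⟦⟧-cong f e))
      (λ x x′ → N.≈ᴹ-trans (N.*ₗ-congʳ (+ᴹ-homo f x x′)) (N.*ₗ-distribʳ y _ _))
      (λ r x → N.≈ᴹ-trans (N.*ₗ-congʳ (*ₗ-homo f r x)) (N.*ₗ-assoc r _ y))

    -- The mirror image of `pure`, for holding the right factor fixed.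
    insertʳ : N.Carrierᴹ → M ⟶ M ⊗ N
    insertʳ y = linear M (M ⊗ N) (λ x → gen (x , y))
      (λ e → ≋-relation (⊗-cong e N.≈ᴹ-refl))
      (λ x x′ → ≋-relation (⊗-+ˡ x x′ y))
      (λ r x → ≋-relation (⊗-*ˡ r x y))

    infixr 10 _⊠_

    _⊠_ : M ⟶ 𝟙 → N ⟶ 𝟙 → M ⊗ N ⟶ 𝟙
    f ⊠ g = unitˡ 𝟙 ∘ₗ f ⊗₁ g

    ⊠-cong : ∀ {f f′ : M ⟶ 𝟙} {g g′ : N ⟶ 𝟙} → f ≗ f′ → g ≗ g′ → f ⊠ g ≗ f′ ⊠ g′
    ⊠-cong e e′ = ≗-on-generators 𝟙 λ (x , y) → R.*-cong (at e x) (at e′ y)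

  -- The generators of an iterated tensor product contain arbitrary elements of the inner product,
  -- so `≗-on-generators` has to be applied a second time with the outer factor fixed.
  ⊗-extˡ : ∀ {M N P Q} {f g : (M ⊗ N) ⊗ P ⟶ Q} →
    (∀ x y z → LeftModule._≈ᴹ_ Q (f ⟨$⟩ gen (gen (x , y) , z)) (g ⟨$⟩ gen (gen (x , y) , z))) → f ≗ g
  ⊗-extˡ {Q = Q} {f} {g} e = ≗-on-generators Q λ (w , z) →
    at (≗-on-generators Q {f = f ∘ₗ insertʳ z} {g = g ∘ₗ insertʳ z} λ (x , y) → e x y z) w

  ⊗-extʳ : ∀ {M N P Q} {f g : M ⊗ (N ⊗ P) ⟶ Q} →
    (∀ x y z → LeftModule._≈ᴹ_ Q (f ⟨$⟩ gen (x , gen (y , z))) (g ⟨$⟩ gen (x , gen (y , z)))) → f ≗ g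
  ⊗-extʳ {M} {N} {P} {Q} {f} {g} e = ≗-on-generators Q λ (x , w) →
    at (≗-on-generators Q {f = f ∘ₗ (pure M (N ⊗ P) ⟨$⟩ x)} {g = g ∘ₗ (pure M (N ⊗ P) ⟨$⟩ x)}
      λ (y , z) → e x y z) w

  ⊗-extˡʳ : ∀ {M N P Q T} {f g : (M ⊗ N) ⊗ (P ⊗ Q) ⟶ T} →
    (∀ x y z w → LeftModule._≈ᴹ_ T
      (f ⟨$⟩ gen (gen (x , y) , gen (z , w))) (g ⟨$⟩ gen (gen (x , y) , gen (z , w)))) → f ≗ g
  ⊗-extˡʳ {T = T} {f} {g} e = ⊗-extʳ λ u z w →
    at (≗-on-generators T {f = f ∘ₗ insertʳ (gen (z , w))} {g = g ∘ₗ insertʳ (gen (z , w))}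
      λ (x , y) → e x y z w) u

  -- The coordinate functionals, which represent the pseudobasis, with the decidable index equality
  -- needed to collapse Kronecker sums. As a separate structure it covers the module on posets, its
  -- tensor powers and `𝕂` at once.
  record DualBasis (M : LCModule) : Set where
    private module I = Setoid (LCModule.Index M)
    field
      _≟_        : Decidable I._≈_
      coef       : I.Carrier → A M ⟶ 𝟙
      coef-basis : ∀ x y → coef y ⟨$⟩ Func.to (LCModule.basis M) x R.≈ 𝟏 (x ≟ y)

    index : DecSetoid 0ℓ 0ℓ
    index = record { isDecEquivalence = record { isEquivalence = I.isEquivalence ; _≟_ = _≟_ } }

  infixr 7 _⊗ᵈ_

  _⊗ᵈ_ : ∀ {M N} → DualBasis M → DualBasis N → DualBasis (M ⊗̂ N)
  D ⊗ᵈ E = record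
    { _≟_        = λ (x , y) (x′ , y′) → (x D.≟ x′) ×-dec (y E.≟ y′)
    ; coef       = λ (x , y) → D.coef x ⊠ E.coef y
    ; coef-basis = λ (x , y) (x′ , y′) → R.trans (R.*-cong (D.coef-basis x x′) (E.coef-basis y y′))
        (R.sym (𝟏-× (x D.≟ x′) (y E.≟ y′)))
    }
    where
    module D = DualBasis D
    module E = DualBasis E

  𝕂-dualBasis : DualBasis 𝕂
  𝕂-dualBasis = record
    { _≟_        = λ _ _ → yes refl
    ; coef       = λ _ → idₗ
    ; coef-basis = λ _ _ → R.refl
    }

  -- Not invariant under `≋`; it serves only as a finite set outside of which all coordinates of the
  -- term vanish.
  generators : ∀ {G : Set} → Term G → List G
  generators (gen x) = x ∷ []
  generators 𝟘       = []
  generators (s ⊕ t) = generators s ++ generators t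
  generators (⊖ s)   = generators s
  generators (r ⊙ s) = generators s

  module _ {M : LCModule} (D : DualBasis M) where
    private
      module M = LCModule M
      module A = LeftModule M.A
    open DualBasis D
    open DecSetoid index using () renaming (Carrier to I; _≈_ to _≈ᴵ_; refl to ≈ᴵ-refl; setoid to I-setoid)
    open Func M.basis using () renaming (to to e; cong to e-cong)

    private
      ext : Free I-setoid ⟶ M.A
      ext = extend I-setoid M.A M.basis

    -- The identity truncated to finitely many coordinates, a finite substitute for expanding an
    -- element in the whole basis.
    project : List I → M.A ⟶ M.A
    project L = ∑ (Hom M.A M.A) L (λ x → rankOne (coef x) (e x))

    project-fixes : ∀ {L} → AllPairs (λ x y → ¬ (x ≈ᴵ y)) L →
      ∀ t → All (λ y → Any (y ≈ᴵ_) L) (generators t) → project L ⟨$⟩ (ext ⟨$⟩ t) A.≈ᴹ ext ⟨$⟩ t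
    project-fixes {L} u = go
      where
      p = project L
      go : ∀ t → All (λ y → Any (y ≈ᴵ_) L) (generators t) → p ⟨$⟩ (ext ⟨$⟩ t) A.≈ᴹ ext ⟨$⟩ t
      go (gen y) (y∈ ∷ []) = A.≈ᴹ-trans (∑-at M.A M.A L _ (e y)) (A.≈ᴹ-trans
        (∑-cong M.A L λ x → A.*ₗ-congʳ (coef-basis y x))
        (∑-kronecker index M.A u y∈ e e-cong))
      go 𝟘       _  = 0ᴹ-homo p
      go (s ⊕ t) in-L = A.≈ᴹ-trans (+ᴹ-homo p _ _) (A.+ᴹ-cong
        (go s (All.++⁻ˡ (generators s) in-L)) (go t (All.++⁻ʳ (generators s) in-L)))
      go (⊖ s)   in-L = A.≈ᴹ-trans (-ᴹ-homo p _) (A.-ᴹ‿cong (go s in-L))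
      go (r ⊙ s) in-L = A.≈ᴹ-trans (*ₗ-homo p r _) (A.*ₗ-congˡ (go s in-L))

    ∈-deduplicate : ∀ {L y} → Any (y ≈ᴵ_) L → Any (y ≈ᴵ_) (deduplicate _≟_ L)
    ∈-deduplicate = Membership.∈-deduplicate⁺ I-setoid _≟_
        (λ {x} {y} {z} x≈y z≈y → DecSetoid.trans index z≈y (DecSetoid.sym index x≈y))

    private
      term : A.Carrierᴹ → Term I
      term m = proj₁ (proj₂ M.isBasis m)

      ext-term : ∀ m → ext ⟨$⟩ term m A.≈ᴹ m
      ext-term m = proj₂ (proj₂ M.isBasis m) ≋-refl

    coordinates : M.A ⟶ Free I-setoid
    coordinates = linear M.A (Free I-setoid) term
      (λ {m} {m′} m≈m′ → proj₁ M.isBasis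
        (A.≈ᴹ-trans (ext-term m) (A.≈ᴹ-trans m≈m′ (A.≈ᴹ-sym (ext-term m′)))))
      (λ m m′ → proj₁ M.isBasis
        (A.≈ᴹ-trans (ext-term _) (A.≈ᴹ-sym (A.+ᴹ-cong (ext-term m) (ext-term m′)))))
      (λ r m → proj₁ M.isBasis
        (A.≈ᴹ-trans (ext-term _) (A.≈ᴹ-sym (A.*ₗ-congˡ (ext-term m)))))

    -- Duplicates are removed because `project` would count a repeated basis vector twice.
    support : List A.Carrierᴹ → List I
    support ms = deduplicate _≟_ (concatMap (generators ∘ term) ms)

    project-support : ∀ ms → All (λ m → project (support ms) ⟨$⟩ m A.≈ᴹ m) ms
    project-support ms = All.map
      (λ {m} in-L → A.≈ᴹ-trans (⟦⟧-cong p (A.≈ᴹ-sym (ext-term m)))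
        (A.≈ᴹ-trans (project-fixes (Unique.deduplicate-! index _) (term m) in-L) (ext-term m)))
      (All.map⁻ (All.concat⁻ {xss = map (generators ∘ term) ms}
        (All.tabulate λ y∈ → ∈-deduplicate (Any.map (λ { refl → ≈ᴵ-refl }) y∈))))
      where p = project (support ms)

    -- The element `m` is a finite combination of basis vectors, and each summand dies either
    -- through its coefficient or through `h`. With `h` the identity this gives the separation of
    -- points; with a general `h` it needs to be tested only on basis vectors that occur in `m`.
    ⟶-vanishes : ∀ {N} (h : M.A ⟶ N) m →
      (∀ x → (coef x ⟨$⟩ m R.≈ R.0#) ⊎ LeftModule._≈ᴹ_ N (h ⟨$⟩ e x) (LeftModule.0ᴹ N)) →
      LeftModule._≈ᴹ_ N (h ⟨$⟩ m) (LeftModule.0ᴹ N)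
    ⟶-vanishes {N} h m dies with project-support (m ∷ [])
    ... | fixed ∷ [] = begin
      h ⟨$⟩ m                    ≈⟨ ⟦⟧-cong h fixed ⟨
      h ⟨$⟩ (project L ⟨$⟩ m)    ≈⟨ ⟦⟧-cong h (∑-at M.A M.A L _ m) ⟩
      h ⟨$⟩ ∑ M.A L (λ x → (coef x ⟨$⟩ m) A.*ₗ e x) ≈⟨ ∑-homo h L _ ⟩
      ∑ N L (λ x → h ⟨$⟩ ((coef x ⟨$⟩ m) A.*ₗ e x)) ≈⟨ ∑-zero N L
          (λ x → N.≈ᴹ-trans (*ₗ-homo h _ _) (vanish x (dies x))) ⟩
      N.0ᴹ ∎
      where
      module N = LeftModule N
      open SetoidReasoning N.≈ᴹ-setoid
      L = support (m ∷ [])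
      vanish : ∀ x → (coef x ⟨$⟩ m R.≈ R.0#) ⊎ (h ⟨$⟩ e x N.≈ᴹ N.0ᴹ) → (coef x ⟨$⟩ m) N.*ₗ (h ⟨$⟩ e x) N.≈ᴹ N.0ᴹ
      vanish x (inj₁ c) = N.≈ᴹ-trans (N.*ₗ-congʳ c) (N.*ₗ-zeroˡ _)
      vanish x (inj₂ z) = N.≈ᴹ-trans (N.*ₗ-congˡ z) (N.*ₗ-zeroʳ _)

    coef-separates : ∀ {m m′} → (∀ x → coef x ⟨$⟩ m R.≈ coef x ⟨$⟩ m′) → m A.≈ᴹ m′
    coef-separates {m} {m′} same = x∙y⁻¹≈ε⇒x≈y m m′ (⟶-vanishes idₗ _ λ x → inj₁
      (R.trans (+ᴹ-homo (coef x) _ _) (R.trans (R.+-cong (same x) (-ᴹ-homo (coef x) _)) (R.-‿inverseʳ _))))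
      where open GroupProperties A.+ᴹ-group

    coef-separates-⟶ : ∀ {N} {f g : N ⟶ M.A} → (∀ x → coef x ∘ₗ f ≗ coef x ∘ₗ g) → f ≗ g
    coef-separates-⟶ same = mk λ m → coef-separates λ x → at (same x) m

  module _ {M N : LCModule} (D : DualBasis M) (E : DualBasis N) where
    private
      module M = LCModule M
      module N = LCModule N
      module D = DualBasis D
      module E = DualBasis E
      module I = DecSetoid D.index
      module J = DecSetoid E.index
      module MA = LeftModule M.A
      module NA = LeftModule N.A
      e = Func.to M.basis

    -- The columns of the matrix (F y (e x)) are finite, as every F y (e x) is
    -- zero unless y belongs to the list assigned to x.

    module _
      (F : J.Carrier → M.A ⟶ 𝟙)
      (F-cong : ∀ {y y′} → y J.≈ y′ → F y ≗ F y′)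
      (rows : I.Carrier → List J.Carrier)
      (rows-complete : ∀ x y → Any (y J.≈_) (rows x) ⊎ (F y ⟨$⟩ e x R.≈ R.0#))
      where

      private
        column : I.Carrier → NA.Carrierᴹ
        column x = ∑ N.A (deduplicate E._≟_ (rows x)) (λ y → (F y ⟨$⟩ e x) NA.*ₗ Func.to N.basis y)

        coef-column : ∀ x y → E.coef y ⟨$⟩ column x R.≈ F y ⟨$⟩ e x
        coef-column x y = begin
          E.coef y ⟨$⟩ column x
            ≈⟨ ∑-homo (E.coef y) L _ ⟩
          ∑ 𝟙 L (λ y′ → E.coef y ⟨$⟩ ((F y′ ⟨$⟩ e x) NA.*ₗ Func.to N.basis y′))
            ≈⟨ ∑-cong 𝟙 L (λ y′ → R.trans (*ₗ-homo (E.coef y) _ _) (R.trans (R.*-comm _ _)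
                 (R.*-congʳ (R.trans (E.coef-basis y′ y) (𝟏-⇔ (mk⇔ J.sym J.sym) (y′ E.≟ y) (y E.≟ y′)))))) ⟩
          ∑ 𝟙 L (λ y′ → 𝟏 (y E.≟ y′) R.* (F y′ ⟨$⟩ e x))
            ≈⟨ collapse (rows-complete x y) ⟩
          F y ⟨$⟩ e x ∎
          where
          open SetoidReasoning R.setoid
          L = deduplicate E._≟_ (rows x)
          collapse : Any (y J.≈_) (rows x) ⊎ (F y ⟨$⟩ e x R.≈ R.0#) →
            ∑ 𝟙 L (λ y′ → 𝟏 (y E.≟ y′) R.* (F y′ ⟨$⟩ e x)) R.≈ F y ⟨$⟩ e x
          collapse (inj₁ y∈) = ∑-kronecker E.index 𝟙 (Unique.deduplicate-! E.index _) (∈-deduplicate E y∈)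
            (λ y′ → F y′ ⟨$⟩ e x) (λ y≈ → at (F-cong y≈) (e x))
          collapse (inj₂ F≈0) = R.trans (∑-zero 𝟙 L λ y′ → R.trans
            (𝟏*-cong 𝟙 (y E.≟ y′) (λ y≈ → R.trans (R.sym (at (F-cong y≈) (e x))) F≈0)) (R.zeroʳ _)) (R.sym F≈0)

        columns : Func I.setoid NA.≈ᴹ-setoid
        columns = record
          { to   = column
          -- Equivalent indices may come with different lists `rows`, so the columns are compared by
          -- their coordinates, which do not depend on the lists.
          ; cong = λ {x} {x′} x≈x′ → coef-separates E λ y → R.trans (coef-column x y)
              (R.trans (⟦⟧-cong (F y) (Func.cong M.basis x≈x′)) (R.sym (coef-column x′ y)))
          }

      fromRows : ∃ λ (g : M.A ⟶ N.A) → ∀ y → E.coef y ∘ₗ g ≗ F y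
      fromRows = extend I.setoid N.A columns ∘ₗ coordinates D , λ y → mk λ m → R.trans
        (at (≗-on-generators 𝟙 {f = E.coef y ∘ₗ extend I.setoid N.A columns} {g = F y ∘ₗ extend I.setoid M.A M.basis}
          (λ x → coef-column x y)) (coordinates D ⟨$⟩ m))
        (⟦⟧-cong (F y) (proj₂ (proj₂ M.isBasis m) ≋-refl))

  module _ (M N : LCModule) where
    private
      module M = LCModule M
      module N = LCModule N
      module MB = LeftModule M.B
      module NB = LeftModule N.B

      pairing⁻¹ : N.A ⟶ 𝟙 → NB.Carrierᴹ
      pairing⁻¹ f = proj₁ (proj₂ N.perfect f)

      pairing-pairing⁻¹ : ∀ f → N.pairing ⟨$⟩ pairing⁻¹ f ≗ f
      pairing-pairing⁻¹ f = proj₂ (proj₂ N.perfect f) NB.≈ᴹ-refl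

    abstract
      adjoint : N.A ⟶ M.A → ContinuousLinear M N
      adjoint g = record
        { toLinear = linear M.B N.B (λ b → pairing⁻¹ ((M.pairing ⟨$⟩ b) ∘ₗ g))
            (λ {b} {b′} b≈b′ → proj₁ N.perfect (mk λ a → R.trans (pair b a)
              (R.trans (at (⟦⟧-cong M.pairing b≈b′) (g ⟨$⟩ a)) (R.sym (pair b′ a)))))
            (λ b b′ → proj₁ N.perfect (mk λ a → R.trans (pair _ a) (R.trans (at (+ᴹ-homo M.pairing b b′) (g ⟨$⟩ a))
              (R.trans (R.sym (R.+-cong (pair b a) (pair b′ a))) (R.sym (at (+ᴹ-homo N.pairing _ _) a))))))
            (λ r b → proj₁ N.perfect (mk λ a → R.trans (pair _ a) (R.trans (at (*ₗ-homo M.pairing r b) (g ⟨$⟩ a))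
              (R.trans (R.sym (R.*-congˡ (pair b a))) (R.sym (at (*ₗ-homo N.pairing r _) a))))))
        -- The value at `a` is controlled by the single pairing with `g ⟨$⟩ a`.
        ; continuous = λ a b → (g ⟨$⟩ a) ∷ [] , λ { b′ (same ∷ []) →
            R.trans (pair b′ a) (R.trans same (R.sym (pair b a))) }
        }
        where
        pair : ∀ b a → N.⟨ a , pairing⁻¹ ((M.pairing ⟨$⟩ b) ∘ₗ g) ⟩ R.≈ M.⟨ g ⟨$⟩ a , b ⟩
        pair b = at (pairing-pairing⁻¹ ((M.pairing ⟨$⟩ b) ∘ₗ g))

      adjoint-isAdjoint : ∀ g → IsAdjoint M N (adjoint g) g
      adjoint-isAdjoint g a b = R.sym (at (pairing-pairing⁻¹ ((M.pairing ⟨$⟩ b) ∘ₗ g)) a)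

    isAdjoint-resp-≈ᶜ : ∀ {f f′ g} → _≈ᶜ_ M N f f′ → IsAdjoint M N f g → IsAdjoint M N f′ g
    isAdjoint-resp-≈ᶜ f≈f′ adj a b = R.trans (adj a b) (at (⟦⟧-cong N.pairing (at f≈f′ b)) a)

    module _ (D : DualBasis M) where
      private
        module D = DualBasis D
        e = Func.to M.basis

      -- A density argument: by continuity the values of `f` and `g` at `b`, paired with `a`, depend
      -- on finitely many pairings of `b`, and some finite combination of the pseudobasis has the
      -- same pairings. All uniqueness claims rest on this.
      ≈ᶜ-on-pseudobasis : (p : Setoid.Carrier M.Index → MB.Carrierᴹ) → (∀ x → M.pairing ⟨$⟩ p x ≗ D.coef x) →
        ∀ {f g} → (∀ x → toLinear f ⟨$⟩ p x NB.≈ᴹ toLinear g ⟨$⟩ p x) → _≈ᶜ_ M N f g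
      ≈ᶜ-on-pseudobasis p p-coef {f} {g} same = mk λ b → proj₁ N.perfect (mk λ a → pointwise a b)
        where
        pointwise : ∀ a b → N.⟨ a , toLinear f ⟨$⟩ b ⟩ R.≈ N.⟨ a , toLinear g ⟨$⟩ b ⟩
        pointwise a b with continuous f a b | continuous g a b
        ... | as , f-cont | as′ , g-cont = begin
          N.⟨ a , toLinear f ⟨$⟩ b ⟩  ≈⟨ f-cont b′ (All.++⁻ˡ as near) ⟨
          N.⟨ a , toLinear f ⟨$⟩ b′ ⟩ ≈⟨ at (⟦⟧-cong N.pairing f≈g) a ⟩
          N.⟨ a , toLinear g ⟨$⟩ b′ ⟩ ≈⟨ g-cont b′ (All.++⁻ʳ as near) ⟩
          N.⟨ a , toLinear g ⟨$⟩ b ⟩  ∎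
          where
          open SetoidReasoning R.setoid
          L = support D (as ++ as′)
          -- This is `b` truncated to the coordinates that occur in the elements tested by `f` and
          -- by `g`.
          b′ = ∑ M.B L (λ x → M.⟨ e x , b ⟩ MB.*ₗ p x)

          f≈g : toLinear f ⟨$⟩ b′ NB.≈ᴹ toLinear g ⟨$⟩ b′
          f≈g = NB.≈ᴹ-trans (∑-homo (toLinear f) L _) (NB.≈ᴹ-trans
            (∑-cong N.B L λ x → NB.≈ᴹ-trans (*ₗ-homo (toLinear f) _ _)
              (NB.≈ᴹ-trans (NB.*ₗ-congˡ (same x)) (NB.≈ᴹ-sym (*ₗ-homo (toLinear g) _ _))))
            (NB.≈ᴹ-sym (∑-homo (toLinear g) L _)))

          agree : ∀ {a′} → LeftModule._≈ᴹ_ M.A (project D L ⟨$⟩ a′) a′ → M.⟨ a′ , b′ ⟩ R.≈ M.⟨ a′ , b ⟩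
          agree {a′} fixed = begin
            M.⟨ a′ , b′ ⟩
              ≈⟨ at (∑-homo M.pairing L _) a′ ⟩
            ∑ (Dual M.A) L (λ x → M.pairing ⟨$⟩ (M.⟨ e x , b ⟩ MB.*ₗ p x)) ⟨$⟩ a′
              ≈⟨ ∑-at M.A 𝟙 L _ a′ ⟩
            ∑ 𝟙 L (λ x → M.⟨ a′ , M.⟨ e x , b ⟩ MB.*ₗ p x ⟩)
              ≈⟨ ∑-cong 𝟙 L (λ x → R.trans (at (*ₗ-homo M.pairing _ _) a′)
                   (R.trans (R.*-congˡ (at (p-coef x) a′)) (R.trans (R.*-comm _ _)
                     (R.sym (*ₗ-homo (M.pairing ⟨$⟩ b) _ _))))) ⟩
            ∑ 𝟙 L (λ x → (M.pairing ⟨$⟩ b) ⟨$⟩ LeftModule._*ₗ_ M.A (D.coef x ⟨$⟩ a′) (e x))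
              ≈⟨ ∑-homo (M.pairing ⟨$⟩ b) L _ ⟨
            (M.pairing ⟨$⟩ b) ⟨$⟩ ∑ M.A L (λ x → LeftModule._*ₗ_ M.A (D.coef x ⟨$⟩ a′) (e x))
              ≈⟨ ⟦⟧-cong (M.pairing ⟨$⟩ b) (∑-at M.A M.A L _ a′) ⟨
            (M.pairing ⟨$⟩ b) ⟨$⟩ (project D L ⟨$⟩ a′)
              ≈⟨ ⟦⟧-cong (M.pairing ⟨$⟩ b) fixed ⟩
            M.⟨ a′ , b ⟩ ∎

          near : All (λ a′ → M.⟨ a′ , b′ ⟩ R.≈ M.⟨ a′ , b ⟩) (as ++ as′)
          near = All.map (λ {a′} → agree {a′}) (project-support D (as ++ as′))

-- Convolution rings and Neumann series

module Convolution (R : CommutativeRing 0ℓ 0ℓ) where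
  open LinearlyCompact R
  open LinearAlgebra R

  module _ {C A : Mod} {δ : C ⟶ C ⊗ C} {ε : C ⟶ 𝟙} {μ : A ⊗ A ⟶ A} {η : 𝟙 ⟶ A}
           (isCoalgebra : IsCoalgebra C δ ε) (isAlgebra : IsAlgebra A μ η) where
    private
      module A = LeftModule A
      module C = LeftModule C
      module E = LeftModule (Hom C A)
      module δ = IsCoalgebra isCoalgebra
      module μ = IsAlgebra isAlgebra
      open E using () renaming (_+ᴹ_ to _+_)

    infixl 7 _⋆_

    _⋆_ : C ⟶ A → C ⟶ A → C ⟶ A
    f ⋆ g = μ ∘ₗ f ⊗₁ g ∘ₗ δ

    private
      ⋆-cong : ∀ {f f′ g g′} → f ≗ f′ → g ≗ g′ → f ⋆ g ≗ f′ ⋆ g′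
      ⋆-cong {f} {f′} {g} {g′} f≗f′ g≗g′ = mk λ x → ⟦⟧-cong μ (at
        (≗-on-generators (A ⊗ A) {f = f ⊗₁ g} {g = f′ ⊗₁ g′} λ (x , y) →
          ≋-relation (⊗-cong (at f≗f′ x) (at g≗g′ y))) (δ ⟨$⟩ x))

      ⋆-distribˡ : ∀ f g h → f ⋆ (g + h) ≗ f ⋆ g + f ⋆ h
      ⋆-distribˡ f g h = mk λ x → A.≈ᴹ-trans (⟦⟧-cong μ (at
        (≗-on-generators (A ⊗ A) {f = f ⊗₁ (g + h)} {g = LeftModule._+ᴹ_ (Hom (C ⊗ C) (A ⊗ A)) (f ⊗₁ g) (f ⊗₁ h)}
          λ (x , y) → ≋-relation (⊗-+ʳ _ _ _)) (δ ⟨$⟩ x))) (+ᴹ-homo μ _ _)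

      ⋆-distribʳ : ∀ f g h → (g + h) ⋆ f ≗ g ⋆ f + h ⋆ f
      ⋆-distribʳ f g h = mk λ x → A.≈ᴹ-trans (⟦⟧-cong μ (at
        (≗-on-generators (A ⊗ A) {f = (g + h) ⊗₁ f} {g = LeftModule._+ᴹ_ (Hom (C ⊗ C) (A ⊗ A)) (g ⊗₁ f) (h ⊗₁ f)}
          λ (x , y) → ≋-relation (⊗-+ˡ _ _ _)) (δ ⟨$⟩ x))) (+ᴹ-homo μ _ _)

      -- Naturality of the associator separates the two sources of associativity: that of `μ` is
      -- used after `f`, `g`, `h` have acted, and coassociativity of `δ` before.
      ⋆-assoc : ∀ f g h → (f ⋆ g) ⋆ h ≗ f ⋆ (g ⋆ h)
      ⋆-assoc f g h = mk λ x → begin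
        (μ ∘ₗ (f ⋆ g) ⊗₁ h) ⟨$⟩ (δ ⟨$⟩ x)
          ≈⟨ at split-left (δ ⟨$⟩ x) ⟩
        ((μ ∘ₗ μ ⊗₁ idₗ) ∘ₗ (f ⊗₁ g) ⊗₁ h ∘ₗ δ ⊗₁ idₗ ∘ₗ δ) ⟨$⟩ x
          ≈⟨ at μ.assoc (((f ⊗₁ g) ⊗₁ h ∘ₗ δ ⊗₁ idₗ ∘ₗ δ) ⟨$⟩ x) ⟩
        ((μ ∘ₗ idₗ ⊗₁ μ) ∘ₗ ⊗-assoc A A A ∘ₗ (f ⊗₁ g) ⊗₁ h ∘ₗ δ ⊗₁ idₗ ∘ₗ δ) ⟨$⟩ x
          ≈⟨ ⟦⟧-cong (μ ∘ₗ idₗ ⊗₁ μ) (at assoc-natural ((δ ⊗₁ idₗ ∘ₗ δ) ⟨$⟩ x)) ⟩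
        ((μ ∘ₗ idₗ ⊗₁ μ) ∘ₗ f ⊗₁ (g ⊗₁ h) ∘ₗ ⊗-assoc C C C ∘ₗ δ ⊗₁ idₗ ∘ₗ δ) ⟨$⟩ x
          ≈⟨ ⟦⟧-cong (μ ∘ₗ idₗ ⊗₁ μ ∘ₗ f ⊗₁ (g ⊗₁ h)) (at δ.coassoc x) ⟩
        ((μ ∘ₗ idₗ ⊗₁ μ) ∘ₗ f ⊗₁ (g ⊗₁ h) ∘ₗ idₗ ⊗₁ δ ∘ₗ δ) ⟨$⟩ x
          ≈⟨ at split-right (δ ⟨$⟩ x) ⟨
        (μ ∘ₗ f ⊗₁ (g ⋆ h)) ⟨$⟩ (δ ⟨$⟩ x) ∎
        where
        open SetoidReasoning A.≈ᴹ-setoid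
        split-left : μ ∘ₗ (f ⋆ g) ⊗₁ h ≗ (μ ∘ₗ μ ⊗₁ idₗ) ∘ₗ (f ⊗₁ g) ⊗₁ h ∘ₗ δ ⊗₁ idₗ
        split-left = ≗-on-generators A λ _ → A.≈ᴹ-refl
        split-right : μ ∘ₗ f ⊗₁ (g ⋆ h) ≗ (μ ∘ₗ idₗ ⊗₁ μ) ∘ₗ f ⊗₁ (g ⊗₁ h) ∘ₗ idₗ ⊗₁ δ
        split-right = ≗-on-generators A λ _ → A.≈ᴹ-refl
        assoc-natural : ⊗-assoc A A A ∘ₗ (f ⊗₁ g) ⊗₁ h ≗ f ⊗₁ (g ⊗₁ h) ∘ₗ ⊗-assoc C C C
        assoc-natural = ⊗-extˡ λ _ _ _ → ≋-refl

      ⋆-identityˡ : ∀ f → (η ∘ₗ ε) ⋆ f ≗ f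
      ⋆-identityˡ f = mk λ x → begin
        (μ ∘ₗ (η ∘ₗ ε) ⊗₁ f) ⟨$⟩ (δ ⟨$⟩ x)
          ≈⟨ at split (δ ⟨$⟩ x) ⟩
        ((μ ∘ₗ η ⊗₁ idₗ) ∘ₗ idₗ ⊗₁ f ∘ₗ ε ⊗₁ idₗ ∘ₗ δ) ⟨$⟩ x
          ≈⟨ at μ.identityˡ ((idₗ ⊗₁ f ∘ₗ ε ⊗₁ idₗ ∘ₗ δ) ⟨$⟩ x) ⟩
        (unitˡ A ∘ₗ idₗ ⊗₁ f ∘ₗ ε ⊗₁ idₗ ∘ₗ δ) ⟨$⟩ x
          ≈⟨ at natural ((ε ⊗₁ idₗ ∘ₗ δ) ⟨$⟩ x) ⟩
        (f ∘ₗ unitˡ C ∘ₗ ε ⊗₁ idₗ ∘ₗ δ) ⟨$⟩ x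
          ≈⟨ ⟦⟧-cong f (at δ.coidentityˡ x) ⟩
        f ⟨$⟩ x ∎
        where
        open SetoidReasoning A.≈ᴹ-setoid
        split : μ ∘ₗ (η ∘ₗ ε) ⊗₁ f ≗ (μ ∘ₗ η ⊗₁ idₗ) ∘ₗ idₗ ⊗₁ f ∘ₗ ε ⊗₁ idₗ
        split = ≗-on-generators A λ _ → A.≈ᴹ-refl
        natural : unitˡ A ∘ₗ idₗ ⊗₁ f ≗ f ∘ₗ unitˡ C
        natural = ≗-on-generators A λ (r , x) → A.≈ᴹ-sym (*ₗ-homo f r x)

      ⋆-identityʳ : ∀ f → f ⋆ (η ∘ₗ ε) ≗ f
      ⋆-identityʳ f = mk λ x → begin
        (μ ∘ₗ f ⊗₁ (η ∘ₗ ε)) ⟨$⟩ (δ ⟨$⟩ x)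
          ≈⟨ at split (δ ⟨$⟩ x) ⟩
        ((μ ∘ₗ idₗ ⊗₁ η) ∘ₗ f ⊗₁ idₗ ∘ₗ idₗ ⊗₁ ε ∘ₗ δ) ⟨$⟩ x
          ≈⟨ at μ.identityʳ ((f ⊗₁ idₗ ∘ₗ idₗ ⊗₁ ε ∘ₗ δ) ⟨$⟩ x) ⟩
        (unitʳ A ∘ₗ f ⊗₁ idₗ ∘ₗ idₗ ⊗₁ ε ∘ₗ δ) ⟨$⟩ x
          ≈⟨ at natural ((idₗ ⊗₁ ε ∘ₗ δ) ⟨$⟩ x) ⟩
        (f ∘ₗ unitʳ C ∘ₗ idₗ ⊗₁ ε ∘ₗ δ) ⟨$⟩ x
          ≈⟨ ⟦⟧-cong f (at δ.coidentityʳ x) ⟩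
        f ⟨$⟩ x ∎
        where
        open SetoidReasoning A.≈ᴹ-setoid
        split : μ ∘ₗ f ⊗₁ (η ∘ₗ ε) ≗ (μ ∘ₗ idₗ ⊗₁ η) ∘ₗ f ⊗₁ idₗ ∘ₗ idₗ ⊗₁ ε
        split = ≗-on-generators A λ _ → A.≈ᴹ-refl
        natural : unitʳ A ∘ₗ f ⊗₁ idₗ ≗ f ∘ₗ unitʳ C
        natural = ≗-on-generators A λ (x , r) → A.≈ᴹ-sym (*ₗ-homo f r x)

    -- For C = A an antipode is a two-sided inverse of `idₗ` in this ring, so the search for it
    -- becomes ring algebra.
    convolutionRing : Ring 0ℓ 0ℓ
    convolutionRing = record
      { Carrier = C ⟶ A
      ; _*_     = _⋆_
      ; 1#      = η ∘ₗ ε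
      ; isRing  = record
        { +-isAbelianGroup = E.+ᴹ-isAbelianGroup
        ; *-cong     = ⋆-cong
        ; *-assoc    = ⋆-assoc
        ; *-identity = ⋆-identityˡ , ⋆-identityʳ
        ; distrib    = ⋆-distribˡ , ⋆-distribʳ
        }
      }

-- geometric n is the partial sum of length n of the Neumann series
-- ∑ (1 - x)ⁱ for the inverse of x.

module NeumannSeries (K : Ring 0ℓ 0ℓ) (x : Ring.Carrier K) where
  open Ring K renaming (refl to ≈-refl; sym to ≈-sym; trans to ≈-trans)
  open RingProperties K
  open SetoidReasoning setoid

  abstract
    geometric : ℕ → Carrier
    geometric zero    = 0#
    geometric (suc n) = 1# + (1# - x) * geometric n

  -- This is the power (1 - x)ⁿ, by the recursion `step-suc`; it measures how far the partial sum is
  -- from an inverse of `x`.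
  step : ℕ → Carrier
  step n = geometric (suc n) - geometric n

  geometric-suc : ∀ n → geometric (suc n) ≈ step n + geometric n
  geometric-suc n = ≈-sym (begin
    (geometric (suc n) - geometric n) + geometric n   ≈⟨ +-assoc _ _ _ ⟩
    geometric (suc n) + (- geometric n + geometric n) ≈⟨ +-congˡ (-‿inverseˡ _) ⟩
    geometric (suc n) + 0#                            ≈⟨ +-identityʳ _ ⟩
    geometric (suc n)                                 ∎)

  abstract
    step-suc : ∀ n → step (suc n) ≈ (1# - x) * step n
    step-suc n = begin
      (1# + y * geometric (suc n)) - (1# + y * geometric n) ≈⟨ cancel _ _ _ ⟩
      y * geometric (suc n) - y * geometric n               ≈⟨ +-congˡ (-‿distribʳ-* y (geometric n)) ⟩
      y * geometric (suc n) + y * - geometric n             ≈⟨ distribˡ y _ _ ⟨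
      y * step n                                            ∎
      where
      y : Carrier
      y = 1# - x
      cancel : ∀ a b c → (a + b) - (a + c) ≈ b - c
      cancel a b c = begin
        (a + b) - (a + c)     ≈⟨ +-cong (+-comm a b) (≈-sym (-‿+-comm a c)) ⟩
        (b + a) + (- a - c)   ≈⟨ +-assoc b a _ ⟩
        b + (a + (- a - c))   ≈⟨ +-congˡ (≈-sym (+-assoc a (- a) (- c))) ⟩
        b + ((a - a) - c)     ≈⟨ +-congˡ (+-congʳ (-‿inverseʳ a)) ⟩
        b + (0# - c)          ≈⟨ +-congˡ (+-identityˡ (- c)) ⟩
        b - c                 ∎

    -- The ring is not commutative, but a partial sum is a polynomial in `x`. Hence one series
    -- inverts `x` from both sides.
    complement-comm : ∀ n → (1# - x) * geometric n ≈ geometric n * (1# - x)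
    complement-comm zero    = ≈-trans (zeroʳ _) (≈-sym (zeroˡ _))
    complement-comm (suc n) = begin
      y * (1# + y * geometric n)     ≈⟨ distribˡ y _ _ ⟩
      y * 1# + y * (y * geometric n) ≈⟨ +-cong (≈-trans (*-identityʳ y) (≈-sym (*-identityˡ y)))
          (*-congˡ (complement-comm n)) ⟩
      1# * y + y * (geometric n * y) ≈⟨ +-congˡ (*-assoc y _ y) ⟨
      1# * y + (y * geometric n) * y ≈⟨ distribʳ y _ _ ⟨
      (1# + y * geometric n) * y     ∎
      where
      y : Carrier
      y = 1# - x

  x≈1-complement : x ≈ 1# - (1# - x)
  x≈1-complement = ≈-sym (begin
    1# - (1# - x)       ≈⟨ +-congˡ (≈-sym (-‿+-comm 1# (- x))) ⟩
    1# + (- 1# - - x)   ≈⟨ +-assoc _ _ _ ⟨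
    (1# - 1#) - - x     ≈⟨ +-congʳ (-‿inverseʳ 1#) ⟩
    0# - - x            ≈⟨ +-identityˡ _ ⟩
    - - x               ≈⟨ -‿involutive x ⟩
    x                   ∎)

  private
    -- It is applied to a = 1, b = (1 - x) g and c = g with g = `geometric n`: then a + b is the
    -- next partial sum and the bracket is `step n`.
    telescope : ∀ a b c → c - b ≈ a - ((a + b) - c)
    telescope a b c = ≈-sym (begin
      a - ((a + b) - c)       ≈⟨ +-congˡ (≈-sym (-‿+-comm (a + b) (- c))) ⟩
      a + (- (a + b) - - c)   ≈⟨ +-congˡ (+-cong (≈-sym (-‿+-comm a b)) (-‿involutive c)) ⟩
      a + ((- a - b) + c)     ≈⟨ +-congˡ (+-assoc _ _ _) ⟩
      a + (- a + (- b + c))   ≈⟨ +-assoc _ _ _ ⟨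
      (a - a) + (- b + c)     ≈⟨ +-congʳ (-‿inverseʳ a) ⟩
      0# + (- b + c)          ≈⟨ +-identityˡ _ ⟩
      - b + c                 ≈⟨ +-comm _ _ ⟩
      c - b                   ∎)

  abstract
    x*geometric : ∀ n → x * geometric n ≈ 1# - step n
    x*geometric n = begin
      x * geometric n                                  ≈⟨ *-congʳ x≈1-complement ⟩
      (1# - (1# - x)) * geometric n                    ≈⟨ distribʳ _ _ _ ⟩
      1# * geometric n + - (1# - x) * geometric n      ≈⟨ +-cong (*-identityˡ _) (≈-sym (-‿distribˡ-* _ _)) ⟩
      geometric n - (1# - x) * geometric n             ≈⟨ telescope 1# _ _ ⟩
      1# - step n                                      ∎

    geometric*x : ∀ n → geometric n * x ≈ 1# - step n
    geometric*x n = begin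
      geometric n * x                                  ≈⟨ *-congˡ x≈1-complement ⟩
      geometric n * (1# - (1# - x))                    ≈⟨ distribˡ _ _ _ ⟩
      geometric n * 1# + geometric n * - (1# - x)      ≈⟨ +-cong (*-identityʳ _) (≈-sym (-‿distribʳ-* _ _)) ⟩
      geometric n - geometric n * (1# - x)             ≈⟨ +-congˡ (-‿cong (complement-comm n)) ⟨
      geometric n - (1# - x) * geometric n             ≈⟨ telescope 1# _ _ ⟩
      1# - step n                                      ∎

-- Images of subsets

⟨_⟩⇒ : {A B : Set} → A ⇔ B → A → B
⟨ e ⟩⇒ = Equivalence.to e

⟨_⟩⇐ : {A B : Set} → A ⇔ B → B → A
⟨ e ⟩⇐ = Equivalence.from e

module _ {n : ℕ} {F : Fin n → Set} (F? : ∀ x → Dec (F x)) where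

  comprehension : Subset n
  comprehension = tabulate (does ∘ F?)

  ∈-comprehension : ∀ {x} → x ∈ comprehension ⇔ F x
  ∈-comprehension {x} = mk⇔
    (λ x∈ → to (F? x) (trans (sym (Vec.lookup∘tabulate (does ∘ F?) x)) (Vec.[]=⇒lookup x∈)))
    (λ f → Vec.lookup⇒[]= x _ (trans (Vec.lookup∘tabulate (does ∘ F?) x) (dec-true (F? x) f)))
    where
    to : ∀ {x} (d : Dec (F x)) → does d ≡ inside → F x
    to (yes f) _ = f

subset-ext : ∀ {n} {S U : Subset n} → (∀ x → x ∈ S ⇔ x ∈ U) → S ≡ U
subset-ext e = ⊆-antisym (λ {x} → ⟨ e x ⟩⇒) (λ {x} → ⟨ e x ⟩⇐)

module _ {m n : ℕ} (f : Fin m → Fin n) where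

  image : Subset m → Subset n
  image S = comprehension (λ y → any? λ x → (x ∈? S) ×-dec (f x Fin.≟ y))

  preimage : Subset n → Subset m
  preimage U = comprehension (λ x → f x ∈? U)

  ∈-image : ∀ {S y} → y ∈ image S ⇔ ∃ λ x → x ∈ S × f x ≡ y
  ∈-image {S} = ∈-comprehension (λ y → any? λ x → (x ∈? S) ×-dec (f x Fin.≟ y))

  ∈-preimage : ∀ {U x} → x ∈ preimage U ⇔ f x ∈ U
  ∈-preimage {U} = ∈-comprehension (λ x → f x ∈? U)

  image-∪ : ∀ S U → image (S ∪ U) ≡ image S ∪ image U
  image-∪ S U = subset-ext λ y → mk⇔
    (λ y∈ → let (x , x∈ , fx≡y) = ⟨ ∈-image ⟩⇒ y∈ in
      ⟨ ∪⇔⊎ ⟩⇐ ([ (λ x∈S → inj₁ (⟨ ∈-image ⟩⇐ (x , x∈S , fx≡y)))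
                , (λ x∈U → inj₂ (⟨ ∈-image ⟩⇐ (x , x∈U , fx≡y))) ]′ (⟨ ∪⇔⊎ ⟩⇒ x∈)))
    (λ y∈ → [ (λ y∈S → let (x , x∈ , e) = ⟨ ∈-image ⟩⇒ y∈S in ⟨ ∈-image ⟩⇐ (x , ⟨ ∪⇔⊎ ⟩⇐ (inj₁ x∈) , e))
            , (λ y∈U → let (x , x∈ , e) = ⟨ ∈-image ⟩⇒ y∈U in ⟨ ∈-image ⟩⇐ (x , ⟨ ∪⇔⊎ ⟩⇐ (inj₂ x∈) , e))
            ]′ (⟨ ∪⇔⊎ ⟩⇒ y∈))

  module _ (f-injective : Injective _≡_ _≡_ f) where

    ∈-image-injective : ∀ {S x} → f x ∈ image S ⇔ x ∈ S
    ∈-image-injective {S} = mk⇔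
      (λ fx∈ → let (x′ , x′∈ , e) = ⟨ ∈-image ⟩⇒ fx∈ in subst (_∈ S) (f-injective e) x′∈)
      (λ x∈ → ⟨ ∈-image ⟩⇐ (_ , x∈ , refl))

    preimage-image : ∀ S → preimage (image S) ≡ S
    preimage-image S = subset-ext λ x → mk⇔
      (⟨ ∈-image-injective ⟩⇒ ∘ ⟨ ∈-preimage ⟩⇒) (⟨ ∈-preimage ⟩⇐ ∘ ⟨ ∈-image-injective ⟩⇐)

    image-∩ : ∀ S U → image (S ∩ U) ≡ image S ∩ image U
    image-∩ S U = subset-ext λ y → mk⇔
      (λ y∈ → let (x , x∈ , e) = ⟨ ∈-image ⟩⇒ y∈ ; (x∈S , x∈U) = ⟨ ∩⇔× ⟩⇒ x∈ in
        ⟨ ∩⇔× ⟩⇐ (⟨ ∈-image ⟩⇐ (x , x∈S , e) , ⟨ ∈-image ⟩⇐ (x , x∈U , e)))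
      (λ y∈ → let (y∈S , y∈U) = ⟨ ∩⇔× ⟩⇒ y∈ ; (x , x∈S , e) = ⟨ ∈-image ⟩⇒ y∈S in
        ⟨ ∈-image ⟩⇐ (x , ⟨ ∩⇔× ⟩⇐ (x∈S , ⟨ ∈-image-injective ⟩⇒ (subst (_∈ image U) (sym e) y∈U)) , e))

  image-preimage : ∀ {U} → (∀ {y} → y ∈ U → ∃ λ x → f x ≡ y) → image (preimage U) ≡ U
  image-preimage {U} covered = subset-ext λ y → mk⇔
    (λ y∈ → let (x , x∈ , e) = ⟨ ∈-image ⟩⇒ y∈ in subst (_∈ U) e (⟨ ∈-preimage ⟩⇒ x∈))
    (λ y∈ → let (x , e) = covered y∈ in ⟨ ∈-image ⟩⇐ (x , ⟨ ∈-preimage ⟩⇐ (subst (_∈ U) (sym e) y∈) , e))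

embed-∈ : ∀ {n} (S : Subset n) i → embed S i ∈ S
embed-∈ (inside  ∷ S) zero    = here
embed-∈ (inside  ∷ S) (suc i) = there (embed-∈ S i)
embed-∈ (outside ∷ S) i       = there (embed-∈ S i)

embed-surjective : ∀ {n} (S : Subset n) {x} → x ∈ S → ∃ λ i → embed S i ≡ x
embed-surjective (inside  ∷ S) here       = zero , refl
embed-surjective (inside  ∷ S) (there x∈) = let (i , e) = embed-surjective S x∈ in suc i , cong suc e
embed-surjective (outside ∷ S) (there x∈) = let (i , e) = embed-surjective S x∈ in i , cong suc e

-- Embeddings of labeled posets

≅-size : ∀ {P Q} → P ≅ Q → LPoset.size P ≡ LPoset.size Q
≅-size i = ℕ.≤-antisym (Fin.injective⇒≤ (_≅_.injective i)) (Fin.injective⇒≤ (_≅_.injective (≅-sym i)))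

-- An embedding Q ↪ P sees the descents of Q only at its covers, as _≅_ does;
-- an embedding Q ↣ P reflects all label comparisons.

infix 4 _↪_ _↣_

record _↪_ (Q P : LPoset) : Set where
  private
    module Q = LPoset Q
    module P = LPoset P
  field
    fun      : Fin Q.size → Fin P.size
    order    : ∀ {s t} → (s Q.≤ t) ⇔ (fun s P.≤ fun t)
    descents : ∀ {s t} → s Q.⋖ t → (Q.γ s ℤ.> Q.γ t) ⇔ (P.γ (fun s) ℤ.> P.γ (fun t))

  injective : Injective _≡_ _≡_ fun
  injective {s} {t} e = Q.antisym
    (⟨ order ⟩⇐ (subst (fun s P.≤_) e P.≤-refl)) (⟨ order ⟩⇐ (subst (P._≤ fun s) e P.≤-refl))

  strict : ∀ {s t} → (s Q.< t) ⇔ (fun s P.< fun t)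
  strict = mk⇔ (λ (s≤t , s≢t) → ⟨ order ⟩⇒ s≤t , s≢t ∘ injective)
               (λ (s≤t , s≢t) → ⟨ order ⟩⇐ s≤t , s≢t ∘ cong fun)

record _↣_ (Q P : LPoset) : Set where
  private
    module Q = LPoset Q
    module P = LPoset P
  field
    fun    : Fin Q.size → Fin P.size
    order  : ∀ {s t} → (s Q.≤ t) ⇔ (fun s P.≤ fun t)
    labels : ∀ {s t} → (Q.γ s ℤ.> Q.γ t) ⇔ (P.γ (fun s) ℤ.> P.γ (fun t))

  toEmbedding : Q ↪ P
  toEmbedding = record { fun = fun ; order = order ; descents = λ _ → labels }

infixr 9 _∘↣_

-- The outer map has to be a `↣`: the inner one need not carry covers to covers, and on other pairs
-- an outer `↪` says nothing about labels.
_∘↣_ : ∀ {S Q P} → Q ↣ P → S ↪ Q → S ↪ P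
j ∘↣ i = record
  { fun      = j.fun ∘ i.fun
  ; order    = mk⇔ (⟨ j.order ⟩⇒ ∘ ⟨ i.order ⟩⇒) (⟨ i.order ⟩⇐ ∘ ⟨ j.order ⟩⇐)
  ; descents = λ c → mk⇔ (⟨ j.labels ⟩⇒ ∘ ⟨ i.descents c ⟩⇒) (⟨ i.descents c ⟩⇐ ∘ ⟨ j.labels ⟩⇐)
  }
  where
  module j = _↣_ j
  module i = _↪_ i

id↣ : ∀ {P} → P ↣ P
id↣ = record { fun = id ; order = mk⇔ id id ; labels = mk⇔ id id }

restrict-↣ : ∀ P S → restrict P S ↣ P
restrict-↣ P S = record { fun = embed S ; order = mk⇔ id id ; labels = mk⇔ id id }

≅⇒↪ : ∀ {P Q} → P ≅ Q → P ↪ Q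
≅⇒↪ i = record { fun = _≅_.φ i ; order = mk⇔ (_≅_.mono i) (_≅_.cancel i) ; descents = _≅_.descents i }

module _ {Q P} (i : Q ↪ P) where
  InRange : Fin (LPoset.size P) → Set
  InRange y = ∃ λ x → _↪_.fun i x ≡ y

-- The map is i followed by the inverse of j. It is an order bijection, hence preserves covers, and
-- both sides compare their descents with the labels of `P`. The isomorphisms constructed below come
-- from here.
same-range⇒≅ : ∀ {Q Q′ P} (i : Q ↪ P) (j : Q′ ↪ P) → (∀ {y} → InRange i y ⇔ InRange j y) → Q ≅ Q′
same-range⇒≅ {Q} {Q′} {P} i j same = record
  { φ                  = φ
  ; isOrderIsomorphism = record
    { isOrderMonomorphism = record
      { isOrderHomomorphism = record { cong = cong φ ; mono = ⟨ order ⟩⇒ }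
      ; injective           = λ {s} {t} e → i.injective (trans (sym (jφ s)) (trans (cong j.fun e) (jφ t)))
      ; cancel              = ⟨ order ⟩⇐
      }
    ; surjective = λ y → proj₁ (onto y) , λ { refl → proj₂ (onto y) }
    }
  ; descents = λ {s} {t} c →
      mk⇔ (λ d → ⟨ j.descents (φ-⋖ c) ⟩⇐ (subst₂ (λ a b → P.γ a ℤ.> P.γ b) (sym (jφ s)) (sym (jφ t))
          (⟨ i.descents c ⟩⇒ d)))
           (λ d → ⟨ i.descents c ⟩⇐ (subst₂ (λ a b → P.γ a ℤ.> P.γ b) (jφ s) (jφ t) (⟨ j.descents (φ-⋖ c) ⟩⇒ d)))
  }
  where
  module i = _↪_ i
  module j = _↪_ j
  module P = LPoset P
  module Q = LPoset Q
  module Q′ = LPoset Q′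

  φ : Fin Q.size → Fin Q′.size
  φ x = proj₁ (⟨ same ⟩⇒ (x , refl))

  jφ : ∀ x → j.fun (φ x) ≡ i.fun x
  jφ x = proj₂ (⟨ same ⟩⇒ (x , refl))

  order : ∀ {s t} → (s Q.≤ t) ⇔ (φ s Q′.≤ φ t)
  order {s} {t} = mk⇔
    (λ le → ⟨ j.order ⟩⇐ (subst₂ P._≤_ (sym (jφ s)) (sym (jφ t)) (⟨ i.order ⟩⇒ le)))
    (λ le → ⟨ i.order ⟩⇐ (subst₂ P._≤_ (jφ s) (jφ t) (⟨ j.order ⟩⇒ le)))

  onto : ∀ y → ∃ λ x → φ x ≡ y
  onto y = let (x , e) = ⟨ same ⟩⇐ (y , refl) in x , j.injective (trans (jφ x) e)

  φ-< : ∀ {s t} → (s Q.< t) ⇔ (φ s Q′.< φ t)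
  φ-< {s} {t} = mk⇔
    (λ lt → ⟨ j.strict ⟩⇐ (subst₂ P._<_ (sym (jφ s)) (sym (jφ t)) (⟨ i.strict ⟩⇒ lt)))
    (λ lt → ⟨ i.strict ⟩⇐ (subst₂ P._<_ (jφ s) (jφ t) (⟨ j.strict ⟩⇒ lt)))

  φ-⋖ : ∀ {s t} → s Q.⋖ t → φ s Q′.⋖ φ t
  φ-⋖ (s<t , nothing-between) = ⟨ φ-< ⟩⇒ s<t , λ (u , s<u , u<t) →
    let (x , e) = onto u in
    nothing-between (x , ⟨ φ-< ⟩⇐ (subst (_ Q′.<_) (sym e) s<u) , ⟨ φ-< ⟩⇐ (subst (Q′._< _) (sym e) u<t))

surjective⇒≅ : ∀ {Q P} (i : Q ↪ P) → (∀ y → InRange i y) → Q ≅ P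
surjective⇒≅ i onto = same-range⇒≅ i (_↣_.toEmbedding id↣) (mk⇔ (λ _ → _ , refl) (λ _ → onto _))

IsConvex : (P : LPoset) → Subset (LPoset.size P) → Set
IsConvex P S = ∀ {x y z} → x < y → y < z → x ∈ S → z ∈ S → y ∈ S
  where open LPoset P

module _ {Q P} (i : Q ↪ P) where
  private
    module i = _↪_ i
    module Q = LPoset Q
    module P = LPoset P

  -- By convexity an element strictly between two members of `S` lies in `S`, so a cover of the
  -- restriction is a cover of `Q`, which is where `i` controls the labels.
  restrict-convex-↪ : ∀ {S} → IsConvex Q S → restrict Q S ↪ P
  restrict-convex-↪ {S} convex = record
    { fun      = i.fun ∘ embed S
    ; order    = i.order
    ; descents = λ { ((s≤t , s≢t) , nothing-between) → i.descents
        ( (s≤t , s≢t ∘ embed-injective S)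
        , λ { (u , s<u , u<t) → between nothing-between
                (embed-surjective S (convex s<u u<t (embed-∈ S _) (embed-∈ S _))) s<u u<t }) }
    }
    where
    between : ∀ {s t u} → ¬ (∃ λ v → LPoset._<_ (restrict Q S) s v × LPoset._<_ (restrict Q S) v t) →
      (∃ λ v → embed S v ≡ u) → embed S s Q.< u → ¬ (u Q.< embed S t)
    between none (v , refl) (s≤u , s≢u) (u≤t , u≢t) =
      none (v , (s≤u , s≢u ∘ cong (embed S)) , (u≤t , u≢t ∘ cong (embed S)))

  -- The image is embedded in `P` by a `↣`, so it need not be convex there; convexity in the source
  -- suffices.
  restrict-image-≅ : ∀ {S} → IsConvex Q S → restrict Q S ≅ restrict P (image i.fun S)
  restrict-image-≅ {S} convex = same-range⇒≅ (restrict-convex-↪ convex)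
      (_↣_.toEmbedding (restrict-↣ P (image i.fun S))) (mk⇔
    (λ { (x , refl) → embed-surjective (image i.fun S) (⟨ ∈-image i.fun ⟩⇐ (_ , embed-∈ S x , refl)) })
    (λ { (y , refl) → let (x , x∈ , e) = ⟨ ∈-image i.fun ⟩⇒ (embed-∈ (image i.fun S) y)
                          (x′ , e′) = embed-surjective S x∈
                      in x′ , trans (cong i.fun e′) e }))

restrict-full-≅ : ∀ P → restrict P full ≅ P
restrict-full-≅ P = surjective⇒≅ (_↣_.toEmbedding (restrict-↣ P full)) (λ y → embed-surjective full ∈⊤)

module _ (P Q : LPoset) where
  private
    module P = LPoset P
    module Q = LPoset Q
    open DisjointUnion P Q

    shift-> : ∀ {a b} c → (a ℤ.> b) ⇔ (a ℤ.+ c ℤ.> b ℤ.+ c)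
    shift-> c = mk⇔ (ℤ.+-monoˡ-< c) (λ lt → ℤ.≰⇒> λ le → ℤ.<⇒≱ lt (ℤ.+-monoˡ-≤ c le))

  -- The union shifts all labels of a component by one constant, which preserves every comparison
  -- inside the component.
  inl : P ↣ P ⊔ Q
  inl = record
    { fun    = _↑ˡ Q.size
    ; order  = λ {s} {t} → subst₂ (λ a b → T (s P.≤ᵇ t) ⇔ T (⊎-order a b))
        (sym (Fin.splitAt-↑ˡ P.size s Q.size)) (sym (Fin.splitAt-↑ˡ P.size t Q.size)) (mk⇔ id id)
    ; labels = λ {s} {t} → subst₂ (λ a b → (P.γ s ℤ.> P.γ t) ⇔ (label a ℤ.> label b))
        (sym (Fin.splitAt-↑ˡ P.size s Q.size)) (sym (Fin.splitAt-↑ˡ P.size t Q.size)) (shift-> _)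
    }

  inr : Q ↣ P ⊔ Q
  inr = record
    { fun    = P.size ↑ʳ_
    ; order  = λ {s} {t} → subst₂ (λ a b → T (s Q.≤ᵇ t) ⇔ T (⊎-order a b))
        (sym (Fin.splitAt-↑ʳ P.size Q.size s)) (sym (Fin.splitAt-↑ʳ P.size Q.size t)) (mk⇔ id id)
    ; labels = λ {s} {t} → subst₂ (λ a b → (Q.γ s ℤ.> Q.γ t) ⇔ (label a ℤ.> label b))
        (sym (Fin.splitAt-↑ʳ P.size Q.size s)) (sym (Fin.splitAt-↑ʳ P.size Q.size t))
        (mk⇔ (⟨ shift-> _ ⟩⇒ ∘ ⟨ shift-> _ ⟩⇒) (⟨ shift-> _ ⟩⇐ ∘ ⟨ shift-> _ ⟩⇐))
    }

  data Side : Fin (P.size ℕ.+ Q.size) → Set where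
    left  : ∀ s → Side (s ↑ˡ Q.size)
    right : ∀ s → Side (P.size ↑ʳ s)

  side : ∀ s → Side s
  side s with splitAt P.size s in e
  ... | inj₁ a = subst Side (Fin.splitAt⁻¹-↑ˡ e) (left a)
  ... | inj₂ b = subst Side (Fin.splitAt⁻¹-↑ʳ e) (right b)

  inl-inr-incomparable : ∀ s t → ¬ (LPoset._≤_ (P ⊔ Q) (s ↑ˡ Q.size) (P.size ↑ʳ t)) × ¬
      (LPoset._≤_ (P ⊔ Q) (P.size ↑ʳ t) (s ↑ˡ Q.size))
  inl-inr-incomparable s t =
      (λ le → subst₂ (λ a b → T (⊎-order a b)) (Fin.splitAt-↑ˡ P.size s Q.size) (Fin.splitAt-↑ʳ P.size Q.size t) le)
    , (λ le → subst₂ (λ a b → T (⊎-order a b)) (Fin.splitAt-↑ʳ P.size Q.size t) (Fin.splitAt-↑ˡ P.size s Q.size) le)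

module _ {P Q S} (i : P ↪ S) (j : Q ↪ S) where
  private
    module P = LPoset P
    module Q = LPoset Q
    module S = LPoset S
    module P⊔Q = LPoset (P ⊔ Q)
    module i = _↪_ i
    module j = _↪_ j
    module l = _↪_ (_↣_.toEmbedding (inl P Q))
    module r = _↪_ (_↣_.toEmbedding (inr P Q))

    fun : Fin (P.size ℕ.+ Q.size) → Fin S.size
    fun s = [ i.fun , j.fun ]′ (splitAt P.size s)

    fun-inl : ∀ s → fun (s ↑ˡ Q.size) ≡ i.fun s
    fun-inl s = cong [ i.fun , j.fun ]′ (Fin.splitAt-↑ˡ P.size s Q.size)

    fun-inr : ∀ s → fun (P.size ↑ʳ s) ≡ j.fun s
    fun-inr s = cong [ i.fun , j.fun ]′ (Fin.splitAt-↑ʳ P.size Q.size s)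

    ⋖-reflect : ∀ {A B} (k : A ↪ B) {s t} → LPoset._⋖_ B (_↪_.fun k s) (_↪_.fun k t) → LPoset._⋖_ A s t
    ⋖-reflect k (lt , none) = ⟨ k.strict ⟩⇐ lt , λ (u , s<u , u<t) → none
        (k.fun u , ⟨ k.strict ⟩⇒ s<u , ⟨ k.strict ⟩⇒ u<t)
      where module k = _↪_ k

  copair-range : ∀ {y} → (∃ λ s → fun s ≡ y) ⇔ (InRange i y ⊎ InRange j y)
  copair-range = mk⇔ (λ (s , e) → to (side P Q s) e)
    [ (λ (s , e) → s ↑ˡ Q.size , trans (fun-inl s) e) , (λ (s , e) → P.size ↑ʳ s , trans (fun-inr s) e) ]′
    where
    to : ∀ {s y} → Side P Q s → fun s ≡ y → InRange i y ⊎ InRange j y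
    to (left s)  e = inj₁ (s , trans (sym (fun-inl s)) e)
    to (right s) e = inj₂ (s , trans (sym (fun-inr s)) e)

  module _ (incomparable : ∀ {x y} → InRange i x → InRange j y → ¬ (x S.≤ y) × ¬ (y S.≤ x)) where

    -- No cover of the union joins its components, so only descents inside a component have to be
    -- compared. The relative position of the two blocks of labels is invisible, and this is what
    -- lets the union be commutative on classes.
    copair : P ⊔ Q ↪ S
    copair = record
      { fun      = fun
      ; order    = λ {s} {t} → order (side P Q s) (side P Q t)
      ; descents = λ {s} {t} c → descents (side P Q s) (side P Q t) c
      }
      where
      order : ∀ {s t} → Side P Q s → Side P Q t → (s P⊔Q.≤ t) ⇔ (fun s S.≤ fun t)
      order (left s)  (left t)  = subst₂ (λ a b → _ ⇔ (a S.≤ b)) (sym (fun-inl s)) (sym (fun-inl t))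
        (mk⇔ (⟨ i.order ⟩⇒ ∘ ⟨ l.order ⟩⇐) (⟨ l.order ⟩⇒ ∘ ⟨ i.order ⟩⇐))
      order (right s) (right t) = subst₂ (λ a b → _ ⇔ (a S.≤ b)) (sym (fun-inr s)) (sym (fun-inr t))
        (mk⇔ (⟨ j.order ⟩⇒ ∘ ⟨ r.order ⟩⇐) (⟨ r.order ⟩⇒ ∘ ⟨ j.order ⟩⇐))
      order (left s)  (right t) = mk⇔
        (λ le → contradiction le (proj₁ (inl-inr-incomparable P Q s t)))
        (λ le → contradiction (subst₂ S._≤_ (fun-inl s) (fun-inr t) le) (proj₁ (incomparable (s , refl) (t , refl))))
      order (right s) (left t)  = mk⇔
        (λ le → contradiction le (proj₂ (inl-inr-incomparable P Q t s)))
        (λ le → contradiction (subst₂ S._≤_ (fun-inr s) (fun-inl t) le) (proj₂ (incomparable (t , refl) (s , refl))))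

      descents : ∀ {s t} → Side P Q s → Side P Q t → s P⊔Q.⋖ t →
        (P⊔Q.γ s ℤ.> P⊔Q.γ t) ⇔ (S.γ (fun s) ℤ.> S.γ (fun t))
      descents (left s)  (left t)  c = subst₂ (λ a b → _ ⇔ (S.γ a ℤ.> S.γ b)) (sym (fun-inl s)) (sym (fun-inl t))
        (mk⇔ (⟨ i.descents c′ ⟩⇒ ∘ ⟨ l.descents c′ ⟩⇐) (⟨ l.descents c′ ⟩⇒ ∘ ⟨ i.descents c′ ⟩⇐))
        where c′ = ⋖-reflect (_↣_.toEmbedding (inl P Q)) c
      descents (right s) (right t) c = subst₂ (λ a b → _ ⇔ (S.γ a ℤ.> S.γ b)) (sym (fun-inr s)) (sym (fun-inr t))
        (mk⇔ (⟨ j.descents c′ ⟩⇒ ∘ ⟨ r.descents c′ ⟩⇐) (⟨ r.descents c′ ⟩⇒ ∘ ⟨ j.descents c′ ⟩⇐))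
        where c′ = ⋖-reflect (_↣_.toEmbedding (inr P Q)) c
      descents (left s)  (right t) ((le , _) , _) = contradiction le (proj₁ (inl-inr-incomparable P Q s t))
      descents (right s) (left t)  ((le , _) , _) = contradiction le (proj₂ (inl-inr-incomparable P Q t s))

-- Disjoint unions up to isomorphism

⊔-comm-≅ : ∀ P Q → P ⊔ Q ≅ Q ⊔ P
⊔-comm-≅ P Q = surjective⇒≅ i (λ y → ⟨ copair-range (_↣_.toEmbedding (inr Q P)) (_↣_.toEmbedding (inl Q P)) ⟩⇐
    (onto (side Q P y)))
  where
  i = copair (_↣_.toEmbedding (inr Q P)) (_↣_.toEmbedding (inl Q P))
    λ { (x , refl) (y , refl) → let (a , b) = inl-inr-incomparable Q P y x in b , a }
  onto : ∀ {y} → Side Q P y → _ ⊎ _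
  onto (left s)  = inj₂ (s , refl)
  onto (right s) = inj₁ (s , refl)

⊔-cong-≅ : ∀ {P P′ Q Q′} → P ≅ P′ → Q ≅ Q′ → P ⊔ Q ≅ P′ ⊔ Q′
⊔-cong-≅ {P} {P′} {Q} {Q′} i j = surjective⇒≅ k (λ y → ⟨ copair-range (inl P′ Q′ ∘↣ ≅⇒↪ i) (inr P′ Q′ ∘↣ ≅⇒↪ j)
    ⟩⇐ (onto (side P′ Q′ y)))
  where
  k = copair (inl P′ Q′ ∘↣ ≅⇒↪ i) (inr P′ Q′ ∘↣ ≅⇒↪ j) λ { (x , refl) (y , refl) → inl-inr-incomparable P′ Q′ _ _ }
  onto : ∀ {y} → Side P′ Q′ y → _ ⊎ _
  onto (left s)  = inj₁ (ψ i s , cong (_↑ˡ LPoset.size Q′) (φψ i s))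
  onto (right s) = inj₂ (ψ j s , cong (LPoset.size P′ ↑ʳ_) (φψ j s))

⊔-assoc-≅ : ∀ P Q S → (P ⊔ Q) ⊔ S ≅ P ⊔ (Q ⊔ S)
⊔-assoc-≅ P Q S = surjective⇒≅ k (λ y → ⟨ copair-range LM N ⟩⇐ (onto (side P (Q ⊔ S) y)))
  where
  L = inl P (Q ⊔ S)
  M = inr P (Q ⊔ S) ∘↣ _↣_.toEmbedding (inl Q S)
  N = inr P (Q ⊔ S) ∘↣ _↣_.toEmbedding (inr Q S)
  LM = copair (_↣_.toEmbedding L) M λ { (x , refl) (y , refl) → inl-inr-incomparable P (Q ⊔ S) _ _ }
  apart : ∀ {x y} → InRange (_↣_.toEmbedding L) x ⊎ InRange M x → InRange N y →
    ¬ (LPoset._≤_ (P ⊔ (Q ⊔ S)) x y) × ¬ (LPoset._≤_ (P ⊔ (Q ⊔ S)) y x)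
  apart (inj₁ (_ , refl)) (_ , refl) = inl-inr-incomparable P (Q ⊔ S) _ _
  apart (inj₂ (x , refl)) (y , refl) =
    let (a , b) = inl-inr-incomparable Q S x y ; module r = _↣_ (inr P (Q ⊔ S)) in
    (λ le → a (⟨ r.order ⟩⇐ le)) , (λ le → b (⟨ r.order ⟩⇐ le))
  k = copair LM N (λ x∈ → apart (⟨ copair-range (_↣_.toEmbedding L) M ⟩⇒ x∈))
  onto-inr : ∀ {y} → Side Q S y → InRange LM (LPoset.size P ↑ʳ y) ⊎ InRange N (LPoset.size P ↑ʳ y)
  onto-inr (left s)  = inj₁ (⟨ copair-range (_↣_.toEmbedding L) M ⟩⇐ (inj₂ (s , refl)))
  onto-inr (right s) = inj₂ (s , refl)
  onto : ∀ {y} → Side P (Q ⊔ S) y → InRange LM y ⊎ InRange N y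
  onto (left s)  = inj₁ (⟨ copair-range (_↣_.toEmbedding L) M ⟩⇐ (inj₁ (s , refl)))
  onto (right s) = onto-inr (side Q S s)

∅↪ : ∀ {P} → ∅ ↪ P
∅↪ = record { fun = λ () ; order = λ { {()} } ; descents = λ { {()} } }

size≡0⇒∅≅ : ∀ P → LPoset.size P ≡ 0 → ∅ ≅ P
size≡0⇒∅≅ P@record { size = zero } refl = surjective⇒≅ (∅↪ {P}) λ ()

⊔-identityˡ-≅ : ∀ P → ∅ ⊔ P ≅ P
⊔-identityˡ-≅ P = surjective⇒≅
  (copair ∅↪ (_↣_.toEmbedding (id↣ {P})) λ { (() , _) })
  (λ y → ⟨ copair-range ∅↪ (_↣_.toEmbedding (id↣ {P})) ⟩⇐ (inj₂ (y , refl)))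

module _ {m n : ℕ} (S : Subset m) (U : Subset n) where

  ∈-++ˡ : ∀ {i} → (i ↑ˡ n) ∈ (S Vec.++ U) ⇔ i ∈ S
  ∈-++ˡ {i} = mk⇔
    (λ i∈ → Vec.lookup⇒[]= i S (trans (sym (Vec.lookup-++ˡ S U i)) (Vec.[]=⇒lookup i∈)))
    (λ i∈ → Vec.lookup⇒[]= _ (S Vec.++ U) (trans (Vec.lookup-++ˡ S U i) (Vec.[]=⇒lookup i∈)))

  ∈-++ʳ : ∀ {i} → (m ↑ʳ i) ∈ (S Vec.++ U) ⇔ i ∈ U
  ∈-++ʳ {i} = mk⇔
    (λ i∈ → Vec.lookup⇒[]= i U (trans (sym (Vec.lookup-++ʳ S U i)) (Vec.[]=⇒lookup i∈)))
    (λ i∈ → Vec.lookup⇒[]= _ (S Vec.++ U) (trans (Vec.lookup-++ʳ S U i) (Vec.[]=⇒lookup i∈)))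

∣++∩++∣ : ∀ {m n} (S U : Subset m) (S′ U′ : Subset n) →
  ∣ (S Vec.++ S′) ∩ (U Vec.++ U′) ∣ ≡ ∣ S ∩ U ∣ ℕ.+ ∣ S′ ∩ U′ ∣
∣++∩++∣ []            []            S′ U′ = refl
∣++∩++∣ (inside  ∷ S) (inside  ∷ U) S′ U′ = cong suc (∣++∩++∣ S U S′ U′)
∣++∩++∣ (inside  ∷ S) (outside ∷ U) S′ U′ = ∣++∩++∣ S U S′ U′
∣++∩++∣ (outside ∷ S) (_       ∷ U) S′ U′ = ∣++∩++∣ S U S′ U′

restrict-⊔-≅ : ∀ P Q S U → restrict P S ⊔ restrict Q U ≅ restrict (P ⊔ Q) (S Vec.++ U)
restrict-⊔-≅ P Q S U = same-range⇒≅ k (_↣_.toEmbedding (restrict-↣ (P ⊔ Q) (S Vec.++ U))) (mk⇔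
  (λ y∈ → embed-surjective (S Vec.++ U) (to (⟨ copair-range i j ⟩⇒ y∈)))
  (λ { (y , refl) → ⟨ copair-range i j ⟩⇐ (from (side P Q _) (embed-∈ (S Vec.++ U) y)) }))
  where
  i = inl P Q ∘↣ _↣_.toEmbedding (restrict-↣ P S)
  j = inr P Q ∘↣ _↣_.toEmbedding (restrict-↣ Q U)
  k = copair i j λ { (x , refl) (y , refl) → inl-inr-incomparable P Q _ _ }
  to : ∀ {y} → InRange i y ⊎ InRange j y → y ∈ (S Vec.++ U)
  to (inj₁ (x , refl)) = ⟨ ∈-++ˡ S U ⟩⇐ (embed-∈ S x)
  to (inj₂ (x , refl)) = ⟨ ∈-++ʳ S U ⟩⇐ (embed-∈ U x)
  from : ∀ {y} → Side P Q y → y ∈ (S Vec.++ U) → InRange i y ⊎ InRange j y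
  from (left s)  s∈ = let (x , e) = embed-surjective S (⟨ ∈-++ˡ S U ⟩⇒ s∈) in inj₁ (x , cong (_↑ˡ _) e)
  from (right s) s∈ = let (x , e) = embed-surjective U (⟨ ∈-++ʳ S U ⟩⇒ s∈) in inj₂ (x , cong (_ ↑ʳ_) e)

-- Splittings as ordered covers

module _ (P : LPoset) where
  open LPoset P

  IsOrdered : Subset size → Subset size → Set
  IsOrdered S U = ∀ x y → x < y → x ∈ U → ¬ (y ∈ S)

  isOrdered? : ∀ S U → Dec (IsOrdered S U)
  isOrdered? S U = all? λ x → all? λ y → (x <? y) →-dec (x ∈? U) →-dec ¬? (y ∈? S)

  -- A splitting of the subposet on `X`, expressed by subsets of `P` rather than of `restrict P X`,
  -- so that splittings of different parts live in one place.
  IsSplittingOf : Subset size → Subset size → Subset size → Set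
  IsSplittingOf X S U = S ∪ U ≡ X × IsOrdered S U

  -- If x < y with x in `U` and y in `S`, closure puts both into the overlap, against the antichain
  -- condition. Conversely an element of a cover that is missing from one set lies in the other,
  -- which gives the closure conditions.
  isSplitting⇔ : ∀ {S U} → IsSplitting P (S , U) ⇔ IsSplittingOf full S U
  isSplitting⇔ {S} {U} = mk⇔
    (λ (lower , upper , cover , antichain) → cover , λ x y x<y x∈U y∈S →
      antichain x y (⟨ ∩⇔× ⟩⇐ (lower x y x<y y∈S , x∈U)) (⟨ ∩⇔× ⟩⇐ (y∈S , upper x y x<y x∈U)) x<y)
    (λ (cover , ordered) →
        (λ x y x<y y∈S → [ id , (λ x∈U → contradiction y∈S (ordered x y x<y x∈U)) ]′ (covered cover x))
      , (λ x y x<y x∈U → [ (λ y∈S → contradiction y∈S (ordered x y x<y x∈U)) , id ]′ (covered cover y))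
      , cover
      , (λ x y x∈ y∈ x<y → ordered x y x<y (proj₂ (⟨ ∩⇔× ⟩⇒ x∈)) (proj₁ (⟨ ∩⇔× ⟩⇒ y∈))))
    where
    covered : S ∪ U ≡ full → ∀ x → x ∈ S ⊎ x ∈ U
    covered e x = ⟨ ∪⇔⊎ ⟩⇒ (subst (x ∈_) (sym e) ∈⊤)

  module _ {S U : Subset size} (split : IsSplitting P (S , U)) where
    private
      lower = proj₁ split
      upper = proj₁ (proj₂ split)
      antichain = proj₂ (proj₂ (proj₂ split))

    lower-convex : IsConvex P S
    lower-convex {x} {y} {z} x<y y<z x∈ z∈ = lower y z y<z z∈

    upper-convex : IsConvex P U
    upper-convex {x} {y} {z} x<y y<z x∈ z∈ = upper x y x<y x∈

    -- The upper element puts an intermediate one into `S`, the lower element puts it into `U`.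
    -- Convexity lets `restrict-image-≅` compare the exponents of the weight across an embedding.
    overlap-convex : IsConvex P (S ∩ U)
    overlap-convex x<y y<z x∈ z∈ = let (x∈S , x∈U) = ⟨ ∩⇔× ⟩⇒ x∈ ; (z∈S , z∈U) = ⟨ ∩⇔× ⟩⇒ z∈ in
      ⟨ ∩⇔× ⟩⇐ (lower _ _ y<z z∈S , upper _ _ x<y x∈U)

module _ {Q P} (i : Q ↪ P) {X} (range : ∀ {y} → y ∈ X ⇔ InRange i y) where
  private module i = _↪_ i

  image-full : image i.fun full ≡ X
  image-full = subset-ext λ y → mk⇔
    (λ y∈ → let (x , _ , e) = ⟨ ∈-image i.fun ⟩⇒ y∈ in ⟨ range ⟩⇐ (x , e))
    (λ y∈ → let (x , e) = ⟨ range ⟩⇒ y∈ in ⟨ ∈-image i.fun ⟩⇐ (x , ∈⊤ , e))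

  -- The order condition mentions only the strict order, which an embedding both preserves and
  -- reflects; lower and upper sets themselves need not have lower and upper images in `P`.
  image-splitting⇔ : ∀ {S U} → IsSplitting Q (S , U) ⇔ IsSplittingOf P X (image i.fun S) (image i.fun U)
  image-splitting⇔ {S} {U} = mk⇔
    (λ split → let (cover , ordered) = ⟨ isSplitting⇔ Q ⟩⇒ split in
        trans (sym (image-∪ i.fun S U)) (trans (cong (image i.fun) cover) image-full)
      , λ x y x<y x∈ y∈ → ordered′ ordered x<y (⟨ ∈-image i.fun ⟩⇒ x∈) (⟨ ∈-image i.fun ⟩⇒ y∈))
    (λ (cover , ordered) → ⟨ isSplitting⇔ Q ⟩⇐
      ( trans (sym (preimage-image i.fun i.injective (S ∪ U)))
          (trans (cong (preimage i.fun) (trans (image-∪ i.fun S U) (trans cover (sym image-full))))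
            (preimage-image i.fun i.injective full))
      , λ x y x<y x∈ y∈ → ordered _ _ (⟨ i.strict ⟩⇒ x<y) (⟨ ∈-image i.fun ⟩⇐ (x , x∈ , refl))
          (⟨ ∈-image i.fun ⟩⇐ (y , y∈ , refl))))
    where
    ordered′ : ∀ {x y} → IsOrdered Q S U → LPoset._<_ P x y → (∃ λ a → a ∈ U × i.fun a ≡ x) →
        (∃ λ b → b ∈ S × i.fun b ≡ y) → _
    ordered′ ordered x<y (a , a∈ , refl) (b , b∈ , refl) = ordered a b (⟨ i.strict ⟩⇐ x<y) a∈ b∈

-- No relation joins the two components, so the covering condition and the order condition both
-- decompose componentwise.
⊔-splitting⇔ : ∀ P Q {S U S′ U′} → IsSplitting (P ⊔ Q) (S Vec.++ S′ , U Vec.++ U′) ⇔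
    (IsSplitting P (S , U) × IsSplitting Q (S′ , U′))
⊔-splitting⇔ P Q {S} {U} {S′} {U′} = mk⇔
  (λ split → let (cover , ordered) = ⟨ isSplitting⇔ (P ⊔ Q) ⟩⇒ split in
      ⟨ isSplitting⇔ P ⟩⇐
        ( subset-ext (λ x → mk⇔ (λ _ → ∈⊤) λ _ → ⟨ ∪⇔⊎ ⟩⇐
            (Sum.map ⟨ ∈-++ˡ S S′ ⟩⇒ ⟨ ∈-++ˡ U U′ ⟩⇒ (covered cover (x ↑ˡ _))))
        , λ x y x<y x∈ y∈ → ordered _ _ (⟨ l.strict ⟩⇒ x<y) (⟨ ∈-++ˡ U U′ ⟩⇐ x∈) (⟨ ∈-++ˡ S S′ ⟩⇐ y∈))
    , ⟨ isSplitting⇔ Q ⟩⇐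
        ( subset-ext (λ x → mk⇔ (λ _ → ∈⊤) λ _ → ⟨ ∪⇔⊎ ⟩⇐
            (Sum.map ⟨ ∈-++ʳ S S′ ⟩⇒ ⟨ ∈-++ʳ U U′ ⟩⇒ (covered cover (_ ↑ʳ x))))
        , λ x y x<y x∈ y∈ → ordered _ _ (⟨ r.strict ⟩⇒ x<y) (⟨ ∈-++ʳ U U′ ⟩⇐ x∈) (⟨ ∈-++ʳ S S′ ⟩⇐ y∈)))
  (λ (split , split′) →
    let (cover , ordered) = ⟨ isSplitting⇔ P ⟩⇒ split ; (cover′ , ordered′) = ⟨ isSplitting⇔ Q ⟩⇒ split′ in
    ⟨ isSplitting⇔ (P ⊔ Q) ⟩⇐
      ( subset-ext (λ x → mk⇔ (λ _ → ∈⊤) λ _ → cover-side cover cover′ (side P Q x))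
      , λ x y → ordered-side ordered ordered′ (side P Q x) (side P Q y)))
  where
  module l = _↪_ (_↣_.toEmbedding (inl P Q))
  module r = _↪_ (_↣_.toEmbedding (inr P Q))

  covered : ∀ {n} {A B : Subset n} → A ∪ B ≡ full → ∀ x → x ∈ A ⊎ x ∈ B
  covered e x = ⟨ ∪⇔⊎ ⟩⇒ (subst (x ∈_) (sym e) ∈⊤)

  cover-side : S ∪ U ≡ full → S′ ∪ U′ ≡ full → ∀ {x} → Side P Q x → x ∈ (S Vec.++ S′) ∪ (U Vec.++ U′)
  cover-side c c′ (left x)  = ⟨ ∪⇔⊎ ⟩⇐ (Sum.map ⟨ ∈-++ˡ S S′ ⟩⇐ ⟨ ∈-++ˡ U U′ ⟩⇐ (covered c x))
  cover-side c c′ (right x) = ⟨ ∪⇔⊎ ⟩⇐ (Sum.map ⟨ ∈-++ʳ S S′ ⟩⇐ ⟨ ∈-++ʳ U U′ ⟩⇐ (covered c′ x))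

  ordered-side : IsOrdered P S U → IsOrdered Q S′ U′ → ∀ {x y} → Side P Q x → Side P Q y →
    LPoset._<_ (P ⊔ Q) x y → x ∈ (U Vec.++ U′) → ¬ (y ∈ (S Vec.++ S′))
  ordered-side o o′ (left x)  (left y)  x<y x∈ y∈ = o x y (⟨ l.strict ⟩⇐ x<y) (⟨ ∈-++ˡ U U′ ⟩⇒ x∈)
      (⟨ ∈-++ˡ S S′ ⟩⇒ y∈)
  ordered-side o o′ (right x) (right y) x<y x∈ y∈ = o′ x y (⟨ r.strict ⟩⇐ x<y) (⟨ ∈-++ʳ U U′ ⟩⇒ x∈)
      (⟨ ∈-++ʳ S S′ ⟩⇒ y∈)
  ordered-side o o′ (left x)  (right y) (x≤y , _) = contradiction x≤y (proj₁ (inl-inr-incomparable P Q x y))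
  ordered-side o o′ (right x) (left y)  (x≤y , _) = contradiction x≤y (proj₂ (inl-inr-incomparable P Q y x))

-- Finiteness of the set of classes of each size

vectors : ∀ {A : Set} → List A → ∀ n → List (Vec A n)
vectors L zero    = [] ∷ []
vectors L (suc n) = cartesianProductWith _∷_ L (vectors L n)

∈-vectors : ∀ {A : Set} {L : List A} → (∀ x → x List.∈ L) → ∀ {n} (v : Vec A n) → v List.∈ vectors L n
∈-vectors all []      = here refl
∈-vectors all (x ∷ v) = List.∈-cartesianProductWith⁺ _∷_ (all x) (∈-vectors all v)

module _ {n : ℕ} where

  Valid : (Fin n → Fin n → Bool) → (Fin n → ℤ) → Set
  Valid le γ =
    (∀ s → T (le s s)) × (∀ s t u → T (le s t) → T (le t u) → T (le s u)) ×
    (∀ s t → T (le s t) → T (le t s) → s ≡ t) × (∀ s t → γ s ≡ γ t → s ≡ t)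

  valid? : ∀ le γ → Dec (Valid le γ)
  valid? le γ =
    all? (λ s → T? (le s s)) ×-dec
    all? (λ s → all? λ t → all? λ u → T? (le s t) →-dec T? (le t u) →-dec T? (le s u)) ×-dec
    all? (λ s → all? λ t → T? (le s t) →-dec T? (le t s) →-dec (s Fin.≟ t)) ×-dec
    all? (λ s → all? λ t → (γ s ℤ.≟ γ t) →-dec (s Fin.≟ t))

  toLPoset : ∀ {le γ} → Valid le γ → LPoset
  toLPoset {le} {γ} (rfl , tr , anti , inj) = record
    { size           = n
    ; _≤ᵇ_           = le
    ; isPartialOrder = record
      { isPreorder = record
        { isEquivalence = isEquivalence
        ; reflexive     = λ { refl → rfl _ }
        ; trans         = tr _ _ _
        }
      ; antisym = anti _ _
      }
    ; γ           = γ
    ; γ-injective = inj _ _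
    }

  -- A code is an order matrix with a vector of ranks; codes that violate the axioms yield nothing.
  -- The bound `suc n` comes from a rank being the cardinality of a subset of `Fin n`.
  decode : Vec (Vec Bool n) n × Vec (Fin (suc n)) n → List LPoset
  decode (m , g) = fromDec (valid? (λ s t → lookup (lookup m s) t) (λ s → ℤ.+ toℕ (lookup g s)))
    where
    fromDec : ∀ {le γ} → Dec (Valid le γ) → List LPoset
    fromDec (yes v) = toLPoset v ∷ []
    fromDec (no _)  = []

lposets : ℕ → List LPoset
lposets n = concatMap decode
  (cartesianProduct (vectors (vectors (true ∷ false ∷ []) n) n) (vectors (allFin (suc n)) n))

-- Replacing labels by their ranks leaves finitely many labelings to list.

module _ (P : LPoset) where
  open LPoset P

  private
    below : Fin size → Subset size
    below s = comprehension (λ u → γ u ℤ.<? γ s)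

    ∈-below : ∀ {s u} → u ∈ below s ⇔ (γ u ℤ.< γ s)
    ∈-below {s} = ∈-comprehension (λ u → γ u ℤ.<? γ s)

    rank : Fin size → ℕ
    rank s = ∣ below s ∣

    rank-< : ∀ {s t} → γ s ℤ.< γ t → rank s ℕ.< rank t
    rank-< {s} {t} s<t = p⊂q⇒∣p∣<∣q∣
      ( (λ u∈ → ⟨ ∈-below ⟩⇐ (ℤ.<-trans (⟨ ∈-below ⟩⇒ u∈) s<t))
      -- The inclusion is strict because `s` lies below `t` but not below itself.
      , s , ⟨ ∈-below ⟩⇐ s<t , λ s∈ → ℤ.<-irrefl refl (⟨ ∈-below ⟩⇒ s∈) )

    rank-<⇔ : ∀ {s t} → (γ s ℤ.< γ t) ⇔ (rank s ℕ.< rank t)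
    rank-<⇔ {s} {t} = mk⇔ rank-< from
      where
      from : rank s ℕ.< rank t → γ s ℤ.< γ t
      from lt with ℤ.<-cmp (γ s) (γ t)
      ... | tri< a _ _ = a
      ... | tri≈ _ e _ = contradiction lt (ℕ.<-irrefl (cong rank (γ-injective e)))
      ... | tri> _ _ c = contradiction lt (ℕ.<-asym (rank-< c))

    rank-injective : ∀ {s t} → rank s ≡ rank t → s ≡ t
    rank-injective {s} {t} e with ℤ.<-cmp (γ s) (γ t)
    ... | tri< a _ _ = contradiction (rank-< a) (ℕ.<-irrefl e)
    ... | tri≈ _ e′ _ = γ-injective e′
    ... | tri> _ _ c = contradiction (rank-< c) (ℕ.<-irrefl (sym e))

    order-code : Vec (Vec Bool size) size
    order-code = tabulate λ s → tabulate (s ≤ᵇ_)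

    label-code : Vec (Fin (suc size)) size
    label-code = tabulate λ s → fromℕ< (ℕ.s≤s (∣p∣≤n (below s)))

    le : Fin size → Fin size → Bool
    le s t = lookup (lookup order-code s) t

    le≡ : ∀ s t → le s t ≡ (s ≤ᵇ t)
    le≡ s t = trans (cong (λ v → lookup v t) (Vec.lookup∘tabulate (λ s → tabulate (s ≤ᵇ_)) s))
        (Vec.lookup∘tabulate (s ≤ᵇ_) t)

    δ : Fin size → ℤ
    δ s = ℤ.+ toℕ (lookup label-code s)

    δ≡ : ∀ s → δ s ≡ ℤ.+ rank s
    δ≡ s = cong ℤ.+_ (trans (cong toℕ (Vec.lookup∘tabulate (λ s → fromℕ< (ℕ.s≤s (∣p∣≤n (below s)))) s))
        (Fin.toℕ-fromℕ< _))

    le⇔ : ∀ {s t} → (s ≤ t) ⇔ T (le s t)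
    le⇔ {s} {t} = subst (λ b → (s ≤ t) ⇔ T b) (sym (le≡ s t)) (mk⇔ id id)

    valid : Valid le δ
    valid =
        (λ s → ⟨ le⇔ ⟩⇒ ≤-refl)
      , (λ s t u a b → ⟨ le⇔ ⟩⇒ (IsPartialOrder.trans isPartialOrder (⟨ le⇔ ⟩⇐ a) (⟨ le⇔ ⟩⇐ b)))
      , (λ s t a b → antisym (⟨ le⇔ ⟩⇐ a) (⟨ le⇔ ⟩⇐ b))
      , (λ s t e → rank-injective (ℤ.+-injective (trans (sym (δ≡ s)) (trans e (δ≡ t)))))
      where open import Relation.Binary.Structures using (IsPartialOrder)

    standardise : ∀ v → P ≅ toLPoset {le = le} {γ = δ} v
    standardise v = surjective⇒≅
      (record
        { fun      = id
        ; order    = le⇔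
        ; descents = λ {s} {t} _ → subst₂ (λ a b → (γ s ℤ.> γ t) ⇔ (a ℤ.> b)) (sym (δ≡ s)) (sym (δ≡ t))
            (mk⇔ (λ lt → ℤ.+<+ (⟨ rank-<⇔ ⟩⇒ lt)) (λ { (ℤ.+<+ lt) → ⟨ rank-<⇔ ⟩⇐ lt }))
        })
      (λ y → y , refl)

    ∈-decode : Any (P ≅_) (decode (order-code , label-code))
    ∈-decode with valid? le δ
    ... | yes v = here (standardise v)
    ... | no ¬v = contradiction valid ¬v

  ∈-lposets : Any (P ≅_) (lposets size)
  ∈-lposets = Any.concatMap⁺ decode (Any.map (λ { refl → ∈-decode })
    (List.∈-cartesianProduct⁺
      (∈-vectors (∈-vectors λ { true → here refl ; false → there (here refl) }) order-code)
      (∈-vectors List.∈-allFin label-code)))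

-- Enumeration of subsets and counting

_≟ˢ_ : ∀ {n} (S U : Subset n) → Dec (S ≡ U)
_≟ˢ_ = Vec.≡-dec Bool._≟_

Subset-decSetoid : ℕ → DecSetoid 0ℓ 0ℓ
Subset-decSetoid n = decSetoid (_≟ˢ_ {n})

∈-subsets : ∀ {n} (S : Subset n) → S List.∈ subsets n
∈-subsets []            = here refl
∈-subsets (inside  ∷ S) = List.∈-++⁺ˡ (List.∈-map⁺ (inside ∷_) (∈-subsets S))
∈-subsets {suc n} (outside ∷ S) = List.∈-++⁺ʳ (map (inside ∷_) (subsets n)) (List.∈-map⁺ (outside ∷_) (∈-subsets S))

subsets-unique : ∀ n → AllPairs (λ S U → ¬ (S ≡ U)) (subsets n)
subsets-unique zero    = [] ∷ []
subsets-unique (suc n) = Uniqueₚ.++⁺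
  (Uniqueₚ.map⁺ Vec.∷-injectiveʳ (subsets-unique n)) (Uniqueₚ.map⁺ Vec.∷-injectiveʳ (subsets-unique n))
  λ (S∈ , S∈′) → disjoint (List.∈-map⁻ _ S∈) (List.∈-map⁻ _ S∈′)
  where
  disjoint : ∀ {S : Subset (suc n)} → (∃ λ U → U List.∈ subsets n × S ≡ inside ∷ U) →
    ¬ (∃ λ U → U List.∈ subsets n × S ≡ outside ∷ U)
  disjoint (_ , _ , refl) (_ , _ , ())

-- This bounds a poset by the sizes of its two parts, so that a product of two classes involves
-- finitely many classes.
cover-size : ∀ {n} (S U : Subset n) → S ∪ U ≡ full → n ℕ.≤ ∣ S ∣ ℕ.+ ∣ U ∣
cover-size []            []            e = ℕ.z≤n
cover-size (inside  ∷ S) (inside  ∷ U) e = ℕ.s≤s (ℕ.≤-trans (cover-size S U (Vec.∷-injectiveʳ e))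
    (ℕ.+-monoʳ-≤ ∣ S ∣ (ℕ.n≤1+n _)))
cover-size (inside  ∷ S) (outside ∷ U) e = ℕ.s≤s (cover-size S U (Vec.∷-injectiveʳ e))
cover-size (outside ∷ S) (inside  ∷ U) e = ℕ.≤-trans (ℕ.s≤s (cover-size S U (Vec.∷-injectiveʳ e)))
    (ℕ.≤-reflexive (sym (ℕ.+-suc _ _)))

-- Both sides count an element of j of the three sets j - 1 times.

overlap-assoc : ∀ {n} (A B C : Subset n) →
  ∣ (A ∪ B) ∩ C ∣ ℕ.+ ∣ A ∩ B ∣ ≡ ∣ A ∩ (B ∪ C) ∣ ℕ.+ ∣ B ∩ C ∣
overlap-assoc [] [] [] = refl
overlap-assoc (inside  ∷ A) (inside  ∷ B) (inside  ∷ C) = cong suc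
    (trans (ℕ.+-suc _ _) (trans (cong suc (overlap-assoc A B C)) (sym (ℕ.+-suc _ _))))
overlap-assoc (inside  ∷ A) (inside  ∷ B) (outside ∷ C) = trans (ℕ.+-suc _ _) (cong suc (overlap-assoc A B C))
overlap-assoc (inside  ∷ A) (outside ∷ B) (inside  ∷ C) = cong suc (overlap-assoc A B C)
overlap-assoc (inside  ∷ A) (outside ∷ B) (outside ∷ C) = overlap-assoc A B C
overlap-assoc (outside ∷ A) (inside  ∷ B) (inside  ∷ C) = trans (cong suc (overlap-assoc A B C)) (sym (ℕ.+-suc _ _))
overlap-assoc (outside ∷ A) (inside  ∷ B) (outside ∷ C) = overlap-assoc A B C
overlap-assoc (outside ∷ A) (outside ∷ B) (_       ∷ C) = overlap-assoc A B C

isSplittingOf? : ∀ P X S U → Dec (IsSplittingOf P X S U)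
isSplittingOf? P X S U = ((S ∪ U) ≟ˢ X) ×-dec isOrdered? P S U

-- `IsOrdered` distributes over unions in either argument, so both sides unfold to the ordered pairs
-- (A , B), (A , C) and (B , C).
splittingOf-assoc : ∀ P {X A B C} →
  (IsSplittingOf P X (A ∪ B) C × IsOrdered P A B) ⇔ (IsSplittingOf P X A (B ∪ C) × IsOrdered P B C)
splittingOf-assoc P {X} {A} {B} {C} = mk⇔
  (λ ((cover , o) , o′) →
      ( trans (sym (∪-assoc A B C)) cover
      , λ x y x<y x∈ y∈ → [ (λ x∈B → o′ x y x<y x∈B y∈) , (λ x∈C → o x y x<y x∈C (⟨ ∪⇔⊎ ⟩⇐ (inj₁ y∈))) ]′
          (⟨ ∪⇔⊎ ⟩⇒ x∈) )
    , λ x y x<y x∈ y∈ → o x y x<y x∈ (⟨ ∪⇔⊎ ⟩⇐ (inj₂ y∈)))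
  (λ ((cover , o) , o′) →
      ( trans (∪-assoc A B C) cover
      , λ x y x<y x∈ y∈ → [ o x y x<y (⟨ ∪⇔⊎ ⟩⇐ (inj₂ x∈)) , o′ x y x<y x∈ ]′ (⟨ ∪⇔⊎ ⟩⇒ y∈) )
    , λ x y x<y x∈ y∈ → o x y x<y (⟨ ∪⇔⊎ ⟩⇐ (inj₁ x∈)) y∈)

-- The coproduct of a class as a functional

module CutFunctionals (R : CommutativeRing 0ℓ 0ℓ) (q : CommutativeRing.Carrier R) where
  open LinearlyCompact R
  open LinearAlgebra R
  private module R = CommutativeRing R
  open R using () renaming (_*_ to _·_; _≈_ to _≈ᴿ_)
  open Exp R.semiring using (_^_; ^-homo-*; ^-congʳ)
  open SetoidReasoning R.setoid

  A : Mod
  A = Free (DecSetoid.setoid LPosets)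

  -- The definitions are abstract because the normal form of P ≅? Q is huge.

  abstract
    _≟_ : ∀ P Q → Dec (P ≅ Q)
    _≟_ = _≅?_

    [_] : LPoset → A ⟶ 𝟙
    [_] = pseudobasis LPosets

    []-gen : ∀ P Q → [ P ] ⟨$⟩ gen Q ≈ᴿ 𝟏 (Q ≟ P)
    []-gen P Q = R.refl

    pseudobasis-[] : ∀ P → pseudobasis LPosets P ≗ [ P ]
    pseudobasis-[] P = mk λ _ → R.refl

  ∑ᴿ : {I : Set} → List I → (I → R.Carrier) → R.Carrier
  ∑ᴿ = ∑ 𝟙

  ∑ᴿ-cong : {I : Set} (L : List I) {f g : I → R.Carrier} → (∀ i → f i ≈ᴿ g i) → ∑ᴿ L f ≈ᴿ ∑ᴿ L g
  ∑ᴿ-cong = ∑-cong 𝟙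

  *-∑ : ∀ r {I : Set} (L : List I) (f : I → R.Carrier) → r · ∑ᴿ L f ≈ᴿ ∑ᴿ L (λ i → r · f i)
  *-∑ r []      f = R.zeroʳ r
  *-∑ r (i ∷ L) f = R.trans (R.distribˡ r _ _) (R.+-congˡ (*-∑ r L f))

  ∑-* : ∀ {I : Set} (L : List I) (f : I → R.Carrier) r → ∑ᴿ L f · r ≈ᴿ ∑ᴿ L (λ i → f i · r)
  ∑-* []      f r = R.zeroˡ r
  ∑-* (i ∷ L) f r = R.trans (R.distribʳ r _ _) (R.+-congˡ (∑-* L f r))

  𝟏-absorb : {P Q : Set} (p? : Dec P) (q? : Dec Q) (x : R.Carrier) → (Q → P) → 𝟏 p? · (𝟏 q? · x) ≈ᴿ 𝟏 q? · x
  𝟏-absorb p? (yes q) x q→p = R.trans (R.*-congʳ (𝟏-yes p? (q→p q))) (R.*-identityˡ _)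
  𝟏-absorb p? (no _)  x q→p = R.trans (R.*-congˡ (R.zeroˡ x)) (R.trans (R.zeroʳ _) (R.sym (R.zeroˡ x)))

  ∑-kroneckerˢ : ∀ {n} U (f : Subset n → R.Carrier) → ∑ᴿ (subsets n) (λ S → 𝟏 (U ≟ˢ S) · f S) ≈ᴿ f U
  ∑-kroneckerˢ {n} U f = ∑-kronecker (Subset-decSetoid n) 𝟙 (subsets-unique n) (∈-subsets U) f (λ { refl → R.refl })

  ∑-subsets-++ : ∀ m n (f : Subset (m ℕ.+ n) → R.Carrier) →
    ∑ᴿ (subsets (m ℕ.+ n)) f ≈ᴿ ∑ᴿ (subsets m) (λ S → ∑ᴿ (subsets n) (λ U → f (S Vec.++ U)))
  ∑-subsets-++ zero    n f = R.sym (R.+-identityʳ _)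
  ∑-subsets-++ (suc m) n f = R.trans (split (subsets (m ℕ.+ n)) f)
    (R.trans (R.+-cong (∑-subsets-++ m n (f ∘ (inside ∷_))) (∑-subsets-++ m n (f ∘ (outside ∷_))))
      (R.sym (split (subsets m) (λ S → ∑ᴿ (subsets n) (λ U → f (S Vec.++ U))))))
    where
    split : ∀ {k} (L : List (Subset k)) (f : Subset (suc k) → R.Carrier) →
      ∑ᴿ (map (inside ∷_) L ++ map (outside ∷_) L) f ≈ᴿ ∑ᴿ L (f ∘ (inside ∷_)) R.+ ∑ᴿ L (f ∘ (outside ∷_))
    split L f = R.trans (∑-++ 𝟙 (map (inside ∷_) L) _ f)
      (R.reflexive (cong₂ R._+_ (∑-map 𝟙 (inside ∷_) L f) (∑-map 𝟙 (outside ∷_) L f)))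

  module _ {Q P} (i : Q ↪ P) where
    private
      module i = _↪_ i
      module Q = LPoset Q
      module P = LPoset P
      im = image i.fun
      pre = preimage i.fun

    -- A subset `U` is an image exactly when im (pre U) = U, and then it is the image of `pre U`
    -- alone. The reindexing inserts a Kronecker bracket for each image and exchanges the two sums.
    ∑-image : (f : Subset P.size → R.Carrier) →
      ∑ᴿ (subsets Q.size) (f ∘ im) ≈ᴿ ∑ᴿ (subsets P.size) (λ U → 𝟏 (im (pre U) ≟ˢ U) · f U)
    ∑-image f = begin
      ∑ᴿ (subsets Q.size) (f ∘ im)
        ≈⟨ ∑ᴿ-cong (subsets Q.size) (λ S → ∑-kroneckerˢ (im S) f) ⟨
      ∑ᴿ (subsets Q.size) (λ S → ∑ᴿ (subsets P.size) (λ U → 𝟏 (im S ≟ˢ U) · f U))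
        ≈⟨ ∑-swap 𝟙 (subsets Q.size) (subsets P.size) _ ⟩
      ∑ᴿ (subsets P.size) (λ U → ∑ᴿ (subsets Q.size) (λ S → 𝟏 (im S ≟ˢ U) · f U))
        ≈⟨ ∑ᴿ-cong (subsets P.size) (λ U → R.trans (∑ᴿ-cong (subsets Q.size) (swap U)) (∑-kroneckerˢ (pre U) _)) ⟩
      ∑ᴿ (subsets P.size) (λ U → 𝟏 (im (pre U) ≟ˢ U) · f U) ∎
      where
      swap : ∀ U S → 𝟏 (im S ≟ˢ U) · f U ≈ᴿ 𝟏 (pre U ≟ˢ S) · (𝟏 (im (pre U) ≟ˢ U) · f U)
      swap U S = R.trans (R.*-congʳ (R.trans
        (𝟏-⇔ (mk⇔ (λ { refl → preimage-image i.fun i.injective S , cong im (preimage-image i.fun i.injective S) })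
                  (λ { (refl , e) → e })) (im S ≟ˢ U) ((pre U ≟ˢ S) ×-dec (im (pre U) ≟ˢ U)))
        (𝟏-× (pre U ≟ˢ S) (im (pre U) ≟ˢ U)))) (R.*-assoc _ _ _)

  []-cong : ∀ {P Q} → P ≅ Q → [ P ] ≗ [ Q ]
  []-cong {P} {Q} i = ≗-on-generators 𝟙 λ S → R.trans ([]-gen P S) (R.trans
    (𝟏-⇔ (mk⇔ (λ j → ≅-trans j i) (λ j → ≅-trans j (≅-sym i))) (S ≟ P) (S ≟ Q)) (R.sym ([]-gen Q S)))

  -- The prescribed coproduct of the class of `P`, with q for β, read as a functional. It is the row
  -- at `P` of the matrix of the product of `A`.
  cut : LPoset → A ⊗ A ⟶ 𝟙
  cut P = ∑ (Dual (A ⊗ A)) (splittings P)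
    (λ (S , U) → LeftModule._*ₗ_ (Dual (A ⊗ A)) (q ^ ∣ S ∩ U ∣) ([ restrict P S ] ⊠ [ restrict P U ]))

  ∑-splittings : ∀ P (f : Subset (LPoset.size P) × Subset (LPoset.size P) → R.Carrier) → ∑ᴿ (splittings P) f ≈ᴿ
    ∑ᴿ (subsets (LPoset.size P)) λ S → ∑ᴿ (subsets (LPoset.size P)) λ U → 𝟏 (isSplitting? P (S , U)) · f (S , U)
  ∑-splittings P f = R.trans (∑-filter 𝟙 (isSplitting? P) (cartesianProduct sub sub) f)
      (∑-cartesianProduct 𝟙 sub sub _)
    where sub = subsets (LPoset.size P)

  module _ (s t : LeftModule.Carrierᴹ A) where

    piece : ∀ P → Subset (LPoset.size P) → Subset (LPoset.size P) → R.Carrier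
    piece P S U = q ^ ∣ S ∩ U ∣ · (([ restrict P S ] ⟨$⟩ s) · ([ restrict P U ] ⟨$⟩ t))

    cut-splittings : ∀ P → cut P ⟨$⟩ gen (s , t) ≈ᴿ ∑ᴿ (splittings P) (λ (S , U) → piece P S U)
    cut-splittings P = ∑-at (A ⊗ A) 𝟙 (splittings P) _ (gen (s , t))

    cut-at : ∀ P → cut P ⟨$⟩ gen (s , t) ≈ᴿ
      ∑ᴿ (subsets (LPoset.size P)) λ S → ∑ᴿ (subsets (LPoset.size P)) λ U → 𝟏 (isSplitting? P (S , U)) · piece P S U
    cut-at P = R.trans (cut-splittings P) (∑-splittings P _)

    -- Splittings of `Q` are replaced by their images, and the sum is then extended to all pairs of
    -- subsets of `P`: a pair that covers the range consists of images anyway. Both the invariance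
    -- of `cut` under isomorphism and the iteration of splittings inside one poset follow.
    cut-embedding : ∀ {Q P} (i : Q ↪ P) {X} → (∀ {y} → y ∈ X ⇔ InRange i y) → cut Q ⟨$⟩ gen (s , t) ≈ᴿ
      ∑ᴿ (subsets (LPoset.size P)) λ S → ∑ᴿ (subsets (LPoset.size P)) λ U → 𝟏 (isSplittingOf? P X S U) · piece P S U
    cut-embedding {Q} {P} i {X} range = begin
      cut Q ⟨$⟩ gen (s , t)
        ≈⟨ cut-at Q ⟩
      ∑ᴿ subQ (λ S → ∑ᴿ subQ λ U → 𝟏 (isSplitting? Q (S , U)) · piece Q S U)
        ≈⟨ ∑ᴿ-cong subQ (λ S → ∑ᴿ-cong subQ λ U → transport S U) ⟩
      ∑ᴿ subQ (λ S → ∑ᴿ subQ λ U → 𝟏 (isSplittingOf? P X (im S) (im U)) · piece P (im S) (im U))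
        ≈⟨ ∑ᴿ-cong subQ (λ S → ∑-image i (λ U → 𝟏 (isSplittingOf? P X (im S) U) · piece P (im S) U)) ⟩
      ∑ᴿ subQ (λ S → ∑ᴿ subP λ U → 𝟏 (im (pre U) ≟ˢ U) · (𝟏 (isSplittingOf? P X (im S) U) · piece P (im S) U))
        ≈⟨ ∑-image i (λ S → ∑ᴿ subP λ U → 𝟏 (im (pre U) ≟ˢ U) · (𝟏 (isSplittingOf? P X S U) · piece P S U)) ⟩
      ∑ᴿ subP (λ S → 𝟏 (im (pre S) ≟ˢ S) · ∑ᴿ subP λ U → 𝟏 (im (pre U) ≟ˢ U) ·
          (𝟏 (isSplittingOf? P X S U) · piece P S U))
        ≈⟨ ∑ᴿ-cong subP (λ S → R.trans (*-∑ _ subP _) (∑ᴿ-cong subP λ U → absorb S U)) ⟩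
      ∑ᴿ subP (λ S → ∑ᴿ subP λ U → 𝟏 (isSplittingOf? P X S U) · piece P S U) ∎
      where
      module i = _↪_ i
      subQ = subsets (LPoset.size Q)
      subP = subsets (LPoset.size P)
      im = image i.fun
      pre = preimage i.fun

      transport : ∀ S U → 𝟏 (isSplitting? Q (S , U)) · piece Q S U ≈ᴿ 𝟏 (isSplittingOf? P X (im S) (im U)) ·
          piece P (im S) (im U)
      transport S U = R.trans
        -- The pieces are compared under the bracket, since it is the splitting condition that makes
        -- them convex.
        (𝟏*-cong 𝟙 (isSplitting? Q (S , U)) λ split → R.*-cong
          (^-congʳ q (trans (≅-size (restrict-image-≅ i (overlap-convex Q split)))
              (cong ∣_∣ (image-∩ i.fun i.injective S U))))
          (R.*-cong (at ([]-cong (restrict-image-≅ i (lower-convex Q split))) s)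
                    (at ([]-cong (restrict-image-≅ i (upper-convex Q split))) t)))
        (R.*-congʳ (𝟏-⇔ (image-splitting⇔ i range) (isSplitting? Q (S , U)) (isSplittingOf? P X (im S) (im U))))

      covered : ∀ {S U} → S ∪ U ≡ X → (∀ {y} → y ∈ S → InRange i y) × (∀ {y} → y ∈ U → InRange i y)
      covered refl = (λ y∈ → ⟨ range ⟩⇒ (⟨ ∪⇔⊎ ⟩⇐ (inj₁ y∈))) , (λ y∈ → ⟨ range ⟩⇒ (⟨ ∪⇔⊎ ⟩⇐ (inj₂ y∈)))

      absorb : ∀ S U → 𝟏 (im (pre S) ≟ˢ S) · (𝟏 (im (pre U) ≟ˢ U) · (𝟏 (isSplittingOf? P X S U) · piece P S U))
        ≈ᴿ 𝟏 (isSplittingOf? P X S U) · piece P S U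
      absorb S U = R.trans
        (R.*-congˡ (𝟏-absorb (im (pre U) ≟ˢ U) (isSplittingOf? P X S U) _ λ (e , _) → image-preimage i.fun
            (proj₂ (covered e))))
        (𝟏-absorb (im (pre S) ≟ˢ S) (isSplittingOf? P X S U) _ λ (e , _) → image-preimage i.fun (proj₁ (covered e)))

  cut-cong : ∀ {P Q} → P ≅ Q → cut P ≗ cut Q
  cut-cong {P} {Q} i = ≗-on-generators 𝟙 λ (s , t) → R.trans
    (cut-embedding s t (≅⇒↪ i) (mk⇔ (λ _ → ψ i _ , φψ i _) (λ _ → ∈⊤)))
    (R.sym (cut-embedding s t (_↣_.toEmbedding (id↣ {Q})) (mk⇔ (λ _ → _ , refl) (λ _ → ∈⊤))))
    where open import Defs using (ψ; φψ)

  cut-restrict : ∀ P X s t → cut (restrict P X) ⟨$⟩ gen (s , t) ≈ᴿ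
    ∑ᴿ (subsets (LPoset.size P)) λ S → ∑ᴿ (subsets (LPoset.size P)) λ U → 𝟏 (isSplittingOf? P X S U) · piece s t P S U
  cut-restrict P X s t = cut-embedding s t (_↣_.toEmbedding (restrict-↣ P X))
    (mk⇔ (embed-surjective X) (λ { (y , refl) → embed-∈ X y }))

  cut-full : ∀ P s t → cut P ⟨$⟩ gen (s , t) ≈ᴿ
    ∑ᴿ (subsets (LPoset.size P)) λ S → ∑ᴿ (subsets (LPoset.size P)) λ U → 𝟏 (isSplittingOf? P full S U) · piece
        s t P S U
  cut-full P s t = cut-embedding s t (_↣_.toEmbedding (id↣ {P})) (mk⇔ (λ _ → _ , refl) (λ _ → ∈⊤))

-- The bialgebra on isomorphism classes

module Bialgebra (R : CommutativeRing 0ℓ 0ℓ) (q : CommutativeRing.Carrier R) where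
  open LinearlyCompact R
  open LinearAlgebra R
  open CutFunctionals R q
  private module R = CommutativeRing R
  open R using () renaming (_*_ to _·_; _≈_ to _≈ᴿ_)
  open Exp R.semiring using (_^_; ^-homo-*; ^-congʳ)
  open SetoidReasoning R.setoid
  open CommutativeMonoidSolver R.*-commutativeMonoid using (solve; _⊜_) renaming (_⊕_ to _⊕ₛ_)

  private
    M : LCModule
    M = LC LPosets

    module A = LeftModule A

  D : DualBasis M
  D = record { _≟_ = _≟_ ; coef = [_] ; coef-basis = λ P Q → []-gen Q P }

  𝟏-disjoint : {P Q : Set} (p? : Dec P) (q? : Dec Q) → (P → ¬ Q) → 𝟏 p? · 𝟏 q? ≈ᴿ R.0#
  𝟏-disjoint (yes p) q? p→¬q = R.trans (R.*-identityˡ _) (𝟏-no q? (p→¬q p))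
  𝟏-disjoint (no _)  q? p→¬q = R.zeroˡ _

  ∈-lposets-upTo : ∀ {n} P → LPoset.size P ℕ.≤ n → Any (P ≅_) (concatMap lposets (upTo (suc n)))
  ∈-lposets-upTo P le = Any.concatMap⁺ lposets (Any.map (λ { refl → ∈-lposets P }) (List.∈-upTo⁺ (ℕ.s≤s le)))

  -- A nonzero term needs a cover of `P` by copies of `S` and `T`, and `cover-size` excludes it.
  cut-size : ∀ P S T → LPoset.size S ℕ.+ LPoset.size T ℕ.< LPoset.size P → cut P ⟨$⟩ gen (gen S , gen T) ≈ᴿ R.0#
  cut-size P S T lt = R.trans (cut-at (gen S) (gen T) P) (∑-zero 𝟙 sub λ X → ∑-zero 𝟙 sub λ Y → R.trans
    (𝟏*-cong 𝟙 (isSplitting? P (X , Y)) λ split → R.trans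
        (R.*-congˡ (R.trans (R.*-cong ([]-gen _ S) ([]-gen _ T)) (vanish X Y split))) (R.zeroʳ _)) (R.zeroʳ _))
    where
    sub = subsets (LPoset.size P)
    vanish : ∀ X Y → IsSplitting P (X , Y) → 𝟏 (S ≟ restrict P X) · 𝟏 (T ≟ restrict P Y) ≈ᴿ R.0#
    vanish X Y split = 𝟏-disjoint (S ≟ restrict P X) (T ≟ restrict P Y) λ i j →
      contradiction lt (ℕ.≤⇒≯ (ℕ.≤-trans (cover-size X Y (proj₁ (proj₂ (proj₂ split))))
        (ℕ.≤-reflexive (sym (cong₂ ℕ._+_ (≅-size i) (≅-size j))))))

  abstract
    multiplication : ∃ λ (μ : A ⊗ A ⟶ A) → ∀ P → [ P ] ∘ₗ μ ≗ cut P
    multiplication = fromRows (D ⊗ᵈ D) D cut cut-cong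
      -- Parts may overlap, so every size up to the sum of the two sizes has to be listed.
      (λ (S , T) → concatMap lposets (upTo (suc (LPoset.size S ℕ.+ LPoset.size T))))
      (λ (S , T) P → [ (λ le → inj₁ (∈-lposets-upTo P le)) , (λ lt → inj₂ (cut-size P S T lt)) ]′
        (ℕ.≤-<-connex (LPoset.size P) (LPoset.size S ℕ.+ LPoset.size T)))

  ⊔-size : ∀ P S T → ¬ (LPoset.size S ℕ.+ LPoset.size T ≡ LPoset.size P) → [ S ⊔ T ] ⟨$⟩ gen P ≈ᴿ R.0#
  ⊔-size P S T ne = R.trans ([]-gen _ P) (𝟏-no (P ≟ (S ⊔ T)) λ i → ne (sym (≅-size i)))

  factors : LPoset → List (LPoset × LPoset)
  factors P = cartesianProduct L L
    where L = concatMap lposets (upTo (suc (LPoset.size P)))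

  factors-complete : ∀ P ((S , T) : LPoset × LPoset) →
    Any (λ (S′ , T′) → (S ≅ S′) × (T ≅ T′)) (factors P) ⊎ ([ S ⊔ T ] ⟨$⟩ gen P ≈ᴿ R.0#)
  factors-complete P (S , T) with LPoset.size S ℕ.+ LPoset.size T ℕ.≟ LPoset.size P
  ... | yes e = inj₁ (Any.cartesianProduct⁺
      (∈-lposets-upTo S (ℕ.≤-trans (ℕ.m≤m+n _ _) (ℕ.≤-reflexive e)))
      (∈-lposets-upTo T (ℕ.≤-trans (ℕ.m≤n+m _ _) (ℕ.≤-reflexive e))))
  ... | no ne = inj₂ (⊔-size P S T ne)

  -- Here and below, the eta-expansions mk (at e) have Agda compare the values
  -- of linear maps and not the maps, which contain their proofs of linearity.

  abstract
    comultiplication : ∃ λ (δ : A ⟶ A ⊗ A) → ∀ P Q → ([ P ] ⊠ [ Q ]) ∘ₗ δ ≗ [ P ⊔ Q ]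
    comultiplication =
      let (δ , coef-δ) = fromRows D (D ⊗ᵈ D) (λ (S , T) → [ S ⊔ T ])
            (λ (i , j) → []-cong (⊔-cong-≅ i j)) factors factors-complete
      in δ , λ P Q → mk (at (coef-δ (P , Q)))

  μ : A ⊗ A ⟶ A
  μ = proj₁ multiplication

  δ : A ⟶ A ⊗ A
  δ = proj₁ comultiplication

  η : 𝟙 ⟶ A
  η = rankOne idₗ (gen ∅)

  ε : A ⟶ 𝟙
  ε = [ ∅ ]

  coef-μ : ∀ P → [ P ] ∘ₗ μ ≗ cut P
  coef-μ P = mk (at (proj₂ multiplication P))

  coef-δ : ∀ P Q → ([ P ] ⊠ [ Q ]) ∘ₗ δ ≗ [ P ⊔ Q ]
  coef-δ P Q = mk (at (proj₂ comultiplication P Q))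

  module _ (P : LPoset) (s t u : A.Carrierᴹ) where
    private
      sub = subsets (LPoset.size P)
      Sub = Subset (LPoset.size P)
      a b c : Sub → R.Carrier
      a X = [ restrict P X ] ⟨$⟩ s
      b X = [ restrict P X ] ⟨$⟩ t
      c X = [ restrict P X ] ⟨$⟩ u
      p : Sub → Sub → R.Carrier
      p X Y = 𝟏 (isSplittingOf? P full X Y)
      o : Sub → Sub → R.Carrier
      o X Y = 𝟏 (isOrdered? P X Y)
      w : Sub → Sub → R.Carrier
      w X Y = q ^ ∣ X ∩ Y ∣
      e : Sub → Sub → R.Carrier
      e X Y = 𝟏 (X ≟ˢ Y)

    -- The outer product splits `P` into (V , Z) and the inner one splits `V` into (X , Y). The
    -- covering condition on `V` is a Kronecker bracket at X ∪ Y; moving the sum over `V` inwards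
    -- eliminates it and leaves a sum over triples.
    assocˡ : [ P ] ⟨$⟩ (μ ⟨$⟩ gen (μ ⟨$⟩ gen (s , t) , u)) ≈ᴿ
      ∑ᴿ sub λ X → ∑ᴿ sub λ Y → ∑ᴿ sub λ Z → (p (X ∪ Y) Z · o X Y) · ((w (X ∪ Y) Z · w X Y) · ((a X · b Y) · c Z))
    assocˡ = begin
      [ P ] ⟨$⟩ (μ ⟨$⟩ gen (μ ⟨$⟩ gen (s , t) , u))
        ≈⟨ R.trans (at (coef-μ P) _) (cut-full P _ u) ⟩
      (∑ᴿ sub λ V → ∑ᴿ sub λ Z → p V Z · (w V Z · (([ restrict P V ] ⟨$⟩ (μ ⟨$⟩ gen (s , t))) · c Z)))
        ≈⟨ (∑ᴿ-cong sub λ V → ∑ᴿ-cong sub λ Z → distribute V Z) ⟩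
      (∑ᴿ sub λ V → ∑ᴿ sub λ Z → ∑ᴿ sub λ X → ∑ᴿ sub λ Y → e (X ∪ Y) V · f V X Y Z)
        ≈⟨ ∑-swap 𝟙 sub sub _ ⟩
      (∑ᴿ sub λ Z → ∑ᴿ sub λ V → ∑ᴿ sub λ X → ∑ᴿ sub λ Y → e (X ∪ Y) V · f V X Y Z)
        ≈⟨ (∑ᴿ-cong sub λ Z → ∑-swap 𝟙 sub sub _) ⟩
      (∑ᴿ sub λ Z → ∑ᴿ sub λ X → ∑ᴿ sub λ V → ∑ᴿ sub λ Y → e (X ∪ Y) V · f V X Y Z)
        ≈⟨ (∑ᴿ-cong sub λ Z → ∑ᴿ-cong sub λ X → R.trans (∑-swap 𝟙 sub sub _)
            (∑ᴿ-cong sub λ Y → ∑-kroneckerˢ (X ∪ Y) _)) ⟩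
      (∑ᴿ sub λ Z → ∑ᴿ sub λ X → ∑ᴿ sub λ Y → f (X ∪ Y) X Y Z)
        ≈⟨ R.trans (∑-swap 𝟙 sub sub _) (∑ᴿ-cong sub λ X → ∑-swap 𝟙 sub sub _) ⟩
      (∑ᴿ sub λ X → ∑ᴿ sub λ Y → ∑ᴿ sub λ Z → f (X ∪ Y) X Y Z) ∎
      where
      f : Sub → Sub → Sub → Sub → R.Carrier
      f V X Y Z = (p V Z · o X Y) · ((w V Z · w X Y) · ((a X · b Y) · c Z))
      distribute : ∀ V Z → p V Z · (w V Z · (([ restrict P V ] ⟨$⟩ (μ ⟨$⟩ gen (s , t))) · c Z)) ≈ᴿ
        ∑ᴿ sub λ X → ∑ᴿ sub λ Y → e (X ∪ Y) V · f V X Y Z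
      distribute V Z = begin
        p V Z · (w V Z · (([ restrict P V ] ⟨$⟩ (μ ⟨$⟩ gen (s , t))) · c Z))
          ≈⟨ solve 4 (λ p w x c → p ⊕ₛ (w ⊕ₛ (x ⊕ₛ c)) ⊜ x ⊕ₛ (p ⊕ₛ (w ⊕ₛ c))) R.refl _ _ _ _ ⟩
        ([ restrict P V ] ⟨$⟩ (μ ⟨$⟩ gen (s , t))) · r
          ≈⟨ R.*-congʳ (R.trans (at (coef-μ (restrict P V)) _) (cut-restrict P V s t)) ⟩
        (∑ᴿ sub λ X → ∑ᴿ sub λ Y → 𝟏 (isSplittingOf? P V X Y) · (w X Y · (a X · b Y))) · r
          ≈⟨ R.trans (∑-* sub _ r) (∑ᴿ-cong sub λ X → ∑-* sub _ r) ⟩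
        (∑ᴿ sub λ X → ∑ᴿ sub λ Y → (𝟏 (isSplittingOf? P V X Y) · (w X Y · (a X · b Y))) · r)
          ≈⟨ (∑ᴿ-cong sub λ X → ∑ᴿ-cong sub λ Y → R.trans
              (R.*-congʳ (R.*-congʳ (𝟏-× ((X ∪ Y) ≟ˢ V) (isOrdered? P X Y))))
               (solve 8 (λ e o w a b p w′ c → ((e ⊕ₛ o) ⊕ₛ (w ⊕ₛ (a ⊕ₛ b))) ⊕ₛ (p ⊕ₛ (w′ ⊕ₛ c)) ⊜ e ⊕ₛ
                   ((p ⊕ₛ o) ⊕ₛ ((w′ ⊕ₛ w) ⊕ₛ ((a ⊕ₛ b) ⊕ₛ c))))
                 R.refl _ _ _ _ _ _ _ _)) ⟩
        (∑ᴿ sub λ X → ∑ᴿ sub λ Y → e (X ∪ Y) V · f V X Y Z) ∎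
        where r = p V Z · (w V Z · c Z)

    assocʳ : [ P ] ⟨$⟩ (μ ⟨$⟩ gen (s , μ ⟨$⟩ gen (t , u))) ≈ᴿ
      ∑ᴿ sub λ X → ∑ᴿ sub λ Y → ∑ᴿ sub λ Z → (p X (Y ∪ Z) · o Y Z) · ((w X (Y ∪ Z) · w Y Z) · ((a X · b Y) · c Z))
    assocʳ = begin
      [ P ] ⟨$⟩ (μ ⟨$⟩ gen (s , μ ⟨$⟩ gen (t , u)))
        ≈⟨ R.trans (at (coef-μ P) _) (cut-full P s _) ⟩
      (∑ᴿ sub λ X → ∑ᴿ sub λ V → p X V · (w X V · (a X · ([ restrict P V ] ⟨$⟩ (μ ⟨$⟩ gen (t , u))))))
        ≈⟨ (∑ᴿ-cong sub λ X → ∑ᴿ-cong sub λ V → distribute X V) ⟩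
      (∑ᴿ sub λ X → ∑ᴿ sub λ V → ∑ᴿ sub λ Y → ∑ᴿ sub λ Z → e (Y ∪ Z) V · f V X Y Z)
        ≈⟨ (∑ᴿ-cong sub λ X → R.trans (∑-swap 𝟙 sub sub _) (∑ᴿ-cong sub λ Y →
             R.trans (∑-swap 𝟙 sub sub _) (∑ᴿ-cong sub λ Z → ∑-kroneckerˢ (Y ∪ Z) _))) ⟩
      (∑ᴿ sub λ X → ∑ᴿ sub λ Y → ∑ᴿ sub λ Z → f (Y ∪ Z) X Y Z) ∎
      where
      f : Sub → Sub → Sub → Sub → R.Carrier
      f V X Y Z = (p X V · o Y Z) · ((w X V · w Y Z) · ((a X · b Y) · c Z))
      distribute : ∀ X V → p X V · (w X V · (a X · ([ restrict P V ] ⟨$⟩ (μ ⟨$⟩ gen (t , u))))) ≈ᴿ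
        ∑ᴿ sub λ Y → ∑ᴿ sub λ Z → e (Y ∪ Z) V · f V X Y Z
      distribute X V = begin
        p X V · (w X V · (a X · ([ restrict P V ] ⟨$⟩ (μ ⟨$⟩ gen (t , u)))))
          ≈⟨ solve 4 (λ p w a x → p ⊕ₛ (w ⊕ₛ (a ⊕ₛ x)) ⊜ x ⊕ₛ (p ⊕ₛ (w ⊕ₛ a))) R.refl _ _ _ _ ⟩
        ([ restrict P V ] ⟨$⟩ (μ ⟨$⟩ gen (t , u))) · r
          ≈⟨ R.*-congʳ (R.trans (at (coef-μ (restrict P V)) _) (cut-restrict P V t u)) ⟩
        (∑ᴿ sub λ Y → ∑ᴿ sub λ Z → 𝟏 (isSplittingOf? P V Y Z) · (w Y Z · (b Y · c Z))) · r
          ≈⟨ R.trans (∑-* sub _ r) (∑ᴿ-cong sub λ Y → ∑-* sub _ r) ⟩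
        (∑ᴿ sub λ Y → ∑ᴿ sub λ Z → (𝟏 (isSplittingOf? P V Y Z) · (w Y Z · (b Y · c Z))) · r)
          ≈⟨ (∑ᴿ-cong sub λ Y → ∑ᴿ-cong sub λ Z → R.trans
              (R.*-congʳ (R.*-congʳ (𝟏-× ((Y ∪ Z) ≟ˢ V) (isOrdered? P Y Z))))
               (solve 8 (λ e o w b c p w′ a → ((e ⊕ₛ o) ⊕ₛ (w ⊕ₛ (b ⊕ₛ c))) ⊕ₛ (p ⊕ₛ (w′ ⊕ₛ a)) ⊜ e ⊕ₛ
                   ((p ⊕ₛ o) ⊕ₛ ((w′ ⊕ₛ w) ⊕ₛ ((a ⊕ₛ b) ⊕ₛ c))))
                 R.refl _ _ _ _ _ _ _ _)) ⟩
        (∑ᴿ sub λ Y → ∑ᴿ sub λ Z → e (Y ∪ Z) V · f V X Y Z) ∎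
        where r = p X V · (w X V · a X)

    coef-assoc : [ P ] ⟨$⟩ (μ ⟨$⟩ gen (μ ⟨$⟩ gen (s , t) , u)) ≈ᴿ [ P ] ⟨$⟩ (μ ⟨$⟩ gen (s , μ ⟨$⟩ gen (t , u)))
    coef-assoc = R.trans assocˡ (R.trans
      (∑ᴿ-cong sub λ X → ∑ᴿ-cong sub λ Y → ∑ᴿ-cong sub λ Z → R.*-cong (conditions X Y Z) (R.*-congʳ (weights X Y Z)))
      (R.sym assocʳ))
      where
      conditions : ∀ X Y Z → p (X ∪ Y) Z · o X Y ≈ᴿ p X (Y ∪ Z) · o Y Z
      conditions X Y Z = R.trans (R.sym (𝟏-× (isSplittingOf? P full (X ∪ Y) Z) (isOrdered? P X Y))) (R.trans
        (𝟏-⇔ (splittingOf-assoc P) (isSplittingOf? P full (X ∪ Y) Z ×-dec isOrdered? P X Y)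
          (isSplittingOf? P full X (Y ∪ Z) ×-dec isOrdered? P Y Z))
        (𝟏-× (isSplittingOf? P full X (Y ∪ Z)) (isOrdered? P Y Z)))
      weights : ∀ X Y Z → w (X ∪ Y) Z · w X Y ≈ᴿ w X (Y ∪ Z) · w Y Z
      weights X Y Z = R.trans (R.sym (^-homo-* q ∣ (X ∪ Y) ∩ Z ∣ ∣ X ∩ Y ∣))
        (R.trans (^-congʳ q (overlap-assoc X Y Z)) (^-homo-* q ∣ X ∩ (Y ∪ Z) ∣ ∣ Y ∩ Z ∣))

  ∣S∣≡0⇒S≡⊥ : ∀ {n} (S : Subset n) → ∣ S ∣ ≡ 0 → S ≡ ⊥
  ∣S∣≡0⇒S≡⊥ []            e = refl
  ∣S∣≡0⇒S≡⊥ (outside ∷ S) e = cong (outside ∷_) (∣S∣≡0⇒S≡⊥ S e)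

  coef-gen∅ : ∀ P r → [ P ] ⟨$⟩ (r ⊙ gen ∅) ≈ᴿ r · 𝟏 (∅ ≟ P)
  coef-gen∅ P r = R.trans (*ₗ-homo [ P ] r (gen ∅)) (R.*-congˡ ([]-gen P ∅))

  restrict-∅ : ∀ P {S} → ∅ ≅ restrict P S ⇔ S ≡ ⊥
  restrict-∅ P {S} = mk⇔ (λ i → ∣S∣≡0⇒S≡⊥ S (sym (≅-size i)))
    (λ { refl → size≡0⇒∅≅ (restrict P S) (∣⊥∣≡0 (LPoset.size P)) })

  module _ (P : LPoset) (r : R.Carrier) (t : A.Carrierᴹ) where
    private
      sub = subsets (LPoset.size P)
      Sub = Subset (LPoset.size P)

    -- The class of `∅` pairs to zero with every nonempty part, so only the pair (`⊥` , `full`)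
    -- survives, and its overlap is empty.
    coef-identityˡ : [ P ] ⟨$⟩ (μ ⟨$⟩ gen (r ⊙ gen ∅ , t)) ≈ᴿ r · ([ P ] ⟨$⟩ t)
    coef-identityˡ = begin
      [ P ] ⟨$⟩ (μ ⟨$⟩ gen (r ⊙ gen ∅ , t))
        ≈⟨ R.trans (at (coef-μ P) _) (cut-full P (r ⊙ gen ∅) t) ⟩
      (∑ᴿ sub λ S → ∑ᴿ sub λ U → 𝟏 (isSplittingOf? P full S U) · piece (r ⊙ gen ∅) t P S U)
        ≈⟨ (∑ᴿ-cong sub λ S → ∑ᴿ-cong sub λ U → only S U (⊥ ≟ˢ S)) ⟩
      (∑ᴿ sub λ S → ∑ᴿ sub λ U → 𝟏 (⊥ ≟ˢ S) · (𝟏 (full ≟ˢ U) · (r · ([ P ] ⟨$⟩ t))))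
        ≈⟨ (∑ᴿ-cong sub λ S → R.trans (R.sym (*-∑ _ sub _))
            (R.*-congˡ (∑-kroneckerˢ full λ (_ : Sub) → r · ([ P ] ⟨$⟩ t)))) ⟩
      (∑ᴿ sub λ S → 𝟏 (⊥ ≟ˢ S) · (r · ([ P ] ⟨$⟩ t)))
        ≈⟨ ∑-kroneckerˢ ⊥ (λ (_ : Sub) → r · ([ P ] ⟨$⟩ t)) ⟩
      r · ([ P ] ⟨$⟩ t) ∎
      where
      only : ∀ S U (d : Dec (⊥ ≡ S)) → 𝟏 (isSplittingOf? P full S U) · piece (r ⊙ gen ∅) t P S U ≈ᴿ
        𝟏 d · (𝟏 (full ≟ˢ U) · (r · ([ P ] ⟨$⟩ t)))
      only S U (no ⊥≢S) = R.trans (R.*-congˡ (R.trans (R.*-congˡ (R.trans (R.*-congʳ (R.trans (coef-gen∅ _ r)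
        (R.trans (R.*-congˡ (𝟏-no (∅ ≟ restrict P S) λ i → ⊥≢S (sym (⟨ restrict-∅ P ⟩⇒ i)))) (R.zeroʳ r))))
        (R.zeroˡ _))) (R.zeroʳ _))) (R.trans (R.zeroʳ _) (R.sym (R.zeroˡ _)))
      only S U (yes refl) = R.trans (R.*-congʳ (𝟏-⇔
          (mk⇔ (λ (cover , _) → sym (trans (sym (∪-identityˡ U)) cover))
               (λ { refl → ∪-identityˡ full , λ _ _ _ _ y∈ → ∉⊥ y∈ }))
          (isSplittingOf? P full ⊥ U) (full ≟ˢ U)))
        (R.trans (𝟏*-cong 𝟙 (full ≟ˢ U) λ { refl → R.trans
            (R.*-cong (^-congʳ q (trans (cong ∣_∣ (∩-zeroˡ (full {LPoset.size P}))) (∣⊥∣≡0 (LPoset.size P))))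
              (R.*-cong (R.trans (coef-gen∅ _ r) (R.trans
                  (R.*-congˡ (𝟏-yes (∅ ≟ restrict P ⊥) (⟨ restrict-∅ P ⟩⇐ refl))) (R.*-identityʳ r)))
                        (at ([]-cong (restrict-full-≅ P)) t)))
            (R.*-identityˡ _) })
          (R.sym (R.*-identityˡ _)))

    coef-identityʳ : [ P ] ⟨$⟩ (μ ⟨$⟩ gen (t , r ⊙ gen ∅)) ≈ᴿ r · ([ P ] ⟨$⟩ t)
    coef-identityʳ = begin
      [ P ] ⟨$⟩ (μ ⟨$⟩ gen (t , r ⊙ gen ∅))
        ≈⟨ R.trans (at (coef-μ P) _) (cut-full P t (r ⊙ gen ∅)) ⟩
      (∑ᴿ sub λ S → ∑ᴿ sub λ U → 𝟏 (isSplittingOf? P full S U) · piece t (r ⊙ gen ∅) P S U)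
        ≈⟨ (∑ᴿ-cong sub λ S → ∑ᴿ-cong sub λ U → only S U (⊥ ≟ˢ U)) ⟩
      (∑ᴿ sub λ S → ∑ᴿ sub λ U → 𝟏 (⊥ ≟ˢ U) · (𝟏 (full ≟ˢ S) · (r · ([ P ] ⟨$⟩ t))))
        ≈⟨ (∑ᴿ-cong sub λ S → ∑-kroneckerˢ ⊥ λ (_ : Sub) → 𝟏 (full ≟ˢ S) · (r · ([ P ] ⟨$⟩ t))) ⟩
      (∑ᴿ sub λ S → 𝟏 (full ≟ˢ S) · (r · ([ P ] ⟨$⟩ t)))
        ≈⟨ ∑-kroneckerˢ full (λ (_ : Sub) → r · ([ P ] ⟨$⟩ t)) ⟩
      r · ([ P ] ⟨$⟩ t) ∎
      where
      only : ∀ S U (d : Dec (⊥ ≡ U)) → 𝟏 (isSplittingOf? P full S U) · piece t (r ⊙ gen ∅) P S U ≈ᴿ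
        𝟏 d · (𝟏 (full ≟ˢ S) · (r · ([ P ] ⟨$⟩ t)))
      only S U (no ⊥≢U) = R.trans (R.*-congˡ (R.trans (R.*-congˡ (R.trans (R.*-congˡ (R.trans (coef-gen∅ _ r)
        (R.trans (R.*-congˡ (𝟏-no (∅ ≟ restrict P U) λ i → ⊥≢U (sym (⟨ restrict-∅ P ⟩⇒ i)))) (R.zeroʳ r))))
        (R.zeroʳ _))) (R.zeroʳ _))) (R.trans (R.zeroʳ _) (R.sym (R.zeroˡ _)))
      only S U (yes refl) = R.trans (R.*-congʳ (𝟏-⇔
          (mk⇔ (λ (cover , _) → sym (trans (sym (∪-identityʳ S)) cover))
               (λ { refl → ∪-identityʳ full , λ _ _ _ x∈ _ → ∉⊥ x∈ }))
          (isSplittingOf? P full S ⊥) (full ≟ˢ S)))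
        (R.trans (𝟏*-cong 𝟙 (full ≟ˢ S) λ { refl → R.trans
            (R.*-cong (^-congʳ q (trans (cong ∣_∣ (∩-zeroʳ (full {LPoset.size P}))) (∣⊥∣≡0 (LPoset.size P))))
              (R.*-cong (at ([]-cong (restrict-full-≅ P)) t)
                (R.trans (coef-gen∅ _ r) (R.trans (R.*-congˡ
                    (𝟏-yes (∅ ≟ restrict P ⊥) (⟨ restrict-∅ P ⟩⇐ refl))) (R.*-identityʳ r)))))
            (R.trans (R.*-identityˡ _) (R.*-comm _ _)) })
          (R.sym (R.*-identityˡ _)))

  isAlgebra : IsAlgebra A μ η
  isAlgebra = record
    { assoc     = coef-separates-⟶ D λ P → ⊗-extˡ λ s t u → coef-assoc P s t u
    ; identityˡ = coef-separates-⟶ D λ P → ≗-on-generators 𝟙 λ (r , t) →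
        R.trans (coef-identityˡ P r t) (R.sym (*ₗ-homo [ P ] r t))
    ; identityʳ = coef-separates-⟶ D λ P → ≗-on-generators 𝟙 λ (t , r) →
        R.trans (coef-identityʳ P r t) (R.sym (*ₗ-homo [ P ] r t))
    }

  isCoalgebra : IsCoalgebra A δ ε
  isCoalgebra = record
    { coassoc     = coef-separates-⟶ (D ⊗ᵈ (D ⊗ᵈ D)) λ (P , Q , S) → mk λ x → coassoc P Q S x
    ; coidentityˡ = coef-separates-⟶ D λ P → mk λ x → begin
        [ P ] ⟨$⟩ ((unitˡ A ∘ₗ ε ⊗₁ idₗ) ⟨$⟩ (δ ⟨$⟩ x)) ≈⟨ at (counitˡ P) (δ ⟨$⟩ x) ⟩
        (ε ⊠ [ P ]) ⟨$⟩ (δ ⟨$⟩ x)                       ≈⟨ at (coef-δ ∅ P) x ⟩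
        [ ∅ ⊔ P ] ⟨$⟩ x                                 ≈⟨ at ([]-cong (⊔-identityˡ-≅ P)) x ⟩
        [ P ] ⟨$⟩ x                                     ∎
    ; coidentityʳ = coef-separates-⟶ D λ P → mk λ x → begin
        [ P ] ⟨$⟩ ((unitʳ A ∘ₗ idₗ ⊗₁ ε) ⟨$⟩ (δ ⟨$⟩ x)) ≈⟨ at (counitʳ P) (δ ⟨$⟩ x) ⟩
        ([ P ] ⊠ ε) ⟨$⟩ (δ ⟨$⟩ x)                       ≈⟨ at (coef-δ P ∅) x ⟩
        [ P ⊔ ∅ ] ⟨$⟩ x                                 ≈⟨ at ([]-cong (≅-trans (⊔-comm-≅ P ∅) (⊔-identityˡ-≅ P))) x ⟩
        [ P ] ⟨$⟩ x                                     ∎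
    }
    where
    counitˡ : ∀ P → [ P ] ∘ₗ (unitˡ A ∘ₗ ε ⊗₁ idₗ) ≗ ε ⊠ [ P ]
    counitˡ P = ≗-on-generators 𝟙 λ (x , y) → *ₗ-homo [ P ] (ε ⟨$⟩ x) y

    counitʳ : ∀ P → [ P ] ∘ₗ (unitʳ A ∘ₗ idₗ ⊗₁ ε) ≗ [ P ] ⊠ ε
    counitʳ P = ≗-on-generators 𝟙 λ (x , y) → R.trans (*ₗ-homo [ P ] (ε ⟨$⟩ y) x) (R.*-comm _ _)

    coassoc : ∀ P Q S x → ([ P ] ⊠ ([ Q ] ⊠ [ S ])) ⟨$⟩ ((⊗-assoc A A A ∘ₗ δ ⊗₁ idₗ) ⟨$⟩ (δ ⟨$⟩ x)) ≈ᴿ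
      ([ P ] ⊠ ([ Q ] ⊠ [ S ])) ⟨$⟩ ((idₗ ⊗₁ δ) ⟨$⟩ (δ ⟨$⟩ x))
    coassoc P Q S x = begin
      ([ P ] ⊠ ([ Q ] ⊠ [ S ])) ⟨$⟩ ((⊗-assoc A A A ∘ₗ δ ⊗₁ idₗ) ⟨$⟩ (δ ⟨$⟩ x))
        ≈⟨ at reassociate ((δ ⊗₁ idₗ) ⟨$⟩ (δ ⟨$⟩ x)) ⟩
      (([ P ] ⊠ [ Q ]) ⊠ [ S ]) ⟨$⟩ ((δ ⊗₁ idₗ) ⟨$⟩ (δ ⟨$⟩ x))
        ≈⟨ at left-δ (δ ⟨$⟩ x) ⟩
      ([ P ⊔ Q ] ⊠ [ S ]) ⟨$⟩ (δ ⟨$⟩ x)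
        ≈⟨ at (coef-δ (P ⊔ Q) S) x ⟩
      [ (P ⊔ Q) ⊔ S ] ⟨$⟩ x
        ≈⟨ at ([]-cong (⊔-assoc-≅ P Q S)) x ⟩
      [ P ⊔ (Q ⊔ S) ] ⟨$⟩ x
        ≈⟨ at (coef-δ P (Q ⊔ S)) x ⟨
      ([ P ] ⊠ [ Q ⊔ S ]) ⟨$⟩ (δ ⟨$⟩ x)
        ≈⟨ at right-δ (δ ⟨$⟩ x) ⟨
      ([ P ] ⊠ ([ Q ] ⊠ [ S ])) ⟨$⟩ ((idₗ ⊗₁ δ) ⟨$⟩ (δ ⟨$⟩ x)) ∎
      where
      reassociate : ([ P ] ⊠ ([ Q ] ⊠ [ S ])) ∘ₗ ⊗-assoc A A A ≗ ([ P ] ⊠ [ Q ]) ⊠ [ S ]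
      reassociate = ⊗-extˡ λ _ _ _ → R.sym (R.*-assoc _ _ _)
      left-δ : (([ P ] ⊠ [ Q ]) ⊠ [ S ]) ∘ₗ δ ⊗₁ idₗ ≗ [ P ⊔ Q ] ⊠ [ S ]
      left-δ = ≗-on-generators 𝟙 λ (x , y) → R.*-congʳ (at (coef-δ P Q) x)
      right-δ : ([ P ] ⊠ ([ Q ] ⊠ [ S ])) ∘ₗ idₗ ⊗₁ δ ≗ [ P ] ⊠ [ Q ⊔ S ]
      right-δ = ≗-on-generators 𝟙 λ (x , y) → R.*-congˡ (at (coef-δ Q S) y)

  δ-cocommutative : ⊗-swap A A ∘ₗ δ ≗ δ
  δ-cocommutative = coef-separates-⟶ (D ⊗ᵈ D) λ (P , Q) → mk λ x → begin
    ([ P ] ⊠ [ Q ]) ⟨$⟩ (⊗-swap A A ⟨$⟩ (δ ⟨$⟩ x)) ≈⟨ at (swapped P Q) (δ ⟨$⟩ x) ⟩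
    ([ Q ] ⊠ [ P ]) ⟨$⟩ (δ ⟨$⟩ x)                  ≈⟨ at (coef-δ Q P) x ⟩
    [ Q ⊔ P ] ⟨$⟩ x                                ≈⟨ at ([]-cong (⊔-comm-≅ Q P)) x ⟩
    [ P ⊔ Q ] ⟨$⟩ x                                ≈⟨ at (coef-δ P Q) x ⟨
    ([ P ] ⊠ [ Q ]) ⟨$⟩ (δ ⟨$⟩ x)                  ∎
    where
    swapped : ∀ P Q → ([ P ] ⊠ [ Q ]) ∘ₗ ⊗-swap A A ≗ [ Q ] ⊠ [ P ]
    swapped P Q = ≗-on-generators 𝟙 λ _ → R.*-comm _ _

  -- Every subset of the union is a unique concatenation. The sums over S′ and U are exchanged so
  -- that the two factors of the bracket can be collected separately.
  ∑-splittings-⊔ : ∀ P Q (f : Subset (LPoset.size (P ⊔ Q)) × Subset (LPoset.size (P ⊔ Q)) → R.Carrier) →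
    ∑ᴿ (splittings (P ⊔ Q)) f ≈ᴿ
    ∑ᴿ (splittings P) λ (S , U) → ∑ᴿ (splittings Q) λ (S′ , U′) → f (S Vec.++ S′ , U Vec.++ U′)
  ∑-splittings-⊔ P Q f = begin
    ∑ᴿ (splittings (P ⊔ Q)) f
      ≈⟨ R.trans (∑-splittings (P ⊔ Q) f) (∑-subsets-++ m n _) ⟩
    (∑ᴿ subP λ S → ∑ᴿ subQ λ S′ → ∑ᴿ (subsets (m ℕ.+ n)) λ W → 𝟏 (isSplitting? (P ⊔ Q) (S Vec.++ S′ , W)) · f
        (S Vec.++ S′ , W))
      ≈⟨ (∑ᴿ-cong subP λ S → ∑ᴿ-cong subQ λ S′ → ∑-subsets-++ m n _) ⟩
    (∑ᴿ subP λ S → ∑ᴿ subQ λ S′ → ∑ᴿ subP λ U → ∑ᴿ subQ λ U′ →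
      𝟏 (isSplitting? (P ⊔ Q) (S Vec.++ S′ , U Vec.++ U′)) · f (S Vec.++ S′ , U Vec.++ U′))
      ≈⟨ (∑ᴿ-cong subP λ S → R.trans (∑-swap 𝟙 subQ subP _) (∑ᴿ-cong subP λ U → R.trans
           (∑ᴿ-cong subQ λ S′ → ∑ᴿ-cong subQ λ U′ → factor S U S′ U′)
           (R.sym (R.trans (*-∑ _ subQ _) (∑ᴿ-cong subQ λ S′ → *-∑ _ subQ _))))) ⟩
    (∑ᴿ subP λ S → ∑ᴿ subP λ U → 𝟏 (isSplitting? P (S , U)) ·
      ∑ᴿ subQ λ S′ → ∑ᴿ subQ λ U′ → 𝟏 (isSplitting? Q (S′ , U′)) · f (S Vec.++ S′ , U Vec.++ U′))
      ≈⟨ R.trans (∑-splittings P _) (∑ᴿ-cong subP λ S → ∑ᴿ-cong subP λ U → R.*-congˡ (∑-splittings Q _)) ⟨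
    (∑ᴿ (splittings P) λ (S , U) → ∑ᴿ (splittings Q) λ (S′ , U′) → f (S Vec.++ S′ , U Vec.++ U′)) ∎
    where
    m = LPoset.size P
    n = LPoset.size Q
    subP = subsets m
    subQ = subsets n
    factor : ∀ S U S′ U′ → 𝟏 (isSplitting? (P ⊔ Q) (S Vec.++ S′ , U Vec.++ U′)) · f (S Vec.++ S′ , U Vec.++ U′) ≈ᴿ
      𝟏 (isSplitting? P (S , U)) · (𝟏 (isSplitting? Q (S′ , U′)) · f (S Vec.++ S′ , U Vec.++ U′))
    factor S U S′ U′ = R.trans (R.*-congʳ (R.trans
      (𝟏-⇔ (⊔-splitting⇔ P Q) (isSplitting? (P ⊔ Q) (S Vec.++ S′ , U Vec.++ U′))
          (isSplitting? P (S , U) ×-dec isSplitting? Q (S′ , U′)))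
      (𝟏-× (isSplitting? P (S , U)) (isSplitting? Q (S′ , U′))))) (R.*-assoc _ _ _)

  module _ (P Q : LPoset) where
    private
      A⁴ = (A ⊗ A) ⊗ (A ⊗ A)
      Pieces = Subset (LPoset.size P) × Subset (LPoset.size P)
      Pieces′ = Subset (LPoset.size Q) × Subset (LPoset.size Q)
      weight : Pieces → Pieces′ → R.Carrier
      weight (S , U) (S′ , U′) = q ^ ∣ S ∩ U ∣ · q ^ ∣ S′ ∩ U′ ∣
      lowers uppers : Pieces → Pieces′ → A ⊗ A ⟶ 𝟙
      lowers (S , U) (S′ , U′) = [ restrict P S ] ⊠ [ restrict Q S′ ]
      uppers (S , U) (S′ , U′) = [ restrict P U ] ⊠ [ restrict Q U′ ]
      cut² : A⁴ ⟶ 𝟙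
      cut² = ∑ (Dual A⁴) (splittings P) λ i → ∑ (Dual A⁴) (splittings Q) λ j →
        LeftModule._*ₗ_ (Dual A⁴) (weight i j) (lowers i j ⊠ uppers i j)

      cut²-at : ∀ x → cut² ⟨$⟩ x ≈ᴿ
        ∑ᴿ (splittings P) λ i → ∑ᴿ (splittings Q) λ j → weight i j · ((lowers i j ⊠ uppers i j) ⟨$⟩ x)
      cut²-at x = R.trans (∑-at A⁴ 𝟙 (splittings P) _ x) (∑ᴿ-cong (splittings P) λ i → ∑-at A⁴ 𝟙 (splittings Q) _ x)

    -- `⊗-interchange` computes only on pure tensors, whereas δ s and δ t are arbitrary elements.
    -- The identity is therefore stated for functionals, checked on pure tensors and then applied to
    -- δ s ⊗ δ t.
    cut-interchange : (cut P ⊠ cut Q) ∘ₗ ⊗-interchange A ≗ cut²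
    cut-interchange = ⊗-extˡʳ λ x y z w → R.trans
      (R.*-cong (cut-splittings x z P) (cut-splittings y w Q))
      (R.trans (R.trans (∑-* (splittings P) _ _) (∑ᴿ-cong (splittings P) λ i → R.trans (*-∑ _ (splittings Q) _)
        (∑ᴿ-cong (splittings Q) λ j → solve 6 (λ w x z w′ y v →
          (w ⊕ₛ (x ⊕ₛ z)) ⊕ₛ (w′ ⊕ₛ (y ⊕ₛ v)) ⊜ (w ⊕ₛ w′) ⊕ₛ ((x ⊕ₛ y) ⊕ₛ (z ⊕ₛ v))) R.refl _ _ _ _ _ _)))
        (R.sym (cut²-at (gen (gen (x , y) , gen (z , w))))))

    coef-δ-μ : ∀ s t → ([ P ] ⊠ [ Q ]) ⟨$⟩ (δ ⟨$⟩ (μ ⟨$⟩ gen (s , t))) ≈ᴿ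
      ([ P ] ⊠ [ Q ]) ⟨$⟩ ((μ ⊗₁ μ) ⟨$⟩ (⊗-interchange A ⟨$⟩ gen (δ ⟨$⟩ s , δ ⟨$⟩ t)))
    coef-δ-μ s t = begin
      ([ P ] ⊠ [ Q ]) ⟨$⟩ (δ ⟨$⟩ (μ ⟨$⟩ gen (s , t)))
        ≈⟨ at (coef-δ P Q) (μ ⟨$⟩ gen (s , t)) ⟩
      [ P ⊔ Q ] ⟨$⟩ (μ ⟨$⟩ gen (s , t))
        ≈⟨ at (coef-μ (P ⊔ Q)) (gen (s , t)) ⟩
      cut (P ⊔ Q) ⟨$⟩ gen (s , t)
        ≈⟨ R.trans (cut-splittings s t (P ⊔ Q)) (∑-splittings-⊔ P Q _) ⟩
      (∑ᴿ (splittings P) λ (S , U) → ∑ᴿ (splittings Q) λ (S′ , U′) → piece s t (P ⊔ Q) (S Vec.++ S′) (U Vec.++ U′))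
        ≈⟨ (∑ᴿ-cong (splittings P) λ i → ∑ᴿ-cong (splittings Q) λ j → piece-⊔ i j) ⟩
      (∑ᴿ (splittings P) λ i → ∑ᴿ (splittings Q) λ j → weight i j ·
          ((lowers i j ⟨$⟩ (δ ⟨$⟩ s)) · (uppers i j ⟨$⟩ (δ ⟨$⟩ t))))
        ≈⟨ cut²-at (gen (δ ⟨$⟩ s , δ ⟨$⟩ t)) ⟨
      cut² ⟨$⟩ gen (δ ⟨$⟩ s , δ ⟨$⟩ t)
        ≈⟨ at cut-interchange (gen (δ ⟨$⟩ s , δ ⟨$⟩ t)) ⟨
      (cut P ⊠ cut Q) ⟨$⟩ (⊗-interchange A ⟨$⟩ gen (δ ⟨$⟩ s , δ ⟨$⟩ t))
        ≈⟨ at coef-μ² (⊗-interchange A ⟨$⟩ gen (δ ⟨$⟩ s , δ ⟨$⟩ t)) ⟨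
      ([ P ] ⊠ [ Q ]) ⟨$⟩ ((μ ⊗₁ μ) ⟨$⟩ (⊗-interchange A ⟨$⟩ gen (δ ⟨$⟩ s , δ ⟨$⟩ t))) ∎
      where
      coef-μ² : ([ P ] ⊠ [ Q ]) ∘ₗ μ ⊗₁ μ ≗ cut P ⊠ cut Q
      coef-μ² = ≗-on-generators 𝟙 λ (x , y) → R.*-cong (at (coef-μ P) x) (at (coef-μ Q) y)

      piece-⊔ : ∀ ((S , U) : Pieces) ((S′ , U′) : Pieces′) → piece s t (P ⊔ Q) (S Vec.++ S′) (U Vec.++ U′) ≈ᴿ
        weight (S , U) (S′ , U′) · ((lowers (S , U) (S′ , U′) ⟨$⟩ (δ ⟨$⟩ s)) ·
            (uppers (S , U) (S′ , U′) ⟨$⟩ (δ ⟨$⟩ t)))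
      piece-⊔ (S , U) (S′ , U′) = R.*-cong
        (R.trans (^-congʳ q (∣++∩++∣ S U S′ U′)) (^-homo-* q ∣ S ∩ U ∣ ∣ S′ ∩ U′ ∣))
        (R.*-cong
          (R.trans (at ([]-cong (≅-sym (restrict-⊔-≅ P Q S S′))) s)
              (R.sym (at (coef-δ (restrict P S) (restrict Q S′)) s)))
          (R.trans (at ([]-cong (≅-sym (restrict-⊔-≅ P Q U U′))) t)
              (R.sym (at (coef-δ (restrict P U) (restrict Q U′)) t))))

  ∅≅⊔⇔ : ∀ P Q → ∅ ≅ P ⊔ Q ⇔ (∅ ≅ P × ∅ ≅ Q)
  ∅≅⊔⇔ P Q = mk⇔
    (λ i → size≡0⇒∅≅ P (ℕ.m+n≡0⇒m≡0 (LPoset.size P) (sym (≅-size i)))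
         , size≡0⇒∅≅ Q (ℕ.m+n≡0⇒n≡0 (LPoset.size P) (sym (≅-size i))))
    (λ (i , j) → ≅-trans (≅-sym (⊔-identityˡ-≅ ∅)) (⊔-cong-≅ i j))

  isBialgebra : IsBialgebra A μ η δ ε
  isBialgebra = record
    { isAlgebra   = isAlgebra
    ; isCoalgebra = isCoalgebra
    ; δ-μ = coef-separates-⟶ (D ⊗ᵈ D) λ (P , Q) → ≗-on-generators 𝟙 λ (s , t) → coef-δ-μ P Q s t
    ; ε-μ = ≗-on-generators 𝟙 λ (s , t) → R.trans (at (coef-μ ∅) (gen (s , t))) (R.trans (cut-full ∅ s t) (cut-∅ s t))
    ; δ-η = coef-separates-⟶ (D ⊗ᵈ D) λ (P , Q) → ≗-on-generators 𝟙 λ (r , r′) → coef-δ-η P Q r r′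
    ; ε-η = mk λ r → R.trans (coef-gen∅ ∅ r) (R.trans (R.*-congˡ (𝟏-yes (∅ ≟ ∅) ≅-refl)) (R.*-identityʳ r))
    }
    where
    cut-∅ : ∀ s t → (∑ᴿ (subsets 0) λ S → ∑ᴿ (subsets 0) λ U → 𝟏 (isSplittingOf? ∅ full S U) · piece s t ∅ S U) ≈ᴿ
      ([ ∅ ] ⟨$⟩ s) · ([ ∅ ] ⟨$⟩ t)
    cut-∅ s t = R.trans (R.+-identityʳ _) (R.trans (R.+-identityʳ _)
        (R.trans (R.*-congʳ (𝟏-yes (isSplittingOf? ∅ full [] []) (refl , λ ())))
      (R.trans (R.*-identityˡ _) (R.trans (R.*-identityˡ _)
        (R.*-cong (at ([]-cong (restrict-full-≅ ∅)) s) (at ([]-cong (restrict-full-≅ ∅)) t))))))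

    coef-δ-η : ∀ P Q r r′ → ([ P ] ⊠ [ Q ]) ⟨$⟩ (δ ⟨$⟩ ((r · r′) ⊙ gen ∅)) ≈ᴿ ([ P ] ⟨$⟩ (r ⊙ gen ∅)) ·
        ([ Q ] ⟨$⟩ (r′ ⊙ gen ∅))
    coef-δ-η P Q r r′ = begin
      ([ P ] ⊠ [ Q ]) ⟨$⟩ (δ ⟨$⟩ ((r · r′) ⊙ gen ∅))
        ≈⟨ R.trans (at (coef-δ P Q) _) (coef-gen∅ (P ⊔ Q) (r · r′)) ⟩
      (r · r′) · 𝟏 (∅ ≟ (P ⊔ Q))
        ≈⟨ R.*-congˡ (R.trans (𝟏-⇔ (∅≅⊔⇔ P Q) (∅ ≟ (P ⊔ Q)) ((∅ ≟ P) ×-dec (∅ ≟ Q))) (𝟏-× (∅ ≟ P) (∅ ≟ Q))) ⟩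
      (r · r′) · (𝟏 (∅ ≟ P) · 𝟏 (∅ ≟ Q))
        ≈⟨ solve 4 (λ r r′ x y → (r ⊕ₛ r′) ⊕ₛ (x ⊕ₛ y) ⊜ (r ⊕ₛ x) ⊕ₛ (r′ ⊕ₛ y)) R.refl _ _ _ _ ⟩
      (r · 𝟏 (∅ ≟ P)) · (r′ · 𝟏 (∅ ≟ Q))
        ≈⟨ R.*-cong (coef-gen∅ P r) (coef-gen∅ Q r′) ⟨
      ([ P ] ⟨$⟩ (r ⊙ gen ∅)) · ([ Q ] ⟨$⟩ (r′ ⊙ gen ∅)) ∎

-- The antipode

module Antipode (R : CommutativeRing 0ℓ 0ℓ) (q : CommutativeRing.Carrier R) where
  open LinearlyCompact R
  open LinearAlgebra R
  open Convolution R
  open CutFunctionals R q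
  open Bialgebra R q
  private module R = CommutativeRing R
  open R using () renaming (_≈_ to _≈ᴿ_)

  private
    module A = LeftModule A
    K = convolutionRing isCoalgebra isAlgebra
    module K = Ring K
  open NeumannSeries K idₗ

  -- The grading of `δ`: a pair whose sizes do not add up to that of `P` has coefficient zero in δ
  -- P, so `h` may do anything there.
  δ-vanishes : ∀ {N} (h : A ⊗ A ⟶ N) P →
    (∀ Q S → LPoset.size Q ℕ.+ LPoset.size S ≡ LPoset.size P → LeftModule._≈ᴹ_ N (h ⟨$⟩ gen (gen Q , gen S))
        (LeftModule.0ᴹ N)) →
    LeftModule._≈ᴹ_ N (h ⟨$⟩ (δ ⟨$⟩ gen P)) (LeftModule.0ᴹ N)
  δ-vanishes {N} h P vanish = ⟶-vanishes (D ⊗ᵈ D) {N} h (δ ⟨$⟩ gen P) λ (Q , S) →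
    cases Q S (LPoset.size Q ℕ.+ LPoset.size S ℕ.≟ LPoset.size P)
    where
    cases : ∀ Q S → Dec (LPoset.size Q ℕ.+ LPoset.size S ≡ LPoset.size P) →
      (([ Q ] ⊠ [ S ]) ⟨$⟩ (δ ⟨$⟩ gen P) ≈ᴿ R.0#) ⊎ LeftModule._≈ᴹ_ N (h ⟨$⟩ gen (gen Q , gen S)) (LeftModule.0ᴹ N)
    cases Q S (yes e) = inj₂ (vanish Q S e)
    cases Q S (no ne) = inj₁ (R.trans (at (coef-δ Q S) (gen P)) (⊔-size P Q S ne))

  -- Connectedness: `∅` represents the only class of size 0.
  gen-empty : ∀ P → LPoset.size P ≡ 0 → (η ⟨$⟩ (ε ⟨$⟩ gen P)) A.≈ᴹ gen P
  gen-empty P e = A.≈ᴹ-trans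
    (A.*ₗ-congʳ (R.trans ([]-gen ∅ P) (𝟏-yes (P ≟ ∅) (≅-sym (size≡0⇒∅≅ P e)))))
    (A.≈ᴹ-trans (A.*ₗ-identityˡ _) (≋-relation (gen-cong (size≡0⇒∅≅ P e))))

  -- In the convolution of the reduced map with the preceding power, the reduced map kills a left
  -- factor of size 0; any other left factor leaves a right factor smaller than `P`, which the
  -- preceding power kills by induction.
  step-vanishes : ∀ n P → LPoset.size P ℕ.< n → (step n ⟨$⟩ gen P) A.≈ᴹ 𝟘
  step-vanishes (suc n) P (ℕ.s≤s P≤n) = A.≈ᴹ-trans (at (step-suc n) (gen P))
    (δ-vanishes (μ ∘ₗ reduced ⊗₁ step n) P λ Q S e → summand Q S e (LPoset.size Q ℕ.≟ 0))
    where
    reduced : A ⟶ A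
    reduced = K.1# K.- idₗ
    summand : ∀ Q S → LPoset.size Q ℕ.+ LPoset.size S ≡ LPoset.size P → Dec (LPoset.size Q ≡ 0) →
      ((μ ∘ₗ reduced ⊗₁ step n) ⟨$⟩ gen (gen Q , gen S)) A.≈ᴹ 𝟘
    summand Q S e (yes Q≡0) = A.≈ᴹ-trans
      (⟦⟧-cong (μ ∘ₗ insertʳ (step n ⟨$⟩ gen S)) {reduced ⟨$⟩ gen Q} {𝟘}
        (A.≈ᴹ-trans (A.+ᴹ-congʳ (gen-empty Q Q≡0)) (A.-ᴹ‿inverseʳ (gen Q))))
      (0ᴹ-homo (μ ∘ₗ insertʳ (step n ⟨$⟩ gen S)))
    summand Q S e (no Q≢0) = A.≈ᴹ-trans
      (⟦⟧-cong (μ ∘ₗ (pure A A ⟨$⟩ (reduced ⟨$⟩ gen Q))) {step n ⟨$⟩ gen S} {𝟘} (step-vanishes n S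
        (ℕ.<-≤-trans (ℕ.m<n+m (LPoset.size S) (ℕ.n≢0⇒n>0 Q≢0)) (ℕ.≤-trans (ℕ.≤-reflexive e) P≤n))))
      (0ᴹ-homo (μ ∘ₗ (pure A A ⟨$⟩ (reduced ⟨$⟩ gen Q))))

  geometric-suc-gen : ∀ n P → LPoset.size P ℕ.< n → (geometric (suc n) ⟨$⟩ gen P) A.≈ᴹ (geometric n ⟨$⟩ gen P)
  geometric-suc-gen n P lt = ≋-trans (at (geometric-suc n) (gen P))
    (≋-trans (⊕-cong (step-vanishes n P lt) ≋-refl) (⊕-identityˡ (geometric n ⟨$⟩ gen P)))

  geometric-stable : ∀ k n P → LPoset.size P ℕ.< n → (geometric (k ℕ.+ n) ⟨$⟩ gen P) A.≈ᴹ (geometric n ⟨$⟩ gen P)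
  geometric-stable zero    n P lt = A.≈ᴹ-refl
  geometric-stable (suc k) n P lt = ≋-trans
    (geometric-suc-gen (k ℕ.+ n) P (ℕ.<-≤-trans lt (ℕ.m≤n+m n k))) (geometric-stable k n P lt)

  -- The limit of the Neumann series: on a class of size k the partial sums are constant from length
  -- k + 1 on. The cut-off respects isomorphism because the size does.
  S : A ⟶ A
  S = extend (DecSetoid.setoid LPosets) A (record
    { to   = λ P → geometric (suc (LPoset.size P)) ⟨$⟩ gen P
    ; cong = λ {P} {Q} i → A.≈ᴹ-trans
        (⟦⟧-cong (geometric (suc (LPoset.size P))) {gen P} {gen Q} (≋-relation (gen-cong i)))
        (A.≈ᴹ-reflexive (cong (λ n → geometric (suc n) ⟨$⟩ gen Q) (≅-size i)))
    })

  S≈geometric : ∀ n P → LPoset.size P ℕ.< n → (S ⟨$⟩ gen P) A.≈ᴹ (geometric n ⟨$⟩ gen P)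
  S≈geometric n P lt = A.≈ᴹ-trans (A.≈ᴹ-sym (geometric-stable (n ℕ.∸ suc (LPoset.size P)) (suc (LPoset.size P))
      P ℕ.≤-refl))
    (A.≈ᴹ-reflexive (cong (λ m → geometric m ⟨$⟩ gen P) (ℕ.m∸n+n≡m lt)))

  module _ (P : LPoset) where
    private
      n : ℕ
      n = suc (LPoset.size P)
      G = geometric n
      open GroupProperties A.+ᴹ-group using (x∙y⁻¹≈ε⇒x≈y; x≈y⇒x∙y⁻¹≈ε)
      H = Hom (A ⊗ A) A
      module H = LeftModule H

      1-step : ((K.1# K.- step n) ⟨$⟩ gen P) A.≈ᴹ ((η ∘ₗ ε) ⟨$⟩ gen P)
      1-step = A.≈ᴹ-trans (A.+ᴹ-congˡ (A.≈ᴹ-trans (A.-ᴹ‿cong (step-vanishes n P ℕ.≤-refl)) -0≈0)) (A.+ᴹ-identityʳ _)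
        where
        open GroupProperties A.+ᴹ-group using () renaming (ε⁻¹≈ε to -0≈0)

    -- The factors in δ P are no larger than `P`, so on all of them `S` agrees with the single
    -- partial sum `G`. The difference of the two convolutions then falls under `δ-vanishes`, and
    -- ring algebra finishes with `G`.
    antipodeˡ-gen : ((μ ∘ₗ S ⊗₁ idₗ ∘ₗ δ) ⟨$⟩ gen P) A.≈ᴹ ((η ∘ₗ ε) ⟨$⟩ gen P)
    antipodeˡ-gen = A.≈ᴹ-trans
      (x∙y⁻¹≈ε⇒x≈y _ _ (δ-vanishes ((μ ∘ₗ S ⊗₁ idₗ) H.+ᴹ (H.-ᴹ (μ ∘ₗ G ⊗₁ idₗ))) P λ Q T e → x≈y⇒x∙y⁻¹≈ε
        (⟦⟧-cong (μ ∘ₗ insertʳ (gen T)) {S ⟨$⟩ gen Q} {G ⟨$⟩ gen Q}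
          (S≈geometric n Q (ℕ.s≤s (ℕ.≤-trans (ℕ.m≤m+n _ _) (ℕ.≤-reflexive e)))))))
      (A.≈ᴹ-trans (at (geometric*x n) (gen P)) 1-step)

    antipodeʳ-gen : ((μ ∘ₗ idₗ ⊗₁ S ∘ₗ δ) ⟨$⟩ gen P) A.≈ᴹ ((η ∘ₗ ε) ⟨$⟩ gen P)
    antipodeʳ-gen = A.≈ᴹ-trans
      (x∙y⁻¹≈ε⇒x≈y _ _ (δ-vanishes ((μ ∘ₗ idₗ ⊗₁ S) H.+ᴹ (H.-ᴹ (μ ∘ₗ idₗ ⊗₁ G))) P λ Q T e → x≈y⇒x∙y⁻¹≈ε
        (⟦⟧-cong (μ ∘ₗ (pure A A ⟨$⟩ gen Q)) {S ⟨$⟩ gen T} {G ⟨$⟩ gen T}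
          (S≈geometric n T (ℕ.s≤s (ℕ.≤-trans (ℕ.m≤n+m _ _) (ℕ.≤-reflexive e)))))))
      (A.≈ᴹ-trans (at (x*geometric n) (gen P)) 1-step)

  isHopfAlgebra : IsHopfAlgebra A μ η δ ε S
  isHopfAlgebra = record
    { isBialgebra = isBialgebra
    ; antipodeˡ   = ≗-on-generators A antipodeˡ-gen
    ; antipodeʳ   = ≗-on-generators A antipodeʳ-gen
    }

-- The continuous operations and their uniqueness

open import Defs

open LinearAlgebra ℤ[β]
open CutFunctionals ℤ[β] β using (A; _≟_; ∑ᴿ; ∑ᴿ-cong; pseudobasis-[]) renaming ([_] to coefficient)
open Bialgebra ℤ[β] β using (D; μ; δ; η; ε; coef-μ; coef-δ; coef-gen∅; δ-cocommutative)
open Antipode ℤ[β] β using (S; isHopfAlgebra)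

private
  D² : DualBasis (𝔪LPoset ⊗̂ 𝔪LPoset)
  D² = _⊗ᵈ_ {𝔪LPoset} {𝔪LPoset} D D

  pseudobasis-coef : ∀ P → LCModule.pairing 𝔪LPoset ⟨$⟩ [ P ] ≗ DualBasis.coef D P
  pseudobasis-coef P = mk (at (pseudobasis-[] P))

  tensor-coef : ∀ P Q → [ P ]⊗[ Q ] ≗ coefficient P ⊠ coefficient Q
  tensor-coef P Q = mk (at (⊠-cong (pseudobasis-[] P) (pseudobasis-[] Q)))

product-spec : IsLPosetProduct (adjoint (𝔪LPoset ⊗̂ 𝔪LPoset) 𝔪LPoset δ)
product-spec P Q = mk λ x → ℤ[β].trans (ℤ[β].sym (adjoint-isAdjoint (𝔪LPoset ⊗̂ 𝔪LPoset) 𝔪LPoset δ x [ P ]⊗[ Q ]))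
  (ℤ[β].trans (at (tensor-coef P Q) (δ ⟨$⟩ x))
  (ℤ[β].trans (at (coef-δ P Q) x)
    (ℤ[β].sym (at (pseudobasis-[] (P ⊔ Q)) x))))

pseudobasis² : LPoset × LPoset → LeftModule.Carrierᴹ (LCModule.B (𝔪LPoset ⊗̂ 𝔪LPoset))
pseudobasis² (P , Q) = [ P ]⊗[ Q ]

pseudobasis²-coef : ∀ x → LCModule.pairing (𝔪LPoset ⊗̂ 𝔪LPoset) ⟨$⟩ pseudobasis² x ≗ DualBasis.coef D² x
pseudobasis²-coef (P , Q) = mk (at (tensor-coef P Q))

≈ᶜ-on-pseudobasis² : ∀ f g →
  (∀ x → LeftModule._≈ᴹ_ (LCModule.B 𝔪LPoset) (toLinear f ⟨$⟩ pseudobasis² x) (toLinear g ⟨$⟩ pseudobasis² x)) →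
  _≈ᶜ_ (𝔪LPoset ⊗̂ 𝔪LPoset) 𝔪LPoset f g
≈ᶜ-on-pseudobasis² f g e = ≈ᶜ-on-pseudobasis (𝔪LPoset ⊗̂ 𝔪LPoset) 𝔪LPoset D² pseudobasis² pseudobasis²-coef {f} {g} e

product-unique : ∀ {∇} → IsLPosetProduct ∇ →
  _≈ᶜ_ (𝔪LPoset ⊗̂ 𝔪LPoset) 𝔪LPoset (adjoint (𝔪LPoset ⊗̂ 𝔪LPoset) 𝔪LPoset δ) ∇
product-unique {∇} is = ≈ᶜ-on-pseudobasis² (adjoint (𝔪LPoset ⊗̂ 𝔪LPoset) 𝔪LPoset δ) ∇ λ (P , Q) → mk λ x →
  ℤ[β].trans (at (product-spec P Q) x) (ℤ[β].sym (at (is P Q) x))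

sum-at : {I : Set} (L : List I) (f : I → A ⊗ A ⟶ 𝟙) (x : LeftModule.Carrierᴹ (A ⊗ A)) →
  sum (LCModule.B (𝔪LPoset ⊗̂ 𝔪LPoset)) (map f L) ⟨$⟩ x ℤ[β].≈ ∑ᴿ L (λ i → f i ⟨$⟩ x)
sum-at []      f x = ℤ[β].refl
sum-at (i ∷ L) f x = ℤ[β].+-congˡ {f i ⟨$⟩ x} (sum-at L f x)

coproduct-spec : IsLPosetCoproduct (adjoint 𝔪LPoset (𝔪LPoset ⊗̂ 𝔪LPoset) μ)
coproduct-spec P = mk λ x → ℤ[β].trans (ℤ[β].sym (adjoint-isAdjoint 𝔪LPoset (𝔪LPoset ⊗̂ 𝔪LPoset) μ x [ P ]))
  (ℤ[β].trans (at (pseudobasis-[] P) (μ ⟨$⟩ x))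
  (ℤ[β].trans (at (coef-μ P) x)
  (ℤ[β].trans (∑-at (A ⊗ A) 𝟙 (splittings P) _ x)
  (ℤ[β].trans
    (∑ᴿ-cong (splittings P) λ (S , U) →
      ℤ[β].*-congˡ {β^ ∣ S ∩ U ∣} (ℤ[β].sym (at (tensor-coef (restrict P S) (restrict P U)) x)))
    (ℤ[β].sym (sum-at (splittings P) _ x))))))

coproduct-unique : ∀ {Δ} → IsLPosetCoproduct Δ →
  _≈ᶜ_ 𝔪LPoset (𝔪LPoset ⊗̂ 𝔪LPoset) (adjoint 𝔪LPoset (𝔪LPoset ⊗̂ 𝔪LPoset) μ) Δ
coproduct-unique {Δ} is =
  ≈ᶜ-on-pseudobasis 𝔪LPoset (𝔪LPoset ⊗̂ 𝔪LPoset) D [_] pseudobasis-coef {adjoint 𝔪LPoset (𝔪LPoset ⊗̂ 𝔪LPoset) μ} {Δ}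
    λ P → mk λ x → ℤ[β].trans (at (coproduct-spec P) x) (ℤ[β].sym (at (is P) x))

unit-spec : IsLPosetUnit (adjoint 𝕂 𝔪LPoset ε)
unit-spec = mk λ x → ℤ[β].trans (ℤ[β].sym (adjoint-isAdjoint 𝕂 𝔪LPoset ε x ℤ[β].1#))
    (ℤ[β].trans (ℤ[β].*-identityʳ _) (ℤ[β].sym (at (pseudobasis-[] ∅) x)))

unit-unique : ∀ {ι} → IsLPosetUnit ι → _≈ᶜ_ 𝕂 𝔪LPoset (adjoint 𝕂 𝔪LPoset ε) ι
unit-unique {ι} is = ≈ᶜ-on-pseudobasis 𝕂 𝔪LPoset 𝕂-dualBasis (λ _ → ℤ[β].1#) (λ _ → mk ℤ[β].*-identityʳ)
  {adjoint 𝕂 𝔪LPoset ε} {ι} λ _ → mk λ x → ℤ[β].trans (at unit-spec x) (ℤ[β].sym (at is x))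

counit-spec : IsLPosetCounit (adjoint 𝔪LPoset 𝕂 η)
-- A scalar in `𝕂` equals its pairing with 1, and there the adjoint of `η` evaluates `[ P ]` on the
-- class of `∅`.
counit-spec P = ℤ[β].trans (ℤ[β].sym (ℤ[β].*-identityˡ _))
  (ℤ[β].trans (ℤ[β].sym (adjoint-isAdjoint 𝔪LPoset 𝕂 η ℤ[β].1# [ P ]))
  (ℤ[β].trans (at (pseudobasis-[] P) (ℤ[β].1# ⊙ gen ∅))
  (ℤ[β].trans (coef-gen∅ P ℤ[β].1#)
  (ℤ[β].trans (ℤ[β].*-identityˡ _)
  (𝟏-⇔ (mk⇔ (λ i → sym (≅-size i)) (size≡0⇒∅≅ P)) (∅ ≟ P) (LPoset.size P ℕ.≟ 0))))))

counit-unique : ∀ {κ} → IsLPosetCounit κ → _≈ᶜ_ 𝔪LPoset 𝕂 (adjoint 𝔪LPoset 𝕂 η) κ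
counit-unique {κ} is = ≈ᶜ-on-pseudobasis 𝔪LPoset 𝕂 D [_] pseudobasis-coef {adjoint 𝔪LPoset 𝕂 η} {κ}
  λ P → ℤ[β].trans (counit-spec P) (ℤ[β].sym (is P))

module _ (∇ : ContinuousLinear (𝔪LPoset ⊗̂ 𝔪LPoset) 𝔪LPoset) (is : IsLPosetProduct ∇) where

  -- Uniqueness identifies an arbitrary `∇` having the prescribed values with the constructed one,
  -- so both share the adjoint `δ`.
  ∇-adjoint : IsAdjoint (𝔪LPoset ⊗̂ 𝔪LPoset) 𝔪LPoset ∇ δ
  ∇-adjoint = isAdjoint-resp-≈ᶜ (𝔪LPoset ⊗̂ 𝔪LPoset) 𝔪LPoset {adjoint (𝔪LPoset ⊗̂ 𝔪LPoset) 𝔪LPoset δ} {∇} {δ}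
      (product-unique {∇} is) (adjoint-isAdjoint (𝔪LPoset ⊗̂ 𝔪LPoset) 𝔪LPoset δ)

  -- Under the pairing `τ` becomes precomposition with `⊗-swap`, so this is dual to the
  -- cocommutativity of `δ`.
  ∇-commutative : toLinear ∇ ∘ₗ τ 𝔪LPoset ≗ toLinear ∇
  ∇-commutative = mk λ b → mk λ x → ℤ[β].trans (ℤ[β].sym (∇-adjoint x (τ 𝔪LPoset ⟨$⟩ b)))
    (ℤ[β].trans (⟦⟧-cong b (at δ-cocommutative x)) (∇-adjoint x b))

isLCHopfAlgebra : ∀ ∇ ι Δ κ → IsLPosetProduct ∇ → IsLPosetUnit ι → IsLPosetCoproduct Δ → IsLPosetCounit κ →
  IsLCHopfAlgebra 𝔪LPoset ∇ ι Δ κ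
isLCHopfAlgebra ∇ ι Δ κ is-∇ is-ι is-Δ is-κ = record
    { antipode         = adjoint 𝔪LPoset 𝔪LPoset S
    ; ∇*               = δ
    ; ι*               = ε
    ; Δ*               = μ
    ; ε*               = η
    ; S*               = S
    ; ∇-adjoint        = ∇-adjoint ∇ is-∇
    ; ι-adjoint        = isAdjoint-resp-≈ᶜ 𝕂 𝔪LPoset {adjoint 𝕂 𝔪LPoset ε} {ι} {ε} (unit-unique {ι} is-ι)
        (adjoint-isAdjoint 𝕂 𝔪LPoset ε)
    ; Δ-adjoint        = isAdjoint-resp-≈ᶜ 𝔪LPoset (𝔪LPoset ⊗̂ 𝔪LPoset) {adjoint 𝔪LPoset (𝔪LPoset ⊗̂ 𝔪LPoset) μ}
        {Δ} {μ} (coproduct-unique {Δ} is-Δ) (adjoint-isAdjoint 𝔪LPoset (𝔪LPoset ⊗̂ 𝔪LPoset) μ)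
    ; ε-adjoint        = isAdjoint-resp-≈ᶜ 𝔪LPoset 𝕂 {adjoint 𝔪LPoset 𝕂 η} {κ} {η} (counit-unique {κ} is-κ)
        (adjoint-isAdjoint 𝔪LPoset 𝕂 η)
    ; antipode-adjoint = adjoint-isAdjoint 𝔪LPoset 𝔪LPoset S
    ; isHopfAlgebra    = isHopfAlgebra
    }

isCommutativeLCHopfAlgebra : ∀ ∇ ι Δ κ → IsLPosetProduct ∇ → IsLPosetUnit ι → IsLPosetCoproduct Δ → IsLPosetCounit κ →
  IsCommutativeLCHopfAlgebra 𝔪LPoset ∇ ι Δ κ
isCommutativeLCHopfAlgebra ∇ ι Δ κ is-∇ is-ι is-Δ is-κ = record
  { isLCHopfAlgebra = isLCHopfAlgebra ∇ ι Δ κ is-∇ is-ι is-Δ is-κ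
  ; commutative     = ∇-commutative ∇ is-∇
  }

theorem3p4 : ∃! (_≈ᶜ_ (𝔪LPoset ⊗̂ 𝔪LPoset) 𝔪LPoset) IsLPosetProduct ×
    ∃! (_≈ᶜ_ 𝔪LPoset (𝔪LPoset ⊗̂ 𝔪LPoset)) IsLPosetCoproduct ×
    ∃! (_≈ᶜ_ 𝕂 𝔪LPoset) IsLPosetUnit ×
    ∃! (_≈ᶜ_ 𝔪LPoset 𝕂) IsLPosetCounit ×
    (∀ ∇ ι Δ ε →
    IsLPosetProduct ∇ → IsLPosetUnit ι → IsLPosetCoproduct Δ → IsLPosetCounit ε →
    IsCommutativeLCHopfAlgebra 𝔪LPoset ∇ ι Δ ε)
theorem3p4 =
    (adjoint (𝔪LPoset ⊗̂ 𝔪LPoset) 𝔪LPoset δ , product-spec , λ {∇} → product-unique {∇})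
  , (adjoint 𝔪LPoset (𝔪LPoset ⊗̂ 𝔪LPoset) μ , coproduct-spec , λ {Δ} → coproduct-unique {Δ})
  , (adjoint 𝕂 𝔪LPoset ε , unit-spec , λ {ι} → unit-unique {ι})
  , (adjoint 𝔪LPoset 𝕂 η , counit-spec , λ {κ} → counit-unique {κ})
  , isCommutativeLCHopfAlgebra
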